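{- Let $G$ be a (simple, finite) bipartite graph with bipartition $(X,Y)$ such that every vertex of $X$ has degree at most $2$ and every vertex of $Y$ has degree at most $3$. If $G$ contains no cycle of length $4$, then $\chi_s'(G) \le 5$.
   Context: A strong edge coloring of a graph $G$ is a proper edge coloring in which each color class is an induced matching of $G$; equivalently, any two distinct edges at distance at most two (i.e., edges that share a vertex or are joined by an edge) receive distinct colors. The strong chromatic index $\chi_s'(G)$ is the minimum number of colors in a strong edge coloring of $G$. In the paper this class of graphs is denoted $B_{2,3}$. -}

module Defs where

open import Data.Nat using (ℕ; _≤_)
open import Data.Bool using (Bool; true; false; T)
open import Data.Fin using (Fin)
open import Data.List using (List; length; filter; allFin)
open import Data.Product using (Σ; _×_; _,_)
open import Data.Sum using (_⊎_)
open import Data.Empty using (⊥)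
open import Relation.Nullary using (¬_)
open import Relation.Binary.PropositionalEquality using (_≡_; _≢_)
open import Data.Bool.Properties using (T?)

record Graph (n : ℕ) : Set where
  field
    adj   : Fin n → Fin n → Bool
    sym   : ∀ u v → adj u v ≡ adj v u
    irrefl : ∀ v → adj v v ≡ false

open Graph public

Adj : ∀ {n} → Graph n → Fin n → Fin n → Set
Adj G u v = T (adj G u v)

degree : ∀ {n} → Graph n → Fin n → ℕ
degree {n} G v = length (filter (λ w → T? (adj G v w)) (allFin n))

-- (X , Y) bipartition given by side : X = vertices with side true,
-- Y = vertices with side false; every edge joins X to Y.
IsBipartition : ∀ {n} → Graph n → (Fin n → Bool) → Set
IsBipartition G side = ∀ u v → Adj G u v → side u ≢ side v

HasC4 : ∀ {n} → Graph n → Set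
HasC4 {n} G = Σ (Fin n) λ a → Σ (Fin n) λ b → Σ (Fin n) λ c → Σ (Fin n) λ d →
  (a ≢ b) × (a ≢ c) × (a ≢ d) × (b ≢ c) × (b ≢ d) × (c ≢ d) ×
  Adj G a b × Adj G b c × Adj G c d × Adj G d a

SameEdge : ∀ {n} → Fin n → Fin n → Fin n → Fin n → Set
SameEdge u v w z = (u ≡ w × v ≡ z) ⊎ (u ≡ z × v ≡ w)

WithinDistTwo : ∀ {n} → Graph n → Fin n → Fin n → Fin n → Fin n → Set
WithinDistTwo G u v w z =
  (u ≡ w ⊎ u ≡ z ⊎ v ≡ w ⊎ v ≡ z) ⊎
  (Adj G u w ⊎ Adj G u z ⊎ Adj G v w ⊎ Adj G v z)

record StrongEdgeColoring {n} (G : Graph n) (k : ℕ) : Set where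
  field
    colour     : (u v : Fin n) → Adj G u v → Fin k
    colour-sym : ∀ u v (e : Adj G u v) (e' : Adj G v u) → colour u v e ≡ colour v u e'
    strong     : ∀ u v w z (e : Adj G u v) (f : Adj G w z) →
                 ¬ SameEdge u v w z → WithinDistTwo G u v w z →
                 colour u v e ≢ colour w z f

StrongChromaticIndex≤ : ∀ {n} → Graph n → ℕ → Set
StrongChromaticIndex≤ G k = StrongEdgeColoring G k

{-# OPTIONS --safe #-}
module Submission where

-- Contract every vertex of X of degree two to an edge joining its neighbours, and keep the pendant
-- vertices of X as leaves. Without 4-cycles this gives a simple graph H of maximum degree 3, in which an
-- edge yx of G becomes the arc from y to the other end of x. A strong edge colouring of G is the same as
-- a colouring c of these arcs such that c v is injective on the neighbours of v, and c v w ≢ c w u.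
--
-- A connected piece with a vertex of degree at most two is coloured recursively from a root. A cubic
-- component is split into a connected part K and a rest R in which every vertex has degree two: move
-- vertices from R to K as long as R keeps as many edges as vertices. K is coloured so that every arc
-- from K to R has colour B m and every arc back can get B (not m); then the A colours suffice for going
-- around the cycle R, and the freedom in m closes it up. If the vertex of K where the cycle is closed is
-- a cut vertex of K, another one is chosen or the component has a bridge; vertices of K with several
-- neighbours in R lead to smaller R, or to K₄ or K₃,₃.

open import Defs hiding (adj; sym; irrefl)
open import Data.Nat using (ℕ; zero; suc; _+_; _≤_; _<_; z≤n; s≤s; _≤?_)
open import Data.Nat.Properties
  using (≤-trans; ≤-reflexive; ≤-pred; ≤-refl; ≤-antisym; <-≤-trans; ≰⇒>; <⇒≱; n≤1+n;
         +-assoc; +-comm; +-identityʳ; +-mono-≤; +-monoʳ-≤; +-monoˡ-≤; +-cancelʳ-≤)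
open import Data.Nat.Solver using (module +-*-Solver)
open import Data.Fin using (Fin; zero; suc; _≟_; #_)
open import Data.Fin.Properties using (any?; all?)
open import Data.Bool using (Bool; true; false; not; _∧_; _∨_; if_then_else_; T)
open import Data.Bool.Properties as Bool using (∧-assoc; ∧-comm)
open import Data.List using (length; filter; tabulate)
open import Data.Unit using (⊤; tt)
open import Data.Product using (∃; _×_; _,_; proj₁; proj₂)
open import Data.Sum as Sum using (_⊎_; inj₁; inj₂)
open import Data.Empty using (⊥; ⊥-elim)
open import Function using (_∘_)
open import Relation.Nullary using (¬_; Dec; yes; no; does)
open import Relation.Nullary.Decidable using (_×-dec_; _⊎-dec_; _→-dec_; ¬?; dec-true; decidable-stable)
open import Relation.Binary.PropositionalEquality

-- The arcs leaving a vertex must have distinct colours and avoid the colours entering it; entering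
-- arcs may agree with one another. Three leaving arcs thus leave two of five colours for the
-- entering ones. A vertex of the cycle sends two A colours along the cycle and a B colour into `K`,
-- so both arcs entering it along the cycle carry the third A colour, and the arc from `K` carries
-- the other B colour. This forces the A colours to repeat with period three, so a cycle of
-- arbitrary length does not close up in this way. One vertex `z` is therefore exceptional: it sends
-- the two B colours to its cycle neighbours `a` and `b`, and an A colour into `K`. Then the arcs
-- from `a` and `b` into `K` must carry opposite B colours, so `M` must differ at their heads `σ`
-- and `τ`, and the edge between `z` and `K` must carry A colours both ways. These two demands shape
-- the rooted colouring: `M` is prescribed at two vertices, and two A colours at the root are
-- guaranteed only when `K` without the root is connected. Hence the care about cut vertices.

sumF : ∀ {n} → (Fin n → ℕ) → ℕ
sumF {zero} f = 0
sumF {suc n} f = f zero + sumF (f ∘ suc)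

sum-cong : ∀ {n} {f g : Fin n → ℕ} → (∀ i → f i ≡ g i) → sumF f ≡ sumF g
sum-cong {zero} e = refl
sum-cong {suc n} e = cong₂ _+_ (e zero) (sum-cong (e ∘ suc))

sum-mono : ∀ {n} {f g : Fin n → ℕ} → (∀ i → f i ≤ g i) → sumF f ≤ sumF g
sum-mono {zero} e = z≤n
sum-mono {suc n} e = +-mono-≤ (e zero) (sum-mono (e ∘ suc))

sum-0 : ∀ {n} → sumF {n} (λ _ → 0) ≡ 0
sum-0 {zero} = refl
sum-0 {suc n} = sum-0 {n}

+-interchange : ∀ a b c d → (a + b) + (c + d) ≡ (a + c) + (b + d)
+-interchange = solve 4 (λ a b c d → (a :+ b) :+ (c :+ d) := (a :+ c) :+ (b :+ d)) refl
  where open +-*-Solver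

sum-+ : ∀ {n} (f g : Fin n → ℕ) → sumF (λ i → f i + g i) ≡ sumF f + sumF g
sum-+ {zero} f g = refl
sum-+ {suc n} f g = trans (cong (f zero + g zero +_) (sum-+ (f ∘ suc) (g ∘ suc)))
  (+-interchange (f zero) (g zero) _ _)

onlyAt : ∀ {n} → Fin n → Fin n → ℕ → ℕ
onlyAt x i k = if does (i ≟ x) then k else 0

sum-onlyAt : ∀ {n} (x : Fin n) (f : Fin n → ℕ) → sumF (λ i → onlyAt x i (f i)) ≡ f x
sum-onlyAt {suc n} zero f = trans (cong (f zero +_) (sum-0 {n})) (+-identityʳ _)
sum-onlyAt {suc n} (suc x) f = trans (sum-cong λ i → shift i) (sum-onlyAt x (f ∘ suc))
  where
  shift : ∀ i → onlyAt (suc x) (suc i) (f (suc i)) ≡ onlyAt x i (f (suc i))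
  shift i with i ≟ x
  ... | yes _ = refl
  ... | no _ = refl

ind : Bool → ℕ
ind true = 1
ind false = 0

bool? : (b : Bool) → b ≡ true ⊎ b ≡ false
bool? true = inj₁ refl
bool? false = inj₂ refl

t≢f : ∀ {b} → b ≡ true → b ≡ false → ⊥
t≢f refl ()

-- Sets of vertices and sums

module Subsets {n : ℕ} where

  V : Set
  V = Fin n

  Sub : Set
  Sub = V → Bool

  infix 4 _∋_ _∌_
  _∋_ _∌_ : Sub → V → Set
  D ∋ v = D v ≡ true
  D ∌ v = D v ≡ false

  ¬∋⇒∌ : ∀ (D : Sub) {v} → ¬ D ∋ v → D ∌ v
  ¬∋⇒∌ D {v} q with D v
  ... | true = ⊥-elim (q refl)
  ... | false = refl

  add del : Sub → V → Sub
  add D r v = does (v ≟ r) ∨ D v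
  del D r v = not (does (v ≟ r)) ∧ D v

  add-new : ∀ (D : Sub) r → add D r ∋ r
  add-new D r with r ≟ r
  ... | yes _ = refl
  ... | no q = ⊥-elim (q refl)

  add-old : ∀ (D : Sub) r {v} → D ∋ v → add D r ∋ v
  add-old D r {v} p with v ≟ r
  ... | yes _ = refl
  ... | no _ = p

  add-inv : ∀ (D : Sub) r {v} → add D r ∋ v → v ≡ r ⊎ D ∋ v
  add-inv D r {v} p with v ≟ r
  ... | yes q = inj₁ q
  ... | no _ = inj₂ p

  add-∌ : ∀ (D : Sub) r {v} → v ≢ r → D ∌ v → add D r ∌ v
  add-∌ D r {v} q p with v ≟ r
  ... | yes e = ⊥-elim (q e)
  ... | no _ = p

  add-∌-inv : ∀ (D : Sub) r {v} → add D r ∌ v → v ≢ r × D ∌ v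
  add-∌-inv D r {v} p with v ≟ r
  add-∌-inv D r {v} () | yes e
  ... | no q = q , p

  del-self : ∀ (D : Sub) r → del D r ∌ r
  del-self D r with r ≟ r
  ... | yes _ = refl
  ... | no q = ⊥-elim (q refl)

  del-in : ∀ (D : Sub) r {v} → v ≢ r → D ∋ v → del D r ∋ v
  del-in D r {v} q p with v ≟ r
  ... | yes e = ⊥-elim (q e)
  ... | no _ = p

  del-inv : ∀ (D : Sub) r {v} → del D r ∋ v → v ≢ r × D ∋ v
  del-inv D r {v} p with v ≟ r
  del-inv D r {v} () | yes e
  ... | no q = q , p

  del-∌ : ∀ (D : Sub) r {v} → del D r ∌ v → v ≡ r ⊎ D ∌ v
  del-∌ D r {v} p with v ≟ r
  ... | yes e = inj₁ e
  ... | no _ = inj₂ p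

  del-∌ˡ : ∀ (D : Sub) r {v} → D ∌ v → del D r ∌ v
  del-∌ˡ D r {v} p with v ≟ r
  ... | yes e = refl
  ... | no _ = p

  size : Sub → ℕ
  size D = sumF (ind ∘ D)

  size-del : ∀ (D : Sub) r → D ∋ r → size D ≡ suc (size (del D r))
  size-del D r p = trans (sum-cong split)
    (trans (sum-+ (λ i → onlyAt r i 1) _) (cong (_+ size (del D r)) (sum-onlyAt r (λ _ → 1))))
    where
    split : ∀ i → ind (D i) ≡ onlyAt r i 1 + ind (del D r i)
    split i with i ≟ r
    ... | yes refl rewrite p = refl
    ... | no _ = refl

  size-mono : ∀ {D E : Sub} → (∀ v → D ∋ v → E ∋ v) → size D ≤ size E
  size-mono {D} {E} s = sum-mono le
    where
    le : ∀ i → ind (D i) ≤ ind (E i)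
    le i with D i in d
    ... | false = z≤n
    ... | true rewrite s i d = ≤-refl

-- Subcubic graphs, the five colours and their permutations

record Subcubic (n : ℕ) : Set where
  field
    adj   : Fin n → Fin n → Bool
    ~-symᵇ  : ∀ v w → adj v w ≡ adj w v
    irr   : ∀ v → adj v v ≡ false
    deg≤3 : ∀ v {a b c d} → adj v a ≡ true → adj v b ≡ true → adj v c ≡ true → adj v d ≡ true →
            a ≢ b → a ≢ c → a ≢ d → b ≢ c → b ≢ d → c ≢ d → ⊥

-- The five colours are split into three colours A t and two colours B m.
data Tri : Set where
  t₀ t₁ t₂ : Tri

data Col : Set where
  A : Tri → Col
  B : Bool → Col

_≟ᵗ_ : (x y : Tri) → Dec (x ≡ y)
t₀ ≟ᵗ t₀ = yes refl
t₀ ≟ᵗ t₁ = no λ ()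
t₀ ≟ᵗ t₂ = no λ ()
t₁ ≟ᵗ t₀ = no λ ()
t₁ ≟ᵗ t₁ = yes refl
t₁ ≟ᵗ t₂ = no λ ()
t₂ ≟ᵗ t₀ = no λ ()
t₂ ≟ᵗ t₁ = no λ ()
t₂ ≟ᵗ t₂ = yes refl

A-inj : ∀ {x y} → A x ≡ A y → x ≡ y
A-inj refl = refl

B-inj : ∀ {x y} → B x ≡ B y → x ≡ y
B-inj refl = refl

_≟ᶜ_ : (x y : Col) → Dec (x ≡ y)
A x ≟ᶜ A y with x ≟ᵗ y
... | yes refl = yes refl
... | no q = no λ e → q (A-inj e)
A x ≟ᶜ B y = no λ ()
B x ≟ᶜ A y = no λ ()
B x ≟ᶜ B y with x Bool.≟ y
... | yes refl = yes refl
... | no q = no λ e → q (B-inj e)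

data isA : Col → Set where
  isa : ∀ {t} → isA (A t)

A≢B : ∀ {x m} → isA x → x ≢ B m
A≢B isa ()

swapᶜ : Col → Col → Col → Col
swapᶜ x y z with z ≟ᶜ x
... | yes _ = y
... | no _ with z ≟ᶜ y
...   | yes _ = x
...   | no _ = z

swapᶜ-l : ∀ x y → swapᶜ x y x ≡ y
swapᶜ-l x y with x ≟ᶜ x
... | yes _ = refl
... | no q = ⊥-elim (q refl)

swapᶜ-other : ∀ x y z → z ≢ x → z ≢ y → swapᶜ x y z ≡ z
swapᶜ-other x y z p q with z ≟ᶜ x
... | yes e = ⊥-elim (p e)
... | no _ with z ≟ᶜ y
...   | yes e = ⊥-elim (q e)
...   | no _ = refl

swapᶜ-r : ∀ x y → swapᶜ x y y ≡ x
swapᶜ-r x y with y ≟ᶜ x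
... | yes e = e
... | no _ with y ≟ᶜ y
...   | yes _ = refl
...   | no q = ⊥-elim (q refl)

swapᶜ-invol : ∀ x y z → swapᶜ x y (swapᶜ x y z) ≡ z
swapᶜ-invol x y z with z ≟ᶜ x
... | yes refl = swapᶜ-r x y
... | no p with z ≟ᶜ y
...   | yes refl = swapᶜ-l x y
...   | no q = swapᶜ-other x y z p q

swapᶜ-inj : ∀ x y {z w} → swapᶜ x y z ≡ swapᶜ x y w → z ≡ w
swapᶜ-inj x y {z} {w} e =
  trans (sym (swapᶜ-invol x y z)) (trans (cong (swapᶜ x y) e) (swapᶜ-invol x y w))

swapᶜ-A : ∀ x y {z} → isA z → isA (swapᶜ (A x) (A y) z)
swapᶜ-A x y {z} p with z ≟ᶜ A x
... | yes _ = isa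
... | no _ with z ≟ᶜ A y
...   | yes _ = isa
...   | no _ = p

-- The permutation taking `a` to `a'` and `b` to `b'`: the second transposition acts on the image of
-- `b` under the first.
move : Col → Col → Col → Col → Col → Col
move a b a' b' z = swapᶜ (swapᶜ a a' b) b' (swapᶜ a a' z)

module _ (a b a' b' : Col) where

  move-inj : ∀ {z w} → move a b a' b' z ≡ move a b a' b' w → z ≡ w
  move-inj e = swapᶜ-inj a a' (swapᶜ-inj _ b' e)

  move-a : a ≢ b → a' ≢ b' → move a b a' b' a ≡ a'
  move-a p q = trans (cong (swapᶜ (swapᶜ a a' b) b') (swapᶜ-l a a'))
    (swapᶜ-other _ b' a' (λ e → p (swapᶜ-inj a a' (trans (swapᶜ-l a a') e))) q)

  move-b : move a b a' b' b ≡ b'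
  move-b = swapᶜ-l (swapᶜ a a' b) b'

not-≢ : ∀ b → b ≢ not b
not-≢ true ()
not-≢ false ()

-- Connectivity in graphs of maximum degree three

module SubcubicGraph {n : ℕ} (H : Subcubic n) where
  open Subcubic H public
  open Subsets {n} public

  infix 4 _~_
  _~_ : V → V → Set
  v ~ w = adj v w ≡ true

  ~-sym : ∀ {v w} → v ~ w → w ~ v
  ~-sym {v} {w} p = trans (~-symᵇ w v) p

  ~⇒≢ : ∀ {v w} → v ~ w → v ≢ w
  ~⇒≢ {v} p refl = t≢f p (irr v)

  _~?_ : ∀ v w → Dec (v ~ w)
  v ~? w = adj v w Bool.≟ true

  _∋?_ : ∀ (D : Sub) v → Dec (D ∋ v)
  D ∋? v = D v Bool.≟ true

  _∌?_ : ∀ (D : Sub) v → Dec (D ∌ v)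
  D ∌? v = D v Bool.≟ false

  -- Connectedness without paths: a subset closed under adjacency in D is empty or all of D.
  Conn : Sub → Set
  Conn D = ∀ (S : Sub) → (∀ {v w} → D ∋ v → D ∋ w → v ~ w → S ∋ v → S ∋ w) →
           ∀ {v w} → D ∋ v → D ∋ w → S ∋ v → S ∋ w

  conn-add : ∀ (D : Sub) {w u} → Conn D → D ∋ u → u ~ w → Conn (add D w)
  conn-add D {w} {u} con du uw S cl {x} {y} dx dy sx = reach
    where
    inD : ∀ {a b} → D ∋ a → D ∋ b → S ∋ a → S ∋ b
    inD = con S (λ da db → cl (add-old D w da) (add-old D w db))
    su : S ∋ u
    su with add-inv D w dx
    ... | inj₁ refl = cl dx (add-old D w du) (~-sym uw) sx
    ... | inj₂ d = inD d du sx
    reach : S ∋ y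
    reach with add-inv D w dy
    ... | inj₁ refl = cl (add-old D w du) dy uw su
    ... | inj₂ d = inD du d su

  only : V → Sub
  only v w = does (w ≟ v)

  only-self : ∀ v → only v ∋ v
  only-self v with v ≟ v
  ... | yes _ = refl
  ... | no q = ⊥-elim (q refl)

  only-inv : ∀ v {w} → only v ∋ w → w ≡ v
  only-inv v {w} p with w ≟ v
  ... | yes e = e
  only-inv v {w} () | no _

  only-conn : ∀ v → Conn (only v)
  only-conn v S cl dx dy sx = subst (S ∋_) (trans (only-inv v dx) (sym (only-inv v dy))) sx

  record Comp (W : Sub) (s : V) : Set where
    field
      C    : Sub
      ⊆W   : ∀ {v} → C ∋ v → W ∋ v
      root : C ∋ s
      clo  : ∀ {v w} → C ∋ v → W ∋ w → v ~ w → C ∋ w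
      conn : Conn C

  -- Grown from `s` one vertex at a time; the number of vertices of `W` not yet reached bounds the
  -- rounds. Connectedness is maintained during the growth, as there are no paths from which to
  -- recover it afterwards.
  comp : (W : Sub) {s : V} → W ∋ s → Comp W s
  comp W {s} ws = go (size W) (only s) (λ p → subst (W ∋_) (sym (only-inv s p)) ws) (only-self s)
    (only-conn s) (size-mono {λ v → W v ∧ not (only s v)} {W} ∧-l)
    where
    ∧-l : ∀ {a b : V → Bool} v → a v ∧ b v ≡ true → a v ≡ true
    ∧-l {a} v p with a v
    ... | true = refl
    rest : Sub → Sub
    rest C v = W v ∧ not (C v)
    go : ∀ k (C : Sub) → (∀ {v} → C ∋ v → W ∋ v) → C ∋ s → Conn C → size (rest C) ≤ k → Comp W s
    go k C sub cs con le with any? (λ v → any? (λ w → ((C ∋? v) ×-dec (W ∋? w)) ×-dec ((v ~? w) ×-dec (C ∌? w))))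
    ... | no q = record
      { C = C ; ⊆W = sub ; root = cs ; conn = con
      ; clo = λ {v} {w} cv ww vw → closed cv ww vw (bool? (C w)) }
      where
      closed : ∀ {v w} → C ∋ v → W ∋ w → v ~ w → C ∋ w ⊎ C ∌ w → C ∋ w
      closed cv ww vw (inj₁ y) = y
      closed {v} {w} cv ww vw (inj₂ x) = ⊥-elim (q (v , w , (cv , ww) , vw , x))
    ... | yes (v , w , (cv , ww) , vw , cw) = grow k le
      where
      rw : rest C ∋ w
      rw rewrite ww | cw = refl
      sub' : ∀ {x} → add C w ∋ x → W ∋ x
      sub' p with add-inv C w p
      ... | inj₁ refl = ww
      ... | inj₂ y = sub y
      less : ∀ x → rest (add C w) ∋ x → del (rest C) w ∋ x
      less x p with x ≟ w
      ... | no _ = p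
      less x p | yes _ with W x
      less x () | yes _ | true
      less x () | yes _ | false
      grow : ∀ k → size (rest C) ≤ k → Comp W s
      grow zero le₀ with ≤-trans (≤-reflexive (sym (size-del (rest C) w rw))) le₀
      ... | ()
      grow (suc k) le₁ = go k (add C w) sub' (add-old C w cs) (conn-add C con cv vw)
        (≤-trans (size-mono {rest (add C w)} {del (rest C) w} less)
          (≤-pred (≤-trans (≤-reflexive (sym (size-del (rest C) w rw))) le₁)))

swapᶜ-isA : ∀ {x y z} → isA x → isA y → isA z → isA (swapᶜ x y z)
swapᶜ-isA (isa {x}) (isa {y}) p = swapᶜ-A x y p

swapᶜ-B : ∀ {x y} → isA x → isA y → ∀ m → swapᶜ x y (B m) ≡ B m
swapᶜ-B (isa {x}) (isa {y}) m = swapᶜ-other (A x) (A y) (B m) (λ ()) (λ ())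

-- Coloured pieces with open ends

module Pieces {n : ℕ} (H : Subcubic n) where
  open SubcubicGraph H public

  Colouring : Set
  Colouring = V → V → Col

  module _ (D : Sub) (r p : V) where
    -- The edge from the root to its parent is not an open end: its two arcs are governed by `a` and
    -- `b`.
    Out : V → V → Set
    Out v w = v ~ w × D ∌ w × ¬ (v ≡ r × w ≡ p)

  -- A colouring of the arcs with tail in D; the arc from the root r to its parent p gets colour a, and
  -- b is available for the arc back. A vertex v with a single open neighbour w has c v w ≡ B (M v), so
  -- it can later accept B (not (M v)): an edge between two such vertices may be added if M separates them.
  -- All conditions are invariant under permutations of the A colours.
  record Off (D : Sub) (r p : V) (M : V → Bool) (a b : Col) : Set where
    field
      c      : Colouring
      dist   : ∀ {v w w'} → D ∋ v → v ~ w → v ~ w' → c v w ≡ c v w' → w ≡ w'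
      inn    : ∀ {v w u} → D ∋ v → D ∋ w → v ~ w → w ~ u → c v w ≢ c w u
      rp     : c r p ≡ a
      fr     : ∀ {u} → r ~ u → c r u ≢ b
      sing   : ∀ {v w} → D ∋ v → Out D r p v w → (∀ {w'} → Out D r p v w' → w' ≡ w) →
               c v w ≡ B (M v) × (∀ {u} → D ∋ u → v ~ u → isA (c v u))
      dbl    : ∀ {v w w'} → D ∋ v → Out D r p v w → Out D r p v w' → w ≢ w' →
               ∀ {u} → D ∋ u → v ~ u → isA (c v u) × isA (c u v)
      -- At the root the parent counts as an inner neighbour, so the A conditions of `sing` and
      -- `dbl` carry over to `a` and `b`.
      rootA  : ∀ {w} → Out D r p r w → isA a
      rootA₂ : ∀ {w w'} → Out D r p r w → Out D r p r w' → w ≢ w' → isA b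

  module _ {D : Sub} {r p : V} {M : V → Bool} {a b : Col} (f : Col → Col) (f-inj : ∀ {x y} → f x ≡ f y → x ≡ y)
           (f-A : ∀ {x} → isA x → isA (f x)) (f-B : ∀ m → f (B m) ≡ B m) where
    Off-map : Off D r p M a b → Off D r p M (f a) (f b)
    Off-map o = record
      { c = λ v w → f (c v w)
      ; dist = λ dv vw vw' e → dist dv vw vw' (f-inj e)
      ; inn = λ dv dw vw wu e → inn dv dw vw wu (f-inj e)
      ; rp = cong f rp
      ; fr = λ ru e → fr ru (f-inj e)
      ; sing = λ {v} dv ow un → trans (cong f (proj₁ (sing dv ow un))) (f-B (M v)) ,
                 λ du vu → f-A (proj₂ (sing dv ow un) du vu)
      ; dbl = λ dv ow ow' ne du vu → f-A (proj₁ (dbl dv ow ow' ne du vu)) , f-A (proj₂ (dbl dv ow ow' ne du vu))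
      ; rootA = λ ow → f-A (rootA ow)
      ; rootA₂ = λ ow ow' ne → f-A (rootA₂ ow ow' ne) }
      where open Off o

  module _ {D : Sub} {r p : V} {M : V → Bool} where
    -- Permutations of the A colours act transitively on ordered pairs of distinct A colours, and
    -- they fix the B colours as `Off-map` requires.
    recolAA : ∀ {t s t' s'} → Off D r p M (A t) (A s) → t ≢ s → t' ≢ s' → Off D r p M (A t') (A s')
    recolAA {t} {s} {t'} {s'} o q q' = subst₂ (Off D r p M)
      (move-a (A t) (A s) (A t') (A s') (λ e → q (A-inj e)) (λ e → q' (A-inj e))) (move-b (A t) (A s) (A t') (A s'))
      (Off-map (move (A t) (A s) (A t') (A s')) (move-inj (A t) (A s) (A t') (A s'))
        (λ {z} x → swapᶜ-isA {X} {A s'} x₁ isa (swapᶜ-A t t' x))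
        (λ m → trans (cong (swapᶜ X (A s')) (swapᶜ-B (isa {t}) (isa {t'}) m)) (swapᶜ-B {X} {A s'} x₁ isa m)) o)
      where
      X = swapᶜ (A t) (A t') (A s)
      x₁ = swapᶜ-A t t' (isa {s})

    recolAB : ∀ {t t' m} → Off D r p M (A t) (B m) → Off D r p M (A t') (B m)
    recolAB {t} {t'} {m} o = subst₂ (Off D r p M) (swapᶜ-l (A t) (A t')) (swapᶜ-B (isa {t}) (isa {t'}) m)
      (Off-map (swapᶜ (A t) (A t')) (swapᶜ-inj (A t) (A t')) (swapᶜ-A t t') (swapᶜ-B (isa {t}) (isa {t'})) o)

    recolBA : ∀ {t t' m} → Off D r p M (B m) (A t) → Off D r p M (B m) (A t')
    recolBA {t} {t'} {m} o = subst₂ (Off D r p M) (swapᶜ-B (isa {t}) (isa {t'}) m) (swapᶜ-l (A t) (A t'))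
      (Off-map (swapᶜ (A t) (A t')) (swapᶜ-inj (A t) (A t')) (swapᶜ-A t t') (swapᶜ-B (isa {t}) (isa {t'})) o)

  -- A coloured set D whose open ends at the vertex r are about to be joined to r.
  module _ (D : Sub) (r : V) where
    OutB : V → V → Set
    OutB v w = v ~ w × D ∌ w × w ≢ r

  record Body (D : Sub) (r : V) (M : V → Bool) : Set where
    field
      c    : Colouring
      dist : ∀ {v w w'} → D ∋ v → v ~ w → v ~ w' → c v w ≡ c v w' → w ≡ w'
      inn  : ∀ {v w u} → D ∋ v → D ∋ w → v ~ w → w ~ u → c v w ≢ c w u
      sing : ∀ {v w} → D ∋ v → OutB D r v w → (∀ {w'} → OutB D r v w' → w' ≡ w) →
             c v w ≡ B (M v) × (∀ {u} → D ∋ u → v ~ u → isA (c v u)) × (v ~ r → isA (c v r))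
      dbl  : ∀ {v w w'} → D ∋ v → OutB D r v w → OutB D r v w' → w ≢ w' →
             (∀ {u} → D ∋ u → v ~ u → isA (c v u) × isA (c u v)) × (v ~ r → isA (c v r))

  -- Once `r` stops counting as an open end, a vertex with the two open ends `r` and `w` would drop
  -- from `dbl` to `sing`, about which `o` says nothing. The last hypothesis excludes this; at `s`
  -- the edge to `r` was never counted.
  toBody : ∀ {D s r M a b} (o : Off D s r M a b) → D ∌ r →
           (∀ {z} → D ∋ z → z ~ r → z ≢ s → ∀ {w} → ¬ OutB D r z w) → Body D r M
  toBody {D} {s} {r} {M} o dr chord = record
    { c = c ; dist = dist ; inn = inn ; sing = sing' ; dbl = dbl' }
    where
    open Off o
    fwd : ∀ {v w} → OutB D r v w → Out D s r v w
    fwd (vw , dw , ne) = vw , dw , λ e → ne (proj₂ e)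
    back : ∀ {v w w₀} → D ∋ v → OutB D r v w₀ → Out D s r v w → OutB D r v w
    back {v} {w} dv o₀ (vw , dw , ne) = vw , dw , λ e → wr e
      where
      wr : w ≡ r → ⊥
      wr refl with v ≟ s
      ... | yes refl = ne (refl , refl)
      ... | no q = chord dv vw q o₀
    rootP : ∀ {v w} → D ∋ v → OutB D r v w → v ~ r → isA (c v r)
    rootP {v} dv ow vr with v ≟ s
    ... | yes refl = subst isA (sym rp) (rootA (fwd ow))
    ... | no q = ⊥-elim (chord dv vr q ow)
    sing' : ∀ {v w} → D ∋ v → OutB D r v w → (∀ {w'} → OutB D r v w' → w' ≡ w) →
             c v w ≡ B (M v) × (∀ {u} → D ∋ u → v ~ u → isA (c v u)) × (v ~ r → isA (c v r))
    sing' dv ow un with sing dv (fwd ow) (λ ow' → un (back dv ow ow'))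
    ... | e , f = e , f , rootP dv ow
    dbl' : ∀ {v w w'} → D ∋ v → OutB D r v w → OutB D r v w' → w ≢ w' →
             (∀ {u} → D ∋ u → v ~ u → isA (c v u) × isA (c u v)) × (v ~ r → isA (c v r))
    dbl' dv ow ow' ne = (λ du vu → dbl dv (fwd ow) (fwd ow') ne du vu) , rootP dv ow

  union : Sub → Sub → Sub
  union D E v = D v ∨ E v

  glueM : Sub → (V → Bool) → (V → Bool) → V → Bool
  glueM D M M' v = if D v then M v else M' v

  module _ {D E : Sub} {r : V} {M M' : V → Bool} (x : Body D r M) (y : Body E r M')
           (disj : ∀ {v} → D ∋ v → E ∋ v → ⊥) (apart : ∀ {v w} → D ∋ v → E ∋ w → v ~ w → ⊥) where
    private
      module x = Body x
      module y = Body y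
      cc : Colouring
      cc v = if D v then x.c v else y.c v
      caseU : ∀ {v} → union D E ∋ v → (D ∋ v) ⊎ (D ∌ v × E ∋ v)
      caseU {v} p with D v
      ... | true = inj₁ refl
      ... | false = inj₂ (refl , p)
      inL : ∀ {v u} → D ∋ v → v ~ u → union D E ∋ u → D ∋ u
      inL dv vu p with caseU p
      ... | inj₁ q = q
      ... | inj₂ (_ , eu) = ⊥-elim (apart dv eu vu)
      inR : ∀ {v u} → E ∋ v → v ~ u → union D E ∋ u → D ∌ u × E ∋ u
      inR ev vu p with caseU p
      ... | inj₁ q = ⊥-elim (apart q ev (~-sym vu))
      ... | inj₂ q = q
      ∌U : ∀ {u} → union D E ∌ u → D ∌ u × E ∌ u
      ∌U {u} p with D u
      ∌U {u} () | true
      ... | false = refl , p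
      outL : ∀ {v w} → D ∋ v → OutB (union D E) r v w → OutB D r v w
      outL dv (vw , q , ne) = vw , proj₁ (∌U q) , ne
      outL' : ∀ {v w} → D ∋ v → OutB D r v w → OutB (union D E) r v w
      outL' {v} {w} dv (vw , q , ne) = vw , un , ne
        where
        un : union D E ∌ w
        un rewrite q = ¬∋⇒∌ E (λ ew → apart dv ew vw)
      outR : ∀ {v w} → E ∋ v → OutB (union D E) r v w → OutB E r v w
      outR ev (vw , q , ne) = vw , proj₂ (∌U q) , ne
      outR' : ∀ {v w} → E ∋ v → OutB E r v w → OutB (union D E) r v w
      outR' {v} {w} ev (vw , q , ne) = vw , un , ne
        where
        un : union D E ∌ w
        un rewrite ¬∋⇒∌ D (λ dw → apart dw ev (~-sym vw)) = q

    bodyUnion : Body (union D E) r (glueM D M M')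
    bodyUnion = record { c = cc ; dist = dist' ; inn = inn' ; sing = sing' ; dbl = dbl' }
      where
      dist' : ∀ {v w w'} → union D E ∋ v → v ~ w → v ~ w' → cc v w ≡ cc v w' → w ≡ w'
      dist' p vw vw' e with caseU p
      ... | inj₁ q rewrite q = x.dist q vw vw' e
      ... | inj₂ (q , ev) rewrite q = y.dist ev vw vw' e
      inn' : ∀ {v w u} → union D E ∋ v → union D E ∋ w → v ~ w → w ~ u → cc v w ≢ cc w u
      inn' p q vw wu with caseU p
      ... | inj₁ dv rewrite dv | inL dv vw q = x.inn dv (inL dv vw q) vw wu
      ... | inj₂ (dv , ev) rewrite dv | proj₁ (inR ev vw q) = y.inn ev (proj₂ (inR ev vw q)) vw wu
      sing' : ∀ {v w} → union D E ∋ v → OutB (union D E) r v w → (∀ {w'} → OutB (union D E) r v w' → w' ≡ w) →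
             cc v w ≡ B (glueM D M M' v) × (∀ {u} → union D E ∋ u → v ~ u → isA (cc v u)) × (v ~ r → isA (cc v r))
      sing' p ow un with caseU p
      ... | inj₁ dv with x.sing dv (outL dv ow) (λ o → un (outL' dv o))
      ...   | e , f , g rewrite dv = e , (λ du vu → f (inL dv vu du) vu) , g
      sing' p ow un | inj₂ (dv , ev) with y.sing ev (outR ev ow) (λ o → un (outR' ev o))
      ...   | e , f , g rewrite dv = e , (λ du vu → f (proj₂ (inR ev vu du)) vu) , g
      dbl' : ∀ {v w w'} → union D E ∋ v → OutB (union D E) r v w → OutB (union D E) r v w' → w ≢ w' →
             (∀ {u} → union D E ∋ u → v ~ u → isA (cc v u) × isA (cc u v)) × (v ~ r → isA (cc v r))
      dbl' {v} p ow ow' ne with caseU p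
      ... | inj₁ dv with x.dbl dv (outL dv ow) (outL dv ow') ne
      ...   | f , g rewrite dv = (λ {u} du vu → inside u (inL dv vu du) vu) , g
        where
        inside : ∀ u → D ∋ u → v ~ u → isA (x.c v u) × isA (cc u v)
        inside u du vu rewrite du = f du vu
      dbl' {v} p ow ow' ne | inj₂ (dv , ev) with y.dbl ev (outR ev ow) (outR ev ow') ne
      ...   | f , g rewrite dv = (λ {u} du vu → inside u (inR ev vu du) vu) , g
        where
        inside : ∀ u → D ∌ u × E ∋ u → v ~ u → isA (y.c v u) × isA (cc u v)
        inside u (du , eu) vu rewrite du = f eu vu

  bodyExt : ∀ {D E r M} → (∀ v → E v ≡ D v) → Body D r M → Body E r M
  bodyExt {D} {E} {r} eq x = record
    { c = c
    ; dist = λ dv → dist (tr dv)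
    ; inn = λ dv dw → inn (tr dv) (tr dw)
    ; sing = λ dv ow un → let e , f , g = sing (tr dv) (ou ow) (λ o → un (ou' o)) in e , (λ du → f (tr du)) , g
    ; dbl = λ dv ow ow' ne → let f , g = dbl (tr dv) (ou ow) (ou ow') ne in (λ du → f (tr du)) , g }
    where
    open Body x
    tr : ∀ {v b} → E v ≡ b → D v ≡ b
    tr {v} p = trans (sym (eq v)) p
    ou : ∀ {v w} → OutB E r v w → OutB D r v w
    ou (vw , q , ne) = vw , tr q , ne
    ou' : ∀ {v w} → OutB D r v w → OutB E r v w
    ou' {v} {w} (vw , q , ne) = vw , trans (eq w) q , ne

  -- The colours leaving a vertex of degree at most three. The third one is a default, so that the
  -- third neighbour need not be named and may be absent.
  rootOut : V → V → Col → Col → Col → V → Col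
  rootOut p k a x y u = if does (u ≟ p) then a else if does (u ≟ k) then x else y

  rootOut-p : ∀ p k a x y → rootOut p k a x y p ≡ a
  rootOut-p p k a x y with p ≟ p
  ... | yes _ = refl
  ... | no q = ⊥-elim (q refl)

  rootOut-k : ∀ p k a x y → k ≢ p → rootOut p k a x y k ≡ x
  rootOut-k p k a x y q with k ≟ p
  ... | yes e = ⊥-elim (q e)
  ... | no _ with k ≟ k
  ...   | yes _ = refl
  ...   | no q' = ⊥-elim (q' refl)

  rootOut-y : ∀ p k a x y {u} → u ≢ p → u ≢ k → rootOut p k a x y u ≡ y
  rootOut-y p k a x y {u} q q' with u ≟ p
  ... | yes e = ⊥-elim (q e)
  ... | no _ with u ≟ k
  ...   | yes e = ⊥-elim (q' e)
  ...   | no _ = refl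

  rootOut-any : ∀ p k a x y {P : Col → Set} → P a → P x → P y → ∀ u → P (rootOut p k a x y u)
  rootOut-any p k a x y pa px py u with u ≟ p
  ... | yes _ = pa
  ... | no _ with u ≟ k
  ...   | yes _ = px
  ...   | no _ = py

  rootOut-dist : ∀ {P : V → Set} p k {a x y} → a ≢ x → a ≢ y → x ≢ y →
    (∀ {w w'} → P w → P w' → w ≢ p → w' ≢ p → w ≢ k → w' ≢ k → w ≡ w') →
    ∀ {w w'} → P w → P w' → rootOut p k a x y w ≡ rootOut p k a x y w' → w ≡ w'
  rootOut-dist p k ax ay xy k~ {w} {w'} pw pw' e with w ≟ p | w' ≟ p
  ... | yes e₁ | yes e₂ = trans e₁ (sym e₂)
  ... | yes e₁ | no q₂ with w' ≟ k
  ...   | yes _ = ⊥-elim (ax e)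
  ...   | no _ = ⊥-elim (ay e)
  rootOut-dist p k ax ay xy k~ {w} {w'} pw pw' e | no q₁ | yes e₂ with w ≟ k
  ...   | yes _ = ⊥-elim (ax (sym e))
  ...   | no _ = ⊥-elim (ay (sym e))
  rootOut-dist p k ax ay xy k~ {w} {w'} pw pw' e | no q₁ | no q₂ with w ≟ k | w' ≟ k
  ...   | yes e₁ | yes e₂ = trans e₁ (sym e₂)
  ...   | yes _ | no _ = ⊥-elim (xy e)
  ...   | no _ | yes _ = ⊥-elim (xy (sym e))
  ...   | no q₃ | no q₄ = k~ pw pw' q₁ q₂ q₃ q₄

  -- The vertex `p` need not be adjacent to `r`. In particular `TwoBut r r` says that `r` has degree
  -- at most two, which serves for a root without parent.
  TwoBut : V → V → Set
  TwoBut r p = ∀ {u v w} → r ~ u → r ~ v → r ~ w → u ≢ p → v ≢ p → w ≢ p → u ≢ v → u ≢ w → v ≢ w → ⊥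

  -- Two kinds of consecutive arcs arise at the new vertex: `into` treats those passing through `r`,
  -- `onto` those that start at `r` and pass through a neighbour. `dblA` supplies the half of `dbl`
  -- that concerns the arc from `r` to a vertex with two open ends.
  record Attach (D : Sub) (r p : V) (M : V → Bool) (k : V) (a b x y : Col) (c : Colouring) : Set where
    o : V → Col
    o = rootOut p k a x y
    field
      k~     : ∀ {w w'} → r ~ w → r ~ w' → w ≢ p → w' ≢ p → w ≢ k → w' ≢ k → w ≡ w'
      a≢x    : a ≢ x
      a≢y    : a ≢ y
      x≢y    : x ≢ y
      free   : ∀ {u} → r ~ u → o u ≢ b
      into   : ∀ {s u} → del D r ∋ s → s ~ r → r ~ u → c s r ≢ o u
      onto   : ∀ {s u} → del D r ∋ s → s ~ r → s ~ u → o s ≢ c s u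
      dblA   : ∀ {s w w'} → del D r ∋ s → s ~ r → OutB (del D r) r s w → OutB (del D r) r s w' → w ≢ w' → isA (o s)
      rsing  : ∀ {w} → Out D r p r w → (∀ {w'} → Out D r p r w' → w' ≡ w) →
               o w ≡ B (M r) × (∀ {u} → D ∋ u → r ~ u → isA (o u))
      rdbl   : ∀ {w w'} → Out D r p r w → Out D r p r w' → w ≢ w' → ∀ {u} → D ∋ u → r ~ u → ⊥
      rA     : ∀ {w} → Out D r p r w → isA a
      rA₂    : ∀ {w w'} → Out D r p r w → Out D r p r w' → w ≢ w' → isA b

  attach : ∀ {D r p M k a b x y} → D ∋ r → (bd : Body (del D r) r M) →
           Attach D r p M k a b x y (Body.c bd) → Off D r p M a b
  attach {D} {r} {p} {M} {k} {a} {b} {x} {y} dr bd at = record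
    { c = c' ; dist = dist' ; inn = inn' ; rp = rp' ; fr = fr' ; sing = sing' ; dbl = dbl'
    ; rootA = rA ; rootA₂ = rA₂ }
    where
    open Body bd
    open Attach at
    c' : Colouring
    c' v w = if does (v ≟ r) then o w else c v w
    c'r : ∀ w → c' r w ≡ o w
    c'r w with r ≟ r
    ... | yes _ = refl
    ... | no q = ⊥-elim (q refl)
    rp' : c' r p ≡ a
    rp' = trans (c'r p) (rootOut-p p k a x y)
    fr' : ∀ {u} → r ~ u → c' r u ≢ b
    fr' {u} ru e = free ru (trans (sym (c'r u)) e)
    odist : ∀ {w w'} → r ~ w → r ~ w' → o w ≡ o w' → w ≡ w'
    odist = rootOut-dist {P = r ~_} p k a≢x a≢y x≢y k~
    dist' : ∀ {v w w'} → D ∋ v → v ~ w → v ~ w' → c' v w ≡ c' v w' → w ≡ w'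
    dist' {v} {w} {w'} dv vw vw' e with v ≟ r
    ... | yes refl = odist vw vw' e
    ... | no q = dist (del-in D r q dv) vw vw' e
    inn' : ∀ {v w u} → D ∋ v → D ∋ w → v ~ w → w ~ u → c' v w ≢ c' w u
    inn' {v} {w} {u} dv dw vw wu with v ≟ r | w ≟ r
    ... | yes refl | yes refl = λ _ → ~⇒≢ vw refl
    ... | yes refl | no q = onto (del-in D r q dw) (~-sym vw) wu
    ... | no q | yes refl = into (del-in D r q dv) vw wu
    ... | no q | no q' = inn (del-in D r q dv) (del-in D r q' dw) vw wu
    ou : ∀ {v w} → v ≢ r → Out D r p v w → OutB (del D r) r v w
    ou vr (vw , dw , _) = vw , del-∌ˡ D r dw , λ { refl → t≢f dr dw }
    ou' : ∀ {v w} → v ≢ r → OutB (del D r) r v w → Out D r p v w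
    ou' vr (vw , dw , ne) with del-∌ D r dw
    ... | inj₁ e = ⊥-elim (ne e)
    ... | inj₂ q = vw , q , λ e → vr (proj₁ e)
    sing' : ∀ {v w} → D ∋ v → Out D r p v w → (∀ {w'} → Out D r p v w' → w' ≡ w) →
               c' v w ≡ B (M v) × (∀ {u} → D ∋ u → v ~ u → isA (c' v u))
    sing' {v} {w} dv ow un with v ≟ r
    ... | yes refl = rsing ow un
    ... | no q with sing (del-in D r q dv) (ou q ow) (λ o₁ → un (ou' q o₁))
    ...   | e , f , g = e , λ {u} du vu → ins u du vu
      where
      ins : ∀ u → D ∋ u → v ~ u → isA (c v u)
      ins u du vu with u ≟ r
      ... | yes refl = g vu
      ... | no q' = f (del-in D r q' du) vu
    dbl' : ∀ {v w w'} → D ∋ v → Out D r p v w → Out D r p v w' → w ≢ w' →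
               ∀ {u} → D ∋ u → v ~ u → isA (c' v u) × isA (c' u v)
    dbl' {v} {w} {w'} dv ow ow' ne {u} du vu with v ≟ r
    ... | yes refl = ⊥-elim (rdbl ow ow' ne du vu)
    ... | no q with dbl (del-in D r q dv) (ou q ow) (ou q ow') ne | u ≟ r
    ...   | f , g | yes refl = g vu , dblA (del-in D r q dv) vu (ou q ow) (ou q ow') ne
    ...   | f , g | no q' = f (del-in D r q' du) vu

bool-ext : ∀ {a b : Bool} → (a ≡ true → b ≡ true) → (b ≡ true → a ≡ true) → a ≡ b
bool-ext {true} {true} f g = refl
bool-ext {true} {false} f g = sym (f refl)
bool-ext {false} {true} f g = g refl
bool-ext {false} {false} f g = refl

third : (x y : Tri) → ∃ λ z → z ≢ x × z ≢ y
third t₀ t₀ = t₁ , (λ ()) , λ ()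
third t₀ t₁ = t₂ , (λ ()) , λ ()
third t₀ t₂ = t₁ , (λ ()) , λ ()
third t₁ t₀ = t₂ , (λ ()) , λ ()
third t₁ t₁ = t₀ , (λ ()) , λ ()
third t₁ t₂ = t₀ , (λ ()) , λ ()
third t₂ t₀ = t₁ , (λ ()) , λ ()
third t₂ t₁ = t₀ , (λ ()) , λ ()
third t₂ t₂ = t₀ , (λ ()) , λ ()

-- The colour `z` may enter a vertex whose leaving arcs have colours `a`, `x` and `y`.
Fresh : Col → Col → Col → Col → Set
Fresh z a x y = a ≢ z × x ≢ z × y ≢ z

upd : ∀ {n} → (Fin n → Bool) → Fin n → Bool → Fin n → Bool
upd M r m v = if does (v ≟ r) then m else M v

upd-self : ∀ {n} (M : Fin n → Bool) r m → upd M r m r ≡ m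
upd-self M r m with r ≟ r
... | yes _ = refl
... | no q = ⊥-elim (q refl)

upd-other : ∀ {n} (M : Fin n → Bool) r m {v} → v ≢ r → upd M r m v ≡ M v
upd-other M r m {v} q with v ≟ r
... | yes e = ⊥-elim (q e)
... | no _ = refl

module Steps {n : ℕ} (H : Subcubic n) where
  open Pieces H public

  twoBut : ∀ {s r} → s ~ r → TwoBut s r
  twoBut {s} sr su sv sw up vp wp uv uw vw = deg≤3 s sr su sv sw (λ e → up (sym e)) (λ e → vp (sym e)) (λ e → wp (sym e)) uv uw vw

  conn-ext : ∀ {D E : Sub} → (∀ v → D v ≡ E v) → Conn D → Conn E
  conn-ext eq con S cl dx dy sx =
    con S (λ dv dw → cl (trans (sym (eq _)) dv) (trans (sym (eq _)) dw)) (trans (eq _) dx) (trans (eq _) dy) sx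

  conn-nbr : ∀ (D : Sub) {s e} → Conn D → D ∋ s → D ∋ e → s ≢ e → ∃ λ u → D ∋ u × s ~ u
  conn-nbr D {s} {e} con ds de ne with any? (λ u → (D ∋? u) ×-dec (s ~? u))
  ... | yes p = p
  ... | no q = ⊥-elim (ne (sym (only-inv s (con (only s)
                 (λ { dv dw vw sv → ⊥-elim (q (_ , dw , subst (_~ _) (only-inv s sv) vw)) }) ds de (only-self s)))))

  conn-del₁ : ∀ (D : Sub) {r s} → Conn D → D ∋ r → D ∋ s → r ~ s → (∀ {u} → D ∋ u → r ~ u → u ≡ s) → Conn (del D r)
  conn-del₁ D {r} {s} con dr ds rs un S cl {x} {y} dx dy sx =
    trans (sym (S'o y (proj₁ (del-inv D r dy))))
      (con S' cl' (proj₂ (del-inv D r dx)) (proj₂ (del-inv D r dy)) (trans (S'o x (proj₁ (del-inv D r dx))) sx))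
    where
    S' : Sub
    S' v = if does (v ≟ r) then S s else S v
    S'o : ∀ v → v ≢ r → S' v ≡ S v
    S'o v q with v ≟ r
    ... | yes e = ⊥-elim (q e)
    ... | no _ = refl
    cl' : ∀ {v w} → D ∋ v → D ∋ w → v ~ w → S' ∋ v → S' ∋ w
    cl' {v} {w} dv dw vw sv with v ≟ r | w ≟ r
    ... | yes refl | yes refl = sv
    ... | yes refl | no q = subst (S ∋_) (sym (un dw vw)) sv
    ... | no q | yes refl = subst (S ∋_) (un dv (~-sym vw)) sv
    ... | no q | no q' = cl (del-in D r q dv) (del-in D r q' dw) vw sv

  bodyM : ∀ {D r M M'} → (∀ {v} → D ∋ v → M' v ≡ M v) → Body D r M → Body D r M'
  bodyM eq x = record
    { c = c ; dist = dist ; inn = inn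
    ; sing = λ dv ow un → let e , fg = sing dv ow un in trans e (cong B (sym (eq dv))) , fg
    ; dbl = dbl }
    where open Body x

  AA : Sub → V → V → (V → Bool) → Set
  AA D r p M = Off D r p M (A t₀) (A t₁)

  -- The second form is what a root between two separate pieces yields: two A colours go to the
  -- pieces, a B colour of either sign goes to the parent, and the third A colour is left for the
  -- arc back.
  Cap : Sub → V → V → (V → Bool) → Set
  Cap D r p M = AA D r p M ⊎ (∀ μ → Off D r p M (B μ) (A t₀))

  -- What both forms of `Cap` have in common. A parent that sends neither `A t₀` nor `B μ` can take
  -- any child, without knowing which form the child has.
  Weak : Sub → V → V → (V → Bool) → Bool → Tri → Set
  Weak D r p M μ s = ∃ λ a → (a ≡ A t₀ ⊎ a ≡ B μ) × Off D r p M a (A s)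

  weak : ∀ {D r p M} → Cap D r p M → ∀ μ s → s ≢ t₀ → Weak D r p M μ s
  weak (inj₁ o) μ s q = A t₀ , inj₁ refl , recolAA o (λ ()) (λ e → q (sym e))
  weak (inj₂ f) μ s q = B μ , inj₂ refl , recolBA (f μ)

  A₀B-fresh : ∀ {a m} → (a ≡ A t₀ ⊎ a ≡ B (not m)) → Fresh a (A t₂) (A t₁) (B m)
  A₀B-fresh (inj₁ refl) = (λ ()) , (λ ()) , λ ()
  A₀B-fresh {m = m} (inj₂ refl) = (λ ()) , (λ ()) , λ e → not-≢ m (B-inj e)

  fresh-any : ∀ {p k a x y z} → Fresh z a x y → ∀ u → rootOut p k a x y u ≢ z
  fresh-any {p} {k} {a} {x} {y} {z} (f , g , h) = rootOut-any p k a x y {_≢ z} f g h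

  -- A third neighbour of `r`, besides `p` and `s`, is an open end. It receives `B m`, and setting
  -- `M` to `m` at `r` makes this the colour that `sing` demands.
  attach₁ : ∀ {D r p s M a₁ b₁ m a b} → D ∋ r → D ∋ s → r ~ s → s ≢ p → TwoBut r p →
            (∀ {u} → D ∋ u → r ~ u → u ≡ s) → Off (del D r) s r M a₁ b₁ →
            isA b₁ → isA a → a ≢ b₁ → Fresh a₁ a b₁ (B m) → Fresh b a b₁ (B m) →
            Off D r p (upd M r m) a b
  attach₁ {D} {r} {p} {s} {M} {a₁} {b₁} {m} {a} {b} dr ds rs sp two un o isb isa' ab fa fb =
    attach {k = s} {x = b₁} {y = B m} dr bd record
      { k~ = λ {w} {w'} rw rw' wp wp' ws ws' → uniq rw rw' wp wp' ws ws'
      ; a≢x = ab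
      ; a≢y = λ e → A≢B isa' e
      ; x≢y = λ e → A≢B isb e
      ; free = λ {u} _ → fresh-any {p} {s} fb u
      ; into = λ { ds' sr ru → into' (chd ds' sr) ru }
      ; onto = λ { ds' sr su → onto' (chd ds' sr) su }
      ; dblA = λ { ds' sr _ _ _ → subst isA (sym (trans (cong ro (chd ds' sr)) os)) isb }
      ; rsing = λ { (rw , dw , ne) _ → trans (rootOut-y p s a b₁ (B m) (λ e → ne (refl , e)) (λ { refl → t≢f ds dw }))
                     (cong B (sym (upd-self M r m))) , λ du ru → subst isA (sym (trans (cong ro (un du ru)) os)) isb }
      ; rdbl = λ ow ow' ne _ _ → noDbl ow ow' ne
      ; rA = λ _ → isa'
      ; rA₂ = λ ow ow' ne → ⊥-elim (noDbl ow ow' ne) }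
    where
    ro : V → Col
    ro = rootOut p s a b₁ (B m)
    os : ro s ≡ b₁
    os = rootOut-k p s a b₁ (B m) sp
    chd : ∀ {v} → del D r ∋ v → v ~ r → v ≡ s
    chd dv vr = un (proj₂ (del-inv D r dv)) (~-sym vr)
    bd : Body (del D r) r (upd M r m)
    bd = bodyM (λ dv → upd-other M r m (proj₁ (del-inv D r dv)))
           (toBody o (del-self D r) (λ dz zr zs → ⊥-elim (zs (chd dz zr))))
    uniq : ∀ {w w'} → r ~ w → r ~ w' → w ≢ p → w' ≢ p → w ≢ s → w' ≢ s → w ≡ w'
    uniq {w} {w'} rw rw' wp wp' ws ws' with w ≟ w'
    ... | yes e = e
    ... | no q = ⊥-elim (two rw rw' rs wp wp' sp q ws ws')
    noDbl : ∀ {w w'} → Out D r p r w → Out D r p r w' → w ≢ w' → ⊥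
    noDbl (rw , dw , ne) (rw' , dw' , ne') q = two rw rw' rs (λ e → ne (refl , e)) (λ e → ne' (refl , e)) sp q
      (λ { refl → t≢f ds dw }) (λ { refl → t≢f ds dw' })
    into' : ∀ {v u} → v ≡ s → r ~ u → Off.c o v r ≢ ro u
    into' {u = u} refl ru e = fresh-any {p} {s} fa u (trans (sym e) (Off.rp o))
    onto' : ∀ {v u} → v ≡ s → v ~ u → ro v ≢ Off.c o v u
    onto' refl su e = Off.fr o su (trans (sym e) os)

  -- The neighbours besides `p` are used up by `s₁` and `s₂`, so `r` has no open end and the
  -- conditions on its open ends are vacuous.
  attach₂ : ∀ {D r p s₁ s₂ M a₁ a₂ x y a b} → D ∋ r → D ∋ s₁ → D ∋ s₂ → r ~ s₁ → r ~ s₂ → s₁ ≢ s₂ → s₁ ≢ p → s₂ ≢ p →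
            TwoBut r p → (D ∋ p → r ~ p → ⊥) → (bd : Body (del D r) r M) →
            Body.c bd s₁ r ≡ a₁ → Body.c bd s₂ r ≡ a₂ →
            (∀ {u} → s₁ ~ u → Body.c bd s₁ u ≢ x) → (∀ {u} → s₂ ~ u → Body.c bd s₂ u ≢ y) →
            (∀ {w w'} → OutB (del D r) r s₁ w → OutB (del D r) r s₁ w' → w ≢ w' → isA x) →
            (∀ {w w'} → OutB (del D r) r s₂ w → OutB (del D r) r s₂ w' → w ≢ w' → isA y) →
            a ≢ x → a ≢ y → x ≢ y → Fresh a₁ a x y → Fresh a₂ a x y → Fresh b a x y →
            Off D r p M a b
  attach₂ {D} {r} {p} {s₁} {s₂} {M} {a₁} {a₂} {x} {y} {a} {b} dr d₁ d₂ r₁ r₂ ne n₁ n₂ two pout bd e₁ e₂ f₁ f₂ g₁ g₂ ax ay xy fa₁ fa₂ fb =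
    attach {k = s₁} {x = x} {y = y} dr bd record
      { k~ = λ rw rw' wp wp' ws ws' → trans (is₂ rw wp ws) (sym (is₂ rw' wp' ws'))
      ; a≢x = ax ; a≢y = ay ; x≢y = xy
      ; free = λ {u} _ → fresh-any {p} {s₁} fb u
      ; into = λ ds sr ru → into' (either ds sr) ru
      ; onto = λ ds sr su → onto' (either ds sr) su
      ; dblA = λ ds sr ow ow' q → dbl' (either ds sr) ow ow' q
      ; rsing = λ ow _ → ⊥-elim (noOut ow)
      ; rdbl = λ ow _ _ _ _ → noOut ow
      ; rA = λ ow → ⊥-elim (noOut ow)
      ; rA₂ = λ ow _ _ → ⊥-elim (noOut ow) }
    where
    ro : V → Col
    ro = rootOut p s₁ a x y
    o₁ : ro s₁ ≡ x
    o₁ = rootOut-k p s₁ a x y n₁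
    o₂ : ro s₂ ≡ y
    o₂ = rootOut-y p s₁ a x y n₂ (λ e → ne (sym e))
    is₂ : ∀ {w} → r ~ w → w ≢ p → w ≢ s₁ → w ≡ s₂
    is₂ {w} rw wp ws with w ≟ s₂
    ... | yes e = e
    ... | no q = ⊥-elim (two rw r₁ r₂ wp n₁ n₂ ws q ne)
    noOut : ∀ {w} → ¬ Out D r p r w
    noOut (rw , dw , q) = two rw r₁ r₂ (λ e → q (refl , e)) n₁ n₂ (λ { refl → t≢f d₁ dw }) (λ { refl → t≢f d₂ dw }) ne
    either : ∀ {s} → del D r ∋ s → s ~ r → s ≡ s₁ ⊎ s ≡ s₂
    either {s} ds sr with s ≟ s₁ | s ≟ s₂ | s ≟ p
    ... | yes e | _ | _ = inj₁ e
    ... | no _ | yes e | _ = inj₂ e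
    ... | no q₁ | no q₂ | no q = ⊥-elim (two (~-sym sr) r₁ r₂ q n₁ n₂ q₁ q₂ ne)
    ... | no q₁ | no q₂ | yes refl = ⊥-elim (pout (proj₂ (del-inv D r ds)) (~-sym sr))
    into' : ∀ {s u} → s ≡ s₁ ⊎ s ≡ s₂ → r ~ u → Body.c bd s r ≢ ro u
    into' {u = u} (inj₁ refl) ru e = fresh-any {p} {s₁} fa₁ u (trans (sym e) e₁)
    into' {u = u} (inj₂ refl) ru e = fresh-any {p} {s₁} fa₂ u (trans (sym e) e₂)
    onto' : ∀ {s u} → s ≡ s₁ ⊎ s ≡ s₂ → s ~ u → ro s ≢ Body.c bd s u
    onto' (inj₁ refl) su e = f₁ su (trans (sym e) o₁)
    onto' (inj₂ refl) su e = f₂ su (trans (sym e) o₂)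
    dbl' : ∀ {s w w'} → s ≡ s₁ ⊎ s ≡ s₂ → OutB (del D r) r s w → OutB (del D r) r s w' → w ≢ w' → isA (ro s)
    dbl' (inj₁ refl) ow ow' q = subst isA (sym o₁) (g₁ ow ow' q)
    dbl' (inj₂ refl) ow ow' q = subst isA (sym o₂) (g₂ ow ow' q)

A₀Bμ-fresh : ∀ {a μ} → (a ≡ A t₀ ⊎ a ≡ B μ) → Fresh a (A t₂) (A t₁) (B (not μ))
A₀Bμ-fresh (inj₁ refl) = (λ ()) , (λ ()) , λ ()
A₀Bμ-fresh {μ = μ} (inj₂ refl) = (λ ()) , (λ ()) , λ e → not-≢ μ (sym (B-inj e))

-- Colouring a rooted connected piece

module Solve {n : ℕ} (H : Subcubic n) (Ok : Fin n → Bool → Set) (pref : ∀ v → ∃ (Ok v))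
             (tie : ∀ s e → s ≢ e → ∃ λ m → Ok s m × Ok e (not m)) where
  open Steps H public

  -- The open ends of z, which has one neighbour g inside C, are recoloured; the colour of the arc
  -- from z to r becomes an A colour.
  module Recolour {C : Sub} {s r : V} {M a b} (o : Off C s r M a b) {z g y : V} (C∌r : C ∌ r)
                  (Cz : C ∋ z) (Cg : C ∋ g) (Cy : C ∌ y) (zr : z ~ r) (zg : z ~ g) (zy : z ~ y)
                  (y≢r : y ≢ r) (is-z : ∀ {v} → C ∋ v → v ~ r → v ≢ s → v ≡ z)
                  {β φ c₀ : Tri} (zgβ : Off.c o z g ≡ A β) (gzφ : Off.c o g z ≡ A φ)
                  (c₀β : c₀ ≢ β) (c₀φ : c₀ ≢ φ) (μ : Bool) where
    open Off o
    g≢r : g ≢ r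
    g≢r e = t≢f Cg (subst (C ∌_) (sym e) C∌r)
    g≢y : g ≢ y
    g≢y e = t≢f Cg (subst (C ∌_) (sym e) Cy)
    nbrZ : ∀ {u} → z ~ u → u ≢ g → u ≢ r → u ≡ y
    nbrZ {u} zu ug ur with u ≟ y
    ... | yes e = e
    ... | no q = ⊥-elim (deg≤3 z zu zg zr zy ug ur q g≢r g≢y (λ e → y≢r (sym e)))
    M₂ : V → Bool
    M₂ = upd M z μ
    ze : V → Col
    ze = rootOut g r (A β) (A c₀) (B μ)
    c' : Colouring
    c' v w = if does (v ≟ z) then ze w else c v w
    c'z : ∀ w → c' z w ≡ ze w
    c'z w with z ≟ z
    ... | yes _ = refl
    ... | no q = ⊥-elim (q refl)
    c'o : ∀ {v} w → v ≢ z → c' v w ≡ c v w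
    c'o {v} w q with v ≟ z
    ... | yes e = ⊥-elim (q e)
    ... | no _ = refl
    zeg : ze g ≡ A β
    zeg = rootOut-p g r _ _ _
    zer : ze r ≡ A c₀
    zer = rootOut-k g r _ _ _ (λ e → g≢r (sym e))
    zey : ze y ≡ B μ
    zey = rootOut-y g r _ _ _ (λ e → g≢y (sym e)) y≢r
    ze-any : ∀ {P : Col → Set} → P (A β) → P (A c₀) → P (B μ) → ∀ w → P (ze w)
    ze-any {P} = rootOut-any g r (A β) (A c₀) (B μ) {P}
    ze-dist : ∀ {w w'} → z ~ w → z ~ w' → ze w ≡ ze w' → w ≡ w'
    ze-dist = rootOut-dist {P = z ~_} g r (λ e → c₀β (sym (A-inj e))) (λ ()) (λ ())
      (λ zw zw' q₁ q₂ q₃ q₄ → trans (nbrZ zw q₁ q₃) (sym (nbrZ zw' q₂ q₄)))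
    inZ : ∀ {u} → C ∋ u → z ~ u → u ≡ g
    inZ {u} cu zu with u ≟ g
    ... | yes e = e
    ... | no q with nbrZ zu q (λ { refl → t≢f cu C∌r })
    ...   | refl = ⊥-elim (t≢f cu Cy)
    -- Together with `q` and `r`, two open ends would make four neighbours.
    oneB : ∀ {v w w' q} → C ∋ q → v ~ q → v ~ r → OutB C r v w → OutB C r v w' → w ≢ w' → ⊥
    oneB {v} cq vq vr (vw , cw , wr) (vw' , cw' , wr') ne =
      deg≤3 v vw vw' vq vr ne (λ { refl → t≢f cq cw }) wr (λ { refl → t≢f cq cw' }) wr' (λ { refl → t≢f cq C∌r })
    fwd : ∀ {v w} → OutB C r v w → Out C s r v w
    fwd (vw , q , ne) = vw , q , λ e → ne (proj₂ e)
    back : ∀ {v w} → C ∋ v → v ≢ z → Out C s r v w → OutB C r v w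
    back {v} {w} cv vz (vw , q , ne) = vw , q , λ e → wr e
      where
      wr : w ≡ r → ⊥
      wr refl with v ≟ s
      ... | yes refl = ne (refl , refl)
      ... | no vs = vz (is-z cv vw vs)
    arcR : ∀ {v w} → C ∋ v → v ≢ z → OutB C r v w → v ~ r → isA (c v r)
    arcR {v} cv vz ow vr with v ≟ s
    ... | yes refl = subst isA (sym rp) (rootA (fwd ow))
    ... | no q = ⊥-elim (vz (is-z cv vr q))
    bd : Body C r M₂
    bd = record
      { c = c'
      ; dist = dist'
      ; inn = inn'
      ; sing = sing'
      ; dbl = dbl' }
      where
      dist' : ∀ {v w w'} → C ∋ v → v ~ w → v ~ w' → c' v w ≡ c' v w' → w ≡ w'
      dist' {v} cv vw vw' e with v ≟ z
      ... | yes refl = ze-dist vw vw' e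
      ... | no _ = dist cv vw vw' e
      inn' : ∀ {v w u} → C ∋ v → C ∋ w → v ~ w → w ~ u → c' v w ≢ c' w u
      inn' {v} {w} {u} cv cw vw wu e with v ≟ z | w ≟ z
      ... | yes refl | yes refl = ~⇒≢ vw refl
      ... | yes refl | no q with inZ cw vw
      ...   | refl = inn Cz cw vw wu (trans zgβ (trans (sym zeg) e))
      inn' {v} {w} {u} cv cw vw wu e | no q | yes refl with inZ cv (~-sym vw)
      ... | refl = ze-any {P = λ x → A φ ≢ x}
                     (λ e' → inn cv Cz vw zg (trans gzφ (trans e' (sym zgβ))))
                     (λ e' → c₀φ (sym (A-inj e'))) (λ ()) u (trans (sym gzφ) e)
      inn' {v} {w} {u} cv cw vw wu e | no q | no q' = inn cv cw vw wu e
      sing' : ∀ {v w} → C ∋ v → OutB C r v w → (∀ {w'} → OutB C r v w' → w' ≡ w) →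
         c' v w ≡ B (M₂ v) × (∀ {u} → C ∋ u → v ~ u → isA (c' v u)) × (v ~ r → isA (c' v r))
      sing' {v} {w} cv ow@(vw , cw , wr) un with v ≟ z
      ... | yes refl = trans (cong ze (nbrZ vw (λ { refl → t≢f Cg cw }) wr)) zey ,
              (λ cu zu → subst isA (sym (trans (cong ze (inZ cu zu)) zeg)) isa) , λ _ → subst isA (sym zer) isa
      ... | no q with sing cv (fwd ow) (λ o' → un (back cv q o'))
      ...   | e , f = e , f , arcR cv q ow
      dbl' : ∀ {v w w'} → C ∋ v → OutB C r v w → OutB C r v w' → w ≢ w' →
         (∀ {u} → C ∋ u → v ~ u → isA (c' v u) × isA (c' u v)) × (v ~ r → isA (c' v r))
      dbl' {v} {w} {w'} cv ow ow' ne with v ≟ z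
      ... | yes refl = ⊥-elim (oneB Cg zg zr ow ow' ne)
      ... | no q = (λ {u} cu vu → proj₁ (dbl cv (fwd ow) (fwd ow') ne cu vu) , inU u cu vu) , arcR cv q ow
        where
        inU : ∀ u → C ∋ u → v ~ u → isA (c' u v)
        inU u cu vu with u ≟ z
        ... | yes refl = subst isA (sym (trans (cong ze (inZ cv (~-sym vu))) zeg)) isa
        ... | no _ = proj₂ (dbl cv (fwd ow) (fwd ow') ne cu vu)

  -- Ok prescribes M at two vertices of the ring; the type of solution that exists depends on how r
  -- cuts D, and AA is only guaranteed if D - r is connected.
  record Solution (D : Sub) (r p : V) (m : Bool) : Set where
    field
      M   : V → Bool
      Mr  : M r ≡ m
      ok  : ∀ {v} → D ∋ v → v ≢ r → Ok v (M v)
      cap : Cap D r p M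
      aa  : Conn (del D r) → AA D r p M
      -- Meant for a parent that has to spend a B colour on `r`: the open end of `r` takes `B m`, so
      -- the opposite one can enter.
      ch  : ∀ {w u} → Out D r p r w → D ∋ u → r ~ u → Off D r p M (A t₀) (B (not m))

  module Step {D : Sub} {r p : V} (dr : D ∋ r) (two : TwoBut r p) (pout : D ∋ p → r ~ p → ⊥) (m : Bool) where

    nbr≢p : ∀ {s} → D ∋ s → r ~ s → s ≢ p
    nbr≢p ds rs refl = pout ds rs

    -- Besides `p` there are at most two neighbours, all of them open ends, and the two B colours
    -- suffice. `B m` goes to `k`, so that a sole open end gets the colour prescribed by `sing`.
    leaf : (∀ {u} → D ∋ u → u ≡ r) → Solution D r p m
    leaf lone = record
      { M = λ v → if does (v ≟ r) then m else proj₁ (pref v)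
      ; Mr = upd-self (λ v → proj₁ (pref v)) r m
      ; ok = λ dv q → ⊥-elim (q (lone dv))
      ; cap = inj₁ aa' ; aa = λ _ → aa'
      ; ch = λ _ du ru → ⊥-elim (noInner du ru) }
      where
      M₀ : V → Bool
      M₀ v = if does (v ≟ r) then m else proj₁ (pref v)
      none : ∀ {v} → ¬ (del D r ∋ v)
      none dv = proj₁ (del-inv D r dv) (lone (proj₂ (del-inv D r dv)))
      noInner : ∀ {u} → D ∋ u → ¬ r ~ u
      noInner du ru = ~⇒≢ ru (sym (lone du))
      bd : Body (del D r) r M₀
      bd = record { c = λ _ _ → A t₀ ; dist = λ dv → ⊥-elim (none dv) ; inn = λ dv → ⊥-elim (none dv)
                  ; sing = λ dv → ⊥-elim (none dv) ; dbl = λ dv → ⊥-elim (none dv) }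
      at : (k : V) → (∀ {w w'} → r ~ w → r ~ w' → w ≢ p → w' ≢ p → w ≢ k → w' ≢ k → w ≡ w') →
           (∀ {w} → Out D r p r w → (∀ {w'} → Out D r p r w' → w' ≡ w) → w ≢ p × k ≡ w) → AA D r p M₀
      at k k~ kk = attach {k = k} {x = B m} {y = B (not m)} dr bd record
        { k~ = k~ ; a≢x = λ () ; a≢y = λ () ; x≢y = λ e → not-≢ m (B-inj e)
        ; free = λ {u} _ → fresh-any {p} {k} ((λ ()) , (λ ()) , λ ()) u
        ; into = λ ds → ⊥-elim (none ds) ; onto = λ ds → ⊥-elim (none ds) ; dblA = λ ds → ⊥-elim (none ds)
        ; rsing = λ ow un → chord (kk ow un) , λ du ru → ⊥-elim (noInner du ru)
        ; rdbl = λ _ _ _ du ru → noInner du ru ; rA = λ _ → isa ; rA₂ = λ _ _ _ → isa }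
        where
        chord : ∀ {w} → w ≢ p × k ≡ w → rootOut p k (A t₀) (B m) (B (not m)) w ≡ B (M₀ r)
        chord (wp , refl) = trans (rootOut-k p k _ _ _ wp) (cong B (sym (upd-self (λ v → proj₁ (pref v)) r m)))
      aa' : AA D r p M₀
      aa' with any? (λ k → (r ~? k) ×-dec ¬? (k ≟ p))
      ... | yes (k , rk , kp) = at k (λ {w} {w'} → k~ {w} {w'})
              (λ { (rw , dw , ne) un → (λ e → ne (refl , e)) , un (rk , ¬∋⇒∌ D (λ dk → noInner dk rk) , λ e → kp (proj₂ e)) })
        where
        k~ : ∀ {w w'} → r ~ w → r ~ w' → w ≢ p → w' ≢ p → w ≢ k → w' ≢ k → w ≡ w'
        k~ {w} {w'} rw rw' wp wp' wk wk' with w ≟ w'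
        ... | yes e = e
        ... | no q = ⊥-elim (two rw rw' rk wp wp' kp q wk wk')
      -- Without a neighbour other than `p`, the argument `k` is a dummy.
      ... | no q = at r (λ rw _ wp _ _ _ → ⊥-elim (q (_ , rw , wp)))
                     (λ { (rw , dw , ne) un → ⊥-elim (q (_ , rw , λ e → ne (refl , e))) })

    -- `r` sends `A t₂` to `p`, `A t₁` to `s` and `B m` to an open end. The child sends `A t₀` or
    -- `B (not m)`, and since entering arcs may agree, either of these can also enter from `p`: one
    -- choice gives `aa`, the other `ch`.
    oneChildStep : ∀ {s m₁} → D ∋ s → r ~ s → (∀ {u} → D ∋ u → r ~ u → u ≡ s) → Ok s m₁ → Solution (del D r) s r m₁ → Solution D r p m
    oneChildStep {s} {m₁} ds rs un oks S with weak (Solution.cap S) (not m) t₁ (λ ())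
    ... | a₁ , pr , o = record
      { M = upd (Solution.M S) r m ; Mr = upd-self (Solution.M S) r m
      ; ok = λ {v} dv vr → subst (Ok v) (sym (upd-other (Solution.M S) r m vr)) (ok' (del-in D r vr dv))
      ; cap = inj₁ aa' ; aa = λ _ → aa'
      ; ch = λ _ _ _ → recolAB (mk {B (not m)} ((λ ()) , (λ ()) , λ e → not-≢ m (B-inj e))) }
      where
      mk : ∀ {b} → Fresh b (A t₂) (A t₁) (B m) → Off D r p (upd (Solution.M S) r m) (A t₂) b
      mk = attach₁ dr ds rs (nbr≢p ds rs) two un o isa isa (λ ()) (A₀B-fresh pr)
      aa' : AA D r p (upd (Solution.M S) r m)
      aa' = recolAA (mk {A t₀} ((λ ()) , (λ ()) , λ ())) (λ ()) (λ ())
      ok' : ∀ {v} → del D r ∋ v → Ok v (Solution.M S v)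
      ok' {v} dv with v ≟ s
      ... | yes refl = subst (Ok s) (sym (Solution.Mr S)) oks
      ... | no q = Solution.ok S dv q

    module Two {s z : V} (ds : D ∋ s) (dz : D ∋ z) (rs : r ~ s) (rz : r ~ z) (s≢z : s ≢ z) where
      C : Sub
      C = del D r
      Cs : C ∋ s
      Cs = del-in D r (λ { refl → ~⇒≢ rs refl }) ds
      Cz : C ∋ z
      Cz = del-in D r (λ { refl → ~⇒≢ rz refl }) dz
      sp : s ≢ p
      sp = nbr≢p ds rs
      zp : z ≢ p
      zp = nbr≢p dz rz

      noOut : ∀ {w} → ¬ Out D r p r w
      noOut (rw , dw , q) = two rw rs rz (λ e → q (refl , e)) sp zp (λ { refl → t≢f ds dw }) (λ { refl → t≢f dz dw }) s≢z

      is-z : ∀ {v} → C ∋ v → v ~ r → v ≢ s → v ≡ z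
      is-z {v} cv vr vs with v ≟ z
      ... | yes e = e
      ... | no q = ⊥-elim (two (~-sym vr) rs rz (nbr≢p (proj₂ (del-inv D r cv)) (~-sym vr)) sp zp vs q s≢z)

      -- In `C`, rooted at `s`, the only open end of `z` is `r`; hence `z` sends `B (M z)` to `r`
      -- and accepts the opposite B colour. Asking `s` for the same B colour leaves `A t₁`, `A t₂`
      -- and that opposite B colour for the arcs leaving `r`.
      closedChordStep : ∀ {m₁} → (∀ {w} → z ~ w → D ∌ w → ⊥) → Ok s m₁ → Solution C s r m₁ → Solution D r p m
      closedChordStep {m₁} noz oks S with weak (Solution.cap S) (Solution.M S z) t₁ (λ ())
      ... | a₁ , pr , o = record
        { M = M' ; Mr = upd-self (Solution.M S) r m
        ; ok = λ {v} dv vr → subst (Ok v) (sym (upd-other (Solution.M S) r m vr)) (ok' (del-in D r vr dv))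
        ; cap = inj₁ aa' ; aa = λ _ → aa' ; ch = λ ow _ _ → ⊥-elim (noOut ow) }
        where
        M' : V → Bool
        M' = upd (Solution.M S) r m
        ok' : ∀ {v} → C ∋ v → Ok v (Solution.M S v)
        ok' {v} dv with v ≟ s
        ... | yes refl = subst (Ok s) (sym (Solution.Mr S)) oks
        ... | no q = Solution.ok S dv q
        isR : ∀ {w} → z ~ w → C ∌ w → w ≡ r
        isR zw cw with del-∌ D r cw
        ... | inj₁ e = e
        ... | inj₂ q = ⊥-elim (noz zw q)
        nz : Off.c o z r ≡ B (Solution.M S z) × (∀ {u} → C ∋ u → z ~ u → isA (Off.c o z u))
        nz = Off.sing o Cz (~-sym rz , del-self D r , λ e → s≢z (sym (proj₁ e))) (λ { (zw , cw , _) → isR zw cw })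
        noOz : ∀ {w} → ¬ OutB C r z w
        noOz (zw , cw , wr) = wr (isR zw cw)
        bd : Body C r M'
        bd = bodyM (λ dv → upd-other (Solution.M S) r m (proj₁ (del-inv D r dv)))
               (toBody o (del-self D r) (λ cv vr vs → subst (λ v → ∀ {w} → ¬ OutB C r v w) (sym (is-z cv vr vs)) noOz))
        freeZ : ∀ {u} → z ~ u → Off.c o z u ≢ B (not (Solution.M S z))
        freeZ {u} zu e with bool? (C u)
        ... | inj₁ cu = A≢B (proj₂ nz cu zu) e
        ... | inj₂ cu with isR zu cu
        ...   | refl = not-≢ (Solution.M S z) (B-inj (trans (sym (proj₁ nz)) e))
        aa' : AA D r p M'
        aa' = recolAA {t = t₂} {s = t₀}
          (attach₂ {x = A t₁} {y = B (not (Solution.M S z))} dr ds dz rs rz s≢z sp zp two pout bd (Off.rp o) (proj₁ nz)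
            (Off.fr o) freeZ (λ _ _ _ → isa) (λ ow _ _ → ⊥-elim (noOz ow)) (λ ()) (λ ()) (λ ())
            (A₀Bμ-fresh pr) (A₀Bμ-fresh (inj₂ refl)) ((λ ()) , (λ ()) , λ ())) (λ ()) (λ ())

      -- Both s and z have one neighbour outside D and one in D - r. The vertex r gives both its B
      -- colours to s and z, and receives the third A colour of z from z.
      openChordStep : Conn C → (∃ λ w → s ~ w × D ∌ w) → (∃ λ y → z ~ y × D ∌ y) →
               ∀ {m₁} → Ok s m₁ → Ok z (not m₁) → Solution C s r m₁ → Solution D r p m
      openChordStep con (w₁ , sw₁ , dw₁) (y , zy , dy) {m₁} oks okz S = record
        { M = M' ; Mr = upd-self M₂ r m
        ; ok = λ {v} dv vr → subst (Ok v) (sym (upd-other M₂ r m vr)) (ok' (del-in D r vr dv))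
        ; cap = inj₁ aa' ; aa = λ _ → aa' ; ch = λ ow _ _ → ⊥-elim (noOut ow) }
        where
        M₂ M' : V → Bool
        M₂ = upd (Solution.M S) z (not m₁)
        M' = upd M₂ r m
        ok' : ∀ {v} → C ∋ v → Ok v (M₂ v)
        ok' {v} dv with v ≟ z
        ... | yes refl = okz
        ... | no _ with v ≟ s
        ...   | yes refl = subst (Ok s) (sym (Solution.Mr S)) oks
        ...   | no q = Solution.ok S dv q
        C∌r : C ∌ r
        C∌r = del-self D r
        y≢r : y ≢ r
        y≢r refl = t≢f dr dy
        w≢r : w₁ ≢ r
        w≢r refl = t≢f dr dw₁
        Cy : C ∌ y
        Cy = del-∌ˡ D r dy
        gs : ∃ λ u → C ∋ u × s ~ u
        gs = conn-nbr C con Cs Cz s≢z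
        gz : ∃ λ g → C ∋ g × z ~ g
        gz = conn-nbr C con Cz Cs (λ e → s≢z (sym e))
        g : V
        g = proj₁ gz
        Cg : C ∋ g
        Cg = proj₁ (proj₂ gz)
        zg : z ~ g
        zg = proj₂ (proj₂ gz)
        o : Off C s r (Solution.M S) (A t₀) (B (not m₁))
        o = Solution.ch S (sw₁ , del-∌ˡ D r dw₁ , λ e → w≢r (proj₂ e)) (proj₁ (proj₂ gs)) (proj₂ (proj₂ gs))
        open Off o using (c; dbl; fr; rp)
        -- In `C` the vertex `z` has the two open ends `r` and `y`, so `dbl` applies; it leaves room
        -- to choose the arcs to `r` and `y` afresh.
        dz' : isA (c z g) × isA (c g z)
        dz' = dbl Cz (~-sym rz , C∌r , λ e → s≢z (sym (proj₁ e))) (zy , Cy , λ e → y≢r (proj₂ e)) (λ e → y≢r (sym e)) Cg zg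
        tri : ∀ {x} → isA x → ∃ λ t → x ≡ A t
        tri (isa {t}) = t , refl
        β φ c₀ x₃ : Tri
        β = proj₁ (tri (proj₁ dz'))
        φ = proj₁ (tri (proj₂ dz'))
        -- Along the edge to `g`, `A β` leaves `z` and `A φ` enters it, so the third A colour is the
        -- one left for the arc to `r`.
        c₀ = proj₁ (third β φ)
        -- `r` is entered by `A t₀` from `s` and by `A c₀` from `z`, and sends both B colours to
        -- them; a further A colour goes to `p`.
        x₃ = proj₁ (third t₀ c₀)
        zgβ : c z g ≡ A β
        zgβ = proj₂ (tri (proj₁ dz'))
        gzφ : c g z ≡ A φ
        gzφ = proj₂ (tri (proj₂ dz'))
        module R = Recolour o C∌r Cz Cg Cy (~-sym rz) zg zy y≢r is-z zgβ gzφ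
                     (proj₁ (proj₂ (third β φ))) (proj₂ (proj₂ (third β φ))) (not m₁)
        aa' : AA D r p M'
        aa' = recolAA {t = x₃} {s = t₀}
          (attach₂ {x = B (not m₁)} {y = B m₁} dr ds dz rs rz s≢z sp zp two pout
            (bodyM (λ dv → upd-other M₂ r m (proj₁ (del-inv D r dv))) R.bd)
            (trans (R.c'o r s≢z) rp) (trans (R.c'z r) R.zer)
            (λ {u} su e → fr su (trans (sym (R.c'o u s≢z)) e))
            (λ {u} zu e → R.ze-any {P = λ x → x ≢ B m₁} (λ ()) (λ ()) (λ e' → not-≢ m₁ (sym (B-inj e'))) u (trans (sym (R.c'z u)) e))
            (λ ow ow' ne → ⊥-elim (R.oneB (proj₁ (proj₂ gs)) (proj₂ (proj₂ gs)) (~-sym rs) ow ow' ne))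
            (λ ow ow' ne → ⊥-elim (R.oneB Cg zg (~-sym rz) ow ow' ne))
            (λ ()) (λ ()) (λ e → not-≢ m₁ (sym (B-inj e)))
            ((λ e → proj₁ (proj₂ (third t₀ c₀)) (A-inj e)) , (λ ()) , λ ())
            ((λ e → proj₂ (proj₂ (third t₀ c₀)) (A-inj e)) , (λ ()) , λ ())
            ((λ e → proj₁ (proj₂ (third t₀ c₀)) (A-inj e)) , (λ ()) , λ ()))
          (proj₁ (proj₂ (third t₀ c₀))) (λ ())

if-true : ∀ {X : Set} {b} {x y : X} → b ≡ true → (if b then x else y) ≡ x
if-true refl = refl

if-false : ∀ {X : Set} {b} {x y : X} → b ≡ false → (if b then x else y) ≡ y
if-false refl = refl

module Recursion {n : ℕ} (H : Subcubic n) (Ok : Fin n → Bool → Set) (pref : ∀ v → ∃ (Ok v))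
             (tie : ∀ s e → s ≢ e → ∃ λ m → Ok s m × Ok e (not m)) where
  open Solve H Ok pref tie public

  -- With `r` added, `X` becomes closed under adjacency in `D` and so exhausts it.
  conn-cover : ∀ (D X : Sub) {r} → Conn D → D ∋ r → (∀ {v w} → X ∋ v → del D r ∋ w → v ~ w → X ∋ w) →
               (∀ {u} → D ∋ u → r ~ u → X ∋ u) → ∀ {v} → del D r ∋ v → X ∋ v
  conn-cover D X {r} con dr clo nb {v} dv with add-inv X r (con (add X r) cl dr (proj₂ (del-inv D r dv)) (add-new X r))
    where
    cl : ∀ {v w} → D ∋ v → D ∋ w → v ~ w → add X r ∋ v → add X r ∋ w
    cl {v} {w} dv dw vw xv with w ≟ r | add-inv X r xv
    ... | yes refl | _ = refl
    ... | no q | inj₁ refl = nb dw vw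
    ... | no q | inj₂ x = clo x (del-in D r q dw) vw
  ... | inj₁ e = ⊥-elim (proj₁ (del-inv D r dv) e)
  ... | inj₂ x = x

  module Three {D : Sub} {r p : V} (dr : D ∋ r) (two : TwoBut r p) (pout : D ∋ p → r ~ p → ⊥) (m : Bool)
               {s z : V} (ds : D ∋ s) (dz : D ∋ z) (rs : r ~ s) (rz : r ~ z) (s≢z : s ≢ z) (con : Conn D) where
    open Step dr two pout m
    open Two ds dz rs rz s≢z

    nbrs : ∀ {u} → D ∋ u → r ~ u → u ≡ s ⊎ u ≡ z
    nbrs {u} du ru with u ≟ s
    ... | yes e = inj₁ e
    ... | no q = inj₂ (is-z (del-in D r (λ { refl → ~⇒≢ ru refl }) du) (~-sym ru) q)

    -- The two pieces do not touch, so each can be asked separately to send `A t₀` or `B (not μ)`;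
    -- then `r` may send `B μ`, `A t₁` and `A t₂`. The field `aa` is vacuous, because the component
    -- of `s` is closed in `C` and misses `z`.
    twoBranchStep : (K : Comp C s) (L : Comp C z) → Comp.C K ∌ z → ∀ {m₁ m₂} → Ok s m₁ → Ok z m₂ →
             Solution (Comp.C K) s r m₁ → Solution (Comp.C L) z r m₂ → Solution D r p m
    twoBranchStep K L kz {m₁} {m₂} oks okz S T = record
      { M = M' ; Mr = upd-self M₂ r m
      ; ok = λ {v} dv vr → subst (Ok v) (sym (upd-other M₂ r m vr)) (ok' (del-in D r vr dv))
      ; cap = inj₂ λ μ → recolBA (beta μ)
      ; aa = λ conC → ⊥-elim (t≢f (conC K.C (λ _ cw vw kv → K.clo kv cw vw) Cs Cz K.root) kz)
      ; ch = λ ow _ _ → ⊥-elim (noOut ow) }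
      where
      module K = Comp K
      module L = Comp L
      M₂ M' : V → Bool
      M₂ = glueM K.C (Solution.M S) (Solution.M T)
      M' = upd M₂ r m
      disj : ∀ {v} → K.C ∋ v → L.C ∋ v → ⊥
      disj kv lv = t≢f (L.conn K.C (λ lv lw vw kv → K.clo kv (L.⊆W lw) vw) lv L.root kv) kz
      apart : ∀ {v w} → K.C ∋ v → L.C ∋ w → v ~ w → ⊥
      apart kv lw vw = disj (K.clo kv (L.⊆W lw) vw) lw
      U : Sub
      U = union K.C L.C
      inU : ∀ {v} → K.C ∋ v ⊎ L.C ∋ v → U ∋ v
      inU (inj₁ k) rewrite k = refl
      inU {v} (inj₂ l) with K.C v
      ... | true = refl
      ... | false = l
      outU : ∀ {v} → U ∋ v → K.C ∋ v ⊎ L.C ∋ v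
      outU {v} u with K.C v
      ... | true = inj₁ refl
      ... | false = inj₂ u
      Ceq : ∀ v → C v ≡ U v
      Ceq v = bool-ext (conn-cover D U con dr
                  (λ uv cw vw → inU (Sum.map (λ k → K.clo k cw vw) (λ l → L.clo l cw vw) (outU uv)))
                  (λ du ru → inU (Sum.map (λ { refl → K.root }) (λ { refl → L.root }) (nbrs du ru))))
                (λ u → Sum.[ K.⊆W , L.⊆W ]′ (outU u))
      ok' : ∀ {v} → C ∋ v → Ok v (M₂ v)
      ok' {v} cv with bool? (K.C v)
      ... | inj₁ k with v ≟ s
      ...   | yes refl = subst (Ok s) (sym (trans (if-true k) (Solution.Mr S))) oks
      ...   | no q = subst (Ok v) (sym (if-true k)) (Solution.ok S k q)
      ok' {v} cv | inj₂ k with v ≟ z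
      ...   | yes refl = subst (Ok z) (sym (trans (if-false k) (Solution.Mr T))) okz
      ...   | no q with outU {v} (trans (sym (Ceq v)) cv)
      ...     | inj₁ k' = ⊥-elim (t≢f k' k)
      ...     | inj₂ l = subst (Ok v) (sym (if-false k)) (Solution.ok T l q)
      beta : ∀ μ → Off D r p M' (B μ) (A t₀)
      beta μ with weak (Solution.cap S) (not μ) t₁ (λ ()) | weak (Solution.cap T) (not μ) t₂ (λ ())
      ... | a₁ , pr₁ , o₁ | a₂ , pr₂ , o₂ =
        attach₂ {x = A t₁} {y = A t₂} dr ds dz rs rz s≢z sp zp two pout bd e₁ e₂ f₁ f₂
          (λ _ _ _ → isa) (λ _ _ _ → isa) (λ ()) (λ ()) (λ ()) (fr pr₁) (fr pr₂) ((λ ()) , (λ ()) , λ ())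
        where
        bK : Body K.C r (Solution.M S)
        bK = toBody o₁ (¬∋⇒∌ K.C (λ k → proj₁ (del-inv D r (K.⊆W k)) refl))
               (λ kv vr vs → ⊥-elim (t≢f (subst (K.C ∋_) (is-z (K.⊆W kv) vr vs) kv) kz))
        bL : Body L.C r (Solution.M T)
        bL = toBody o₂ (¬∋⇒∌ L.C (λ l → proj₁ (del-inv D r (L.⊆W l)) refl))
               (λ lv vr vz → ⊥-elim (notS lv vr vz))
          where
          notS : ∀ {v} → L.C ∋ v → v ~ r → v ≢ z → ⊥
          notS {v} lv vr vz with v ≟ s
          ... | yes refl = disj K.root lv
          ... | no q = vz (is-z (L.⊆W lv) vr q)
        bd : Body C r M'
        bd = bodyExt Ceq (bodyM (λ {v} dv → upd-other M₂ r m (proj₁ (del-inv D r (trans (Ceq v) dv))))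
               (bodyUnion bK bL disj apart))
        e₁ : Body.c bd s r ≡ a₁
        e₁ = trans (cong (λ (f : V → Col) → f r) (if-true {x = Off.c o₁ s} {Body.c bL s} K.root)) (Off.rp o₁)
        e₂ : Body.c bd z r ≡ a₂
        e₂ = trans (cong (λ (f : V → Col) → f r) (if-false {x = Body.c bK z} {Off.c o₂ z} kz)) (Off.rp o₂)
        f₁ : ∀ {u} → s ~ u → Body.c bd s u ≢ A t₁
        f₁ {u} su e = Off.fr o₁ su (trans (sym (cong (λ (f : V → Col) → f u) (if-true {x = Off.c o₁ s} {Body.c bL s} K.root))) e)
        f₂ : ∀ {u} → z ~ u → Body.c bd z u ≢ A t₂
        f₂ {u} zu e = Off.fr o₂ zu (trans (sym (cong (λ (f : V → Col) → f u) (if-false {x = Body.c bK z} {Off.c o₂ z} kz))) e)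
        fr : ∀ {a} → (a ≡ A t₀ ⊎ a ≡ B (not μ)) → Fresh a (B μ) (A t₁) (A t₂)
        fr (inj₁ refl) = (λ ()) , (λ ()) , λ ()
        fr (inj₂ refl) = (λ e → not-≢ μ (B-inj e)) , (λ ()) , λ ()

  -- Each round removes the root, and its neighbours become roots with parent `r`. If two neighbours
  -- stay connected without `r`, only one of them can be the new root and the edge to the other is a
  -- chord. A neighbour without edges leaving `D` is preferred as the end of the chord.
  solve : ∀ k (D : Sub) {r p} → size D ≤ k → Conn D → D ∋ r → TwoBut r p → (D ∋ p → r ~ p → ⊥) → ∀ m → Solution D r p m
  solve zero D {r} le con dr two pout m with ≤-trans (≤-reflexive (sym (size-del D r dr))) le
  ... | ()
  solve (suc k) D {r} {p} le con dr two pout m = go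
    where
    open Step dr two pout m
    C : Sub
    C = del D r
    leC : size C ≤ k
    leC = ≤-pred (≤-trans (≤-reflexive (sym (size-del D r dr))) le)
    sub : ∀ (E : Sub) → (∀ {v} → E ∋ v → C ∋ v) → size E ≤ k
    sub E f = ≤-trans (size-mono {E} {C} (λ v → f)) leC
    rec : ∀ (E : Sub) {s} → (∀ {v} → E ∋ v → C ∋ v) → Conn E → E ∋ s → r ~ s → ∀ m → Solution E s r m
    rec E {s} f con es rs m = solve k E (sub E f) con es (twoBut (~-sym rs)) (λ er _ → t≢f (f er) (del-self D r)) m
    inC : ∀ {s} → D ∋ s → r ~ s → C ∋ s
    inC ds rs = del-in D r (λ { refl → ~⇒≢ rs refl }) ds
    out? : ∀ z → Dec (∃ λ w → z ~ w × D ∌ w)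
    out? z = any? (λ w → (z ~? w) ×-dec (D ∌? w))
    go : Solution D r p m
    go with any? (λ s → (D ∋? s) ×-dec (r ~? s))
    ... | no q = leaf (λ du → only-inv r (con (only r)
            (λ { dv dw vw rv → ⊥-elim (q (_ , dw , subst (_~ _) (only-inv r rv) vw)) }) dr du (only-self r)))
    ... | yes (s , ds , rs) with any? (λ z → ((D ∋? z) ×-dec (r ~? z)) ×-dec ¬? (z ≟ s))
    ...   | no q = oneChildStep ds rs un (proj₂ (pref s)) (rec C (λ c → c) (conn-del₁ D con dr ds rs un) (inC ds rs) rs _)
      where
      un : ∀ {u} → D ∋ u → r ~ u → u ≡ s
      un {u} du ru with u ≟ s
      ... | yes e = e
      ... | no q' = ⊥-elim (q (u , (du , ru) , q'))
    ...   | yes (z , (dz , rz) , z≢s) = fork (bool? (Comp.C K z))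
      where
      s≢z : s ≢ z
      s≢z e = z≢s (sym e)
      K : Comp C s
      K = comp C (inC ds rs)
      open Three dr two pout m ds dz rs rz s≢z con
      fork : Comp.C K ∋ z ⊎ Comp.C K ∌ z → Solution D r p m
      fork (inj₂ kz) = twoBranchStep K L kz (proj₂ (pref s)) (proj₂ (pref z))
          (rec (Comp.C K) (Comp.⊆W K) (Comp.conn K) (Comp.root K) rs _)
          (rec (Comp.C L) (Comp.⊆W L) (Comp.conn L) (Comp.root L) rz _)
        where
        L : Comp C z
        L = comp C (inC dz rz)
      fork (inj₁ kz) = chordal (out? s) (out? z)
        where
        conC : Conn C
        conC = conn-ext (λ v → bool-ext (Comp.⊆W K) (conn-cover D (Comp.C K) con dr (Comp.clo K)
                 (λ du ru → Sum.[ (λ { refl → Comp.root K }) , (λ { refl → kz }) ]′ (nbrs du ru)))) (Comp.conn K)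
        module TT = Two ds dz rs rz s≢z
        chordal : Dec (∃ λ w → s ~ w × D ∌ w) → Dec (∃ λ w → z ~ w × D ∌ w) → Solution D r p m
        chordal _ (no q) = TT.closedChordStep (λ zw dw → q (_ , zw , dw)) (proj₂ (pref s)) (rec C (λ c → c) conC (inC ds rs) rs _)
        chordal (no q) (yes _) = Two.closedChordStep dz ds rz rs z≢s (λ sw dw → q (_ , sw , dw)) (proj₂ (pref z))
                                   (rec C (λ c → c) conC (inC dz rz) rz _)
        -- The two B colours sent by `r` are distinct, so `M` must take opposite values at `s` and
        -- `z`; `tie` reconciles this with the prescribed values.
        chordal (yes o) (yes o') with tie s z s≢z
        ... | m₁ , oks , okz = TT.openChordStep conC o o' oks okz (rec C (λ c → c) conC (inC ds rs) rs m₁)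

-- Parity of degree sums

Even : ℕ → Set
Even m = ∃ λ k → m ≡ k + k

ind≤1 : ∀ b → ind b ≤ 1
ind≤1 true = ≤-refl
ind≤1 false = z≤n

-- By symmetry the first row and the first column contribute the same sum; the rest is a smaller
-- matrix of the same kind.
handshake : ∀ {n} (f : Fin n → Fin n → ℕ) → (∀ i j → f i j ≡ f j i) → (∀ i → f i i ≡ 0) →
            Even (sumF λ i → sumF (f i))
handshake {zero} f s d = 0 , refl
handshake {suc n} f s d with handshake (λ i j → f (suc i) (suc j)) (λ i j → s (suc i) (suc j)) (d ∘ suc)
... | k , e = X + k , (begin
    (f zero zero + X) + sumF (λ i → f (suc i) zero + sumF (f (suc i) ∘ suc))
      ≡⟨ cong₂ _+_ (cong (_+ X) (d zero)) (sum-+ (λ i → f (suc i) zero) _) ⟩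
    X + (sumF (λ i → f (suc i) zero) + Y)
      ≡⟨ cong (λ t → X + (t + Y)) (sum-cong λ i → s (suc i) zero) ⟩
    X + (X + Y)  ≡⟨ cong (λ t → X + (X + t)) e ⟩
    X + (X + (k + k)) ≡⟨ solve 2 (λ x k → x :+ (x :+ (k :+ k)) := (x :+ k) :+ (x :+ k)) refl X k ⟩
    (X + k) + (X + k) ∎)
  where
  open ≡-Reasoning
  open +-*-Solver
  X = sumF (f zero ∘ suc)
  Y = sumF (λ i → sumF (f (suc i) ∘ suc))

even-gap : ∀ {s e} → Even e → s + s < e → s + s + 2 ≤ e
even-gap {s} (k , refl) lt with suc s ≤? k
... | yes p = ≤-trans (≤-reflexive (solve 1 (λ s → s :+ s :+ con 2 := (con 1 :+ s) :+ (con 1 :+ s)) refl s)) (+-mono-≤ p p)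
  where open +-*-Solver
... | no q = ⊥-elim (<⇒≱ lt (+-mono-≤ (≤-pred (≰⇒> q)) (≤-pred (≰⇒> q))))

-- Splitting a cubic component

module Counting {n : ℕ} (H : Subcubic n) where
  open Steps H public

  deg : Sub → V → ℕ
  deg R v = sumF λ u → ind (R u ∧ adj v u)

  e₂ : Sub → ℕ
  e₂ R = sumF λ v → if R v then deg R v else 0

  deg-del : ∀ (R : Sub) x v → R ∋ x → deg R v ≡ ind (adj v x) + deg (del R x) v
  deg-del R x v rx = trans (sum-cong pt) (trans (sum-+ (λ u → onlyAt x u (ind (adj v u))) _)
                       (cong (_+ deg (del R x) v) (sum-onlyAt x (λ u → ind (adj v u)))))
    where
    pt : ∀ u → ind (R u ∧ adj v u) ≡ onlyAt x u (ind (adj v u)) + ind (del R x u ∧ adj v u)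
    pt u with u ≟ x
    ... | yes refl rewrite rx = sym (+-identityʳ _)
    ... | no _ = refl

  -- The degree of `x` is lost twice: once as the term at `x`, once as a unit in the term of each of
  -- its neighbours.
  e₂-del : ∀ (R : Sub) x → R ∋ x → e₂ R ≡ e₂ (del R x) + (deg R x + deg R x)
  e₂-del R x rx = begin
    e₂ R ≡⟨ sum-cong pt ⟩
    sumF (λ v → onlyAt x v (deg R v) + ((if del R x v then deg (del R x) v else 0) + ind (R v ∧ adj x v)))
      ≡⟨ sum-+ (λ v → onlyAt x v (deg R v)) _ ⟩
    sumF (λ v → onlyAt x v (deg R v)) + sumF (λ v → (if del R x v then deg (del R x) v else 0) + ind (R v ∧ adj x v))
      ≡⟨ cong₂ _+_ (sum-onlyAt x (deg R)) (sum-+ (λ v → if del R x v then deg (del R x) v else 0) _) ⟩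
    deg R x + (e₂ (del R x) + deg R x)
      ≡⟨ solve 2 (λ d e → d :+ (e :+ d) := e :+ (d :+ d)) refl (deg R x) (e₂ (del R x)) ⟩
    e₂ (del R x) + (deg R x + deg R x) ∎
    where
    open ≡-Reasoning
    open +-*-Solver
    pt : ∀ v → (if R v then deg R v else 0) ≡
               onlyAt x v (deg R v) + ((if del R x v then deg (del R x) v else 0) + ind (R v ∧ adj x v))
    pt v with v ≟ x
    ... | yes refl rewrite rx | irr v = sym (+-identityʳ _)
    ... | no _ with R v
    ...   | true = trans (deg-del R x v rx) (trans (cong (λ b → ind b + deg (del R x) v) (~-symᵇ v x)) (+-comm (ind (adj x v)) _))
    ...   | false = refl

  e₂-even : ∀ R → Even (e₂ R)
  e₂-even R = subst Even (sum-cong inner)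
    (handshake (λ v u → ind (R v ∧ (R u ∧ adj v u))) symm diag)
    where
    inner : ∀ v → sumF (λ u → ind (R v ∧ (R u ∧ adj v u))) ≡ (if R v then deg R v else 0)
    inner v with R v
    ... | true = refl
    ... | false = sum-0 {n}
    symm : ∀ v u → ind (R v ∧ (R u ∧ adj v u)) ≡ ind (R u ∧ (R v ∧ adj u v))
    symm v u rewrite ~-symᵇ v u | sym (∧-assoc (R v) (R u) (adj u v)) | ∧-comm (R v) (R u) | ∧-assoc (R u) (R v) (adj u v) = refl
    diag : ∀ v → ind (R v ∧ (R v ∧ adj v v)) ≡ 0
    diag v rewrite irr v with R v
    ... | true = refl
    ... | false = refl

  record Three~ (v : V) : Set where
    field
      x y z : V
      vx : v ~ x
      vy : v ~ y
      vz : v ~ z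
      x≢y : x ≢ y
      x≢z : x ≢ z
      y≢z : y ≢ z
    all : ∀ {w} → v ~ w → w ≡ x ⊎ w ≡ y ⊎ w ≡ z
    all {w} vw with w ≟ x | w ≟ y | w ≟ z
    ... | yes e | _ | _ = inj₁ e
    ... | no _ | yes e | _ = inj₂ (inj₁ e)
    ... | no _ | no _ | yes e = inj₂ (inj₂ e)
    ... | no p | no q | no r = ⊥-elim (deg≤3 v vw vx vy vz p q r x≢y x≢z y≢z)

  deg-three : ∀ (R : Sub) {v} (t : Three~ v) → let open Three~ t in deg R v ≡ ind (R x) + (ind (R y) + ind (R z))
  deg-three R {v} t = trans (sum-cong pt) (trans (sum-+ (λ u → onlyAt x u (ind (R u))) _)
      (cong₂ _+_ (sum-onlyAt x (ind ∘ R)) (trans (sum-+ (λ u → onlyAt y u (ind (R u))) _)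
        (cong₂ _+_ (sum-onlyAt y (ind ∘ R)) (sum-onlyAt z (ind ∘ R))))))
    where
    open Three~ t
    nadj : ∀ {u} → u ≢ x → u ≢ y → u ≢ z → adj v u ≡ false
    nadj {u} p q r with adj v u in e
    ... | false = refl
    ... | true with all e
    ...   | inj₁ e' = ⊥-elim (p e')
    ...   | inj₂ (inj₁ e') = ⊥-elim (q e')
    ...   | inj₂ (inj₂ e') = ⊥-elim (r e')
    pt : ∀ u → ind (R u ∧ adj v u) ≡ onlyAt x u (ind (R u)) + (onlyAt y u (ind (R u)) + onlyAt z u (ind (R u)))
    pt u with u ≟ x | u ≟ y | u ≟ z
    ... | yes refl | yes e | _ = ⊥-elim (x≢y e)
    ... | yes refl | no _ | yes e = ⊥-elim (x≢z e)
    ... | yes refl | no _ | no _ rewrite vx with R u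
    ...   | true = refl
    ...   | false = refl
    pt u | no _ | yes refl | yes e = ⊥-elim (y≢z e)
    pt u | no _ | yes refl | no _ rewrite vy with R u
    ...   | true = refl
    ...   | false = refl
    pt u | no _ | no _ | yes refl rewrite vz with R u
    ...   | true = refl
    ...   | false = refl
    pt u | no p | no q | no r rewrite nadj p q r with R u
    ...   | true = refl
    ...   | false = refl

  diff : Sub → Sub → Sub
  diff U R v = U v ∧ not (R v)

  diff-in : ∀ (U R : Sub) {v} → U ∋ v → R ∌ v → diff U R ∋ v
  diff-in U R u r rewrite u | r = refl

  diff-inv : ∀ (U R : Sub) {v} → diff U R ∋ v → U ∋ v × R ∌ v
  diff-inv U R {v} p with U v | R v
  ... | true | false = refl , refl

  diff-∌ : ∀ (U R : Sub) {v} → U ∋ v → diff U R ∌ v → R ∋ v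
  diff-∌ U R {v} u p rewrite u with R v
  ... | true = refl

  empty-e₂ : ∀ (R : Sub) → (∀ v → R ∌ v) → e₂ R ≡ 0
  empty-e₂ R none = trans (sum-cong z) (sum-0 {n})
    where
    z : ∀ v → (if R v then deg R v else 0) ≡ 0
    z v rewrite none v = refl

module Growing {n : ℕ} (H : Subcubic n) (U : Fin n → Bool)
               (closed : ∀ {v w} → U v ≡ true → Subcubic.adj H v w ≡ true → U w ≡ true)
               (conU : SubcubicGraph.Conn H U)
               (cubic : ∀ {v} → U v ≡ true → Counting.Three~ H v) where
  open Counting H public

  K : Sub → Sub
  K R = diff U R

  -- K R is connected and R spans at least as many edges as it has vertices: e₂ counts inner arcs.
  record Surplus (R : Sub) : Set where
    field
      sub : ∀ {v} → R ∋ v → U ∋ v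
      conK : Conn (K R)
      kne : ∃ λ k → K R ∋ k
      ne  : ∃ λ v → R ∋ v
      le  : size R + size R ≤ e₂ R

  -- The inequality is the doubled form of `|R| - 1 ≤ edges of R - deg R w`, that is, of the surplus
  -- left after `w` has moved. The neighbour in `K R` keeps `K R` connected.
  Grow? : Sub → V → Set
  Grow? R w = (R ∋ w × ∃ λ u → K R ∋ u × w ~ u) × size R + size R + (deg R w + deg R w) ≤ e₂ R + 2

  grow? : ∀ R w → Dec (Grow? R w)
  grow? R w = ((R ∋? w) ×-dec any? (λ u → (K R ∋? u) ×-dec (w ~? u))) ×-dec
              (size R + size R + (deg R w + deg R w) ≤? e₂ R + 2)

  K-del : ∀ (R : Sub) {w} → U ∋ w → ∀ v → add (K R) w v ≡ K (del R w) v
  K-del R {w} uw v with v ≟ w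
  ... | yes refl rewrite uw = refl
  ... | no _ = refl

  step : ∀ {R w} → Surplus R → Grow? R w → Surplus (del R w)
  step {R} {w} g ((rw , u , ku , wu) , num) = record
    { sub = λ p → sub (proj₂ (del-inv R w p))
    ; conK = conn-ext (K-del R (sub rw)) (conn-add (K R) conK ku (~-sym wu))
    ; kne = u , trans (sym (K-del R (sub rw) u)) (add-old (K R) w ku)
    ; ne = ne'
    ; le = le' }
    where
    open Surplus g
    R' : Sub
    R' = del R w
    d = deg R w
    le' : size R' + size R' ≤ e₂ R'
    le' = +-cancelʳ-≤ (d + d + 2) _ _ (≤-trans (≤-reflexive (trans
            (solve 2 (λ s d → s :+ s :+ (d :+ d :+ con 2) := (con 1 :+ s) :+ (con 1 :+ s) :+ (d :+ d)) refl (size R') d)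
            (cong (λ s → s + s + (d + d)) (sym (size-del R w rw)))))
          (≤-trans num (≤-reflexive (trans (cong (_+ 2) (e₂-del R w rw)) (+-assoc (e₂ R') (d + d) 2)))))
      where open +-*-Solver
    -- If `w` were all of `R`, there would be one vertex and no edge, against the surplus.
    ne' : ∃ λ v → R' ∋ v
    ne' with any? (λ v → R' ∋? v)
    ... | yes p = p
    ... | no q = ⊥-elim (contra (≤-trans (+-mono-≤ big big) (≤-trans le (≤-reflexive zero-e))))
      where
      none : ∀ v → R' ∌ v
      none v = ¬∋⇒∌ R' (λ p → q (v , p))
      big : 1 ≤ size R
      big = ≤-trans (s≤s z≤n) (≤-reflexive (sym (size-del R w rw)))
      zero-d : deg R w ≡ 0
      zero-d = trans (sum-cong pt) (sum-0 {n})
        where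
        pt : ∀ u → ind (R u ∧ adj w u) ≡ 0
        pt u with bool? (R u)
        ... | inj₂ r rewrite r = refl
        ... | inj₁ r with del-∌ R w (none u)
        ...   | inj₁ refl rewrite r | irr u = refl
        ...   | inj₂ r' = ⊥-elim (t≢f r r')
      zero-e : e₂ R ≡ 0
      zero-e = trans (e₂-del R w rw) (trans (cong (λ d → e₂ R' + (d + d)) zero-d) (trans (+-identityʳ _) (empty-e₂ R' none)))
      contra : ¬ (2 ≤ 0)
      contra ()

  record Terminal (R : Sub) : Set where
    field
      gs   : Surplus R
      two  : ∀ {v} → R ∋ v → deg R v ≡ 2

  Smaller : Sub → Set
  Smaller R = ∃ λ R' → size R' < size R × Surplus R'

  size-lt : ∀ (R : Sub) {w} → R ∋ w → size (del R w) < size R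
  size-lt R rw = ≤-reflexive (sym (size-del R _ rw))

  -- A vertex of `R` next to `K R` has degree at most two in `R`, and with degree at most one it
  -- could be moved. If all moves are blocked, these degrees are two, and one blocked inequality
  -- gives `e₂ R < 2 |R| + 2`. Any other vertex of `R` has degree three; a single one would push
  -- `e₂ R` above `2 |R|`, hence by parity to `2 |R| + 2`.
  terminal? : ∀ {R} → Surplus R → Smaller R ⊎ Terminal R
  terminal? {R} g with any? (grow? R)
  ... | yes (w , gw) = inj₁ (del R w , size-lt R (proj₁ (proj₁ gw)) , step g gw)
  ... | no none = inj₂ (record { gs = g ; two = λ rv → two rv (proj₂ near) })
    where
    open Surplus g
    s = size R
    near : ∃ λ w → R ∋ w × ∃ λ u → K R ∋ u × w ~ u
    near with any? (λ w → (R ∋? w) ×-dec any? (λ u → (K R ∋? u) ×-dec (w ~? u)))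
    ... | yes p = p
    ... | no q = ⊥-elim (t≢f (conU R cl (sub (proj₂ ne)) (proj₁ (diff-inv U R (proj₂ kne))) (proj₂ ne))
                              (proj₂ (diff-inv U R (proj₂ kne))))
      where
      cl : ∀ {v w} → U ∋ v → U ∋ w → v ~ w → R ∋ v → R ∋ w
      cl {v} {w} uv uw vw rv with bool? (R w)
      ... | inj₁ r = r
      ... | inj₂ r = ⊥-elim (q (v , rv , w , diff-in U R uw r , vw))
    blocked : ∀ {w} → (R ∋ w × ∃ λ u → K R ∋ u × w ~ u) → e₂ R + 2 < s + s + (deg R w + deg R w)
    blocked p = ≰⇒> (λ num → none (_ , p , num))
    d≥2 : ∀ {w} → (R ∋ w × ∃ λ u → K R ∋ u × w ~ u) → 2 ≤ deg R w
    d≥2 {w} p with 2 ≤? deg R w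
    ... | yes q = q
    ... | no q = ⊥-elim (<⇒≱ (blocked p) (≤-trans (+-monoʳ-≤ (s + s) (+-mono-≤ d≤1 d≤1)) (+-monoˡ-≤ 2 le)))
      where
      d≤1 : deg R w ≤ 1
      d≤1 = ≤-pred (≰⇒> q)
    few : ∀ {v} → R ∋ v → (∃ λ u → K R ∋ u × v ~ u) → deg R v ≤ 2
    few {v} rv (u , ku , vu) with cubic (sub rv)
    ... | t rewrite deg-three R t with Three~.all t vu
    ...   | inj₁ refl rewrite proj₂ (diff-inv U R ku) = +-mono-≤ (ind≤1 (R (Three~.y t))) (ind≤1 (R (Three~.z t)))
    ...   | inj₂ (inj₁ refl) rewrite proj₂ (diff-inv U R ku) = +-mono-≤ (ind≤1 (R (Three~.x t))) (ind≤1 (R (Three~.z t)))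
    ...   | inj₂ (inj₂ refl) rewrite proj₂ (diff-inv U R ku) | +-identityʳ (ind (R (Three~.y t))) =
            +-mono-≤ (ind≤1 (R (Three~.x t))) (ind≤1 (R (Three~.y t)))
    inR : ∀ {v u} → R ∋ v → ¬ (∃ λ u → K R ∋ u × v ~ u) → v ~ u → R ∋ u
    inR {u = u} rv q vu = diff-∌ U R (closed (sub rv) vu) (¬∋⇒∌ (K R) (λ ku → q (u , ku , vu)))
    full : ∀ {v} → R ∋ v → ¬ (∃ λ u → K R ∋ u × v ~ u) → deg R v ≡ 3
    full {v} rv q = trans (deg-three R t)
      (cong₂ _+_ (cong ind (inR rv q t.vx)) (cong₂ _+_ (cong ind (inR rv q t.vy)) (cong ind (inR rv q t.vz))))
      where
      t = cubic (sub rv)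
      module t = Three~ t
    e< : e₂ R < s + s + 2
    e< = +-cancelʳ-≤ 2 _ _ (≤-trans (blocked (proj₂ near)) (≤-trans (+-monoʳ-≤ (s + s)
            (+-mono-≤ (few (proj₁ (proj₂ near)) (proj₂ (proj₂ near))) (few (proj₁ (proj₂ near)) (proj₂ (proj₂ near)))))
            (≤-reflexive (sym (+-assoc (s + s) 2 2)))))
    two : ∀ {v w} → R ∋ v → (R ∋ w × ∃ λ u → K R ∋ u × w ~ u) → deg R v ≡ 2
    two {v} rv _ with any? (λ u → (K R ∋? u) ×-dec (v ~? u))
    ... | yes p = ≤-antisym (few rv p) (d≥2 (rv , p))
    ... | no q = ⊥-elim (<⇒≱ e< (even-gap {s} (e₂-even R) more))
      where
      more : s + s < e₂ R
      more = ≤-trans (≤-reflexive (sym (trans (sum-+ (λ u → onlyAt v u 1) _)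
               (cong₂ _+_ (sum-onlyAt v (λ _ → 1)) (sum-+ (ind ∘ R) (ind ∘ R)))))) (sum-mono pt)
        where
        pt : ∀ u → onlyAt v u 1 + (ind (R u) + ind (R u)) ≤ (if R u then deg R u else 0)
        pt u with u ≟ v
        ... | yes refl rewrite rv = ≤-reflexive (sym (full rv q))
        ... | no _ with R u in ru
        ...   | false = z≤n
        ...   | true with any? (λ x → (K R ∋? x) ×-dec (u ~? x))
        ...     | yes p = d≥2 (ru , p)
        ...     | no q' = ≤-trans (n≤1+n 2) (≤-reflexive (sym (full ru q')))

module Certificates {n : ℕ} (H : Subcubic n) where
  open Pieces H

  record Cert (U : Sub) : Set where
    field
      c    : Colouring
      dist : ∀ {v w w'} → U ∋ v → v ~ w → v ~ w' → c v w ≡ c v w' → w ≡ w'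
      inn  : ∀ {v w u} → U ∋ v → U ∋ w → v ~ w → w ~ u → c v w ≢ c w u

module Separate {n : ℕ} (σ τ : Fin n) (σ≢τ : σ ≢ τ) where
  Ok : Fin n → Bool → Set
  Ok v m = (v ≡ σ → m ≡ false) × (v ≡ τ → m ≡ true)

  pref : ∀ v → ∃ (Ok v)
  pref v with v ≟ τ
  ... | yes refl = true , (λ e → ⊥-elim (σ≢τ (sym e))) , λ _ → refl
  ... | no q = false , (λ _ → refl) , λ e → ⊥-elim (q e)

  -- Values are prescribed at two vertices only, and they are opposite. So two distinct vertices can
  -- always be given opposite values.
  tie : ∀ s e → s ≢ e → ∃ λ m → Ok s m × Ok e (not m)
  tie s e s≢e with s ≟ σ | s ≟ τ
  ... | yes refl | _ = false , ((λ _ → refl) , λ x → ⊥-elim (σ≢τ x)) , ((λ x → ⊥-elim (s≢e (sym x))) , λ _ → refl)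
  ... | no _ | yes refl = true , ((λ x → ⊥-elim (σ≢τ (sym x))) , λ _ → refl) , ((λ _ → refl) , λ x → ⊥-elim (s≢e (sym x)))
  ... | no p | no q with e ≟ σ
  ...   | yes refl = true , ((λ x → ⊥-elim (p x)) , λ _ → refl) , ((λ _ → refl) , λ x → ⊥-elim (σ≢τ x))
  ...   | no r = false , ((λ _ → refl) , λ x → ⊥-elim (q x)) , ((λ x → ⊥-elim (r x)) , λ _ → refl)

-- Closing the cycle

module Closing {n : ℕ} (H : Subcubic n) (U : Fin n → Bool)
               (closed : ∀ {v w} → U v ≡ true → Subcubic.adj H v w ≡ true → U w ≡ true)
               (conU : SubcubicGraph.Conn H U)
               (cubic : ∀ {v} → U v ≡ true → Counting.Three~ H v) where
  open Growing H U closed conU cubic public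
  open Certificates H using (Cert) public

  record RingAt (R : Sub) (v : V) : Set where
    field
      p q o : V
      vp : v ~ p
      vq : v ~ q
      vo : v ~ o
      Rp : R ∋ p
      Rq : R ∋ q
      Ro : R ∌ o
      p≢q : p ≢ q
      isR : ∀ {w} → v ~ w → R ∋ w → w ≡ p ⊎ w ≡ q
      isK : ∀ {w} → v ~ w → R ∌ w → w ≡ o

  ringAt : ∀ {R v} → Terminal R → R ∋ v → RingAt R v
  ringAt {R} {v} T rv = go (bool? (R x)) (bool? (R y)) (bool? (R z))
    where
    t = cubic (Surplus.sub (Terminal.gs T) rv)
    open Three~ t
    d : ind (R x) + (ind (R y) + ind (R z)) ≡ 2
    d = trans (sym (deg-three R t)) (Terminal.two T rv)
    mk : ∀ p q o → v ~ p → v ~ q → v ~ o → R ∋ p → R ∋ q → R ∌ o → p ≢ q →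
         (∀ {w} → v ~ w → w ≡ p ⊎ w ≡ q ⊎ w ≡ o) → RingAt R v
    mk p q o vp vq vo rp rq ro p≢q al = record
      { p = p ; q = q ; o = o ; vp = vp ; vq = vq ; vo = vo ; Rp = rp ; Rq = rq ; Ro = ro ; p≢q = p≢q
      ; isR = λ vw rw → fR rw (al vw) ; isK = λ vw rw → fK rw (al vw) }
      where
      fR : ∀ {w} → R ∋ w → w ≡ p ⊎ w ≡ q ⊎ w ≡ o → w ≡ p ⊎ w ≡ q
      fR rw (inj₁ e) = inj₁ e
      fR rw (inj₂ (inj₁ e)) = inj₂ e
      fR rw (inj₂ (inj₂ refl)) = ⊥-elim (t≢f rw ro)
      fK : ∀ {w} → R ∌ w → w ≡ p ⊎ w ≡ q ⊎ w ≡ o → w ≡ o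
      fK rw (inj₁ refl) = ⊥-elim (t≢f rp rw)
      fK rw (inj₂ (inj₁ refl)) = ⊥-elim (t≢f rq rw)
      fK rw (inj₂ (inj₂ e)) = e
    rot : ∀ {w} → w ≡ x ⊎ w ≡ y ⊎ w ≡ z → w ≡ y ⊎ w ≡ z ⊎ w ≡ x
    rot (inj₁ e) = inj₂ (inj₂ e)
    rot (inj₂ (inj₁ e)) = inj₁ e
    rot (inj₂ (inj₂ e)) = inj₂ (inj₁ e)
    swp : ∀ {w} → w ≡ x ⊎ w ≡ y ⊎ w ≡ z → w ≡ x ⊎ w ≡ z ⊎ w ≡ y
    swp (inj₁ e) = inj₁ e
    swp (inj₂ (inj₁ e)) = inj₂ (inj₂ e)
    swp (inj₂ (inj₂ e)) = inj₂ (inj₁ e)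
    bad : ∀ {a b c} → R x ≡ a → R y ≡ b → R z ≡ c → ind a + (ind b + ind c) ≢ 2 → RingAt R v
    bad ex ey ez q = ⊥-elim (q (trans (sym (cong₂ _+_ (cong ind ex) (cong₂ _+_ (cong ind ey) (cong ind ez)))) d))
    go : R ∋ x ⊎ R ∌ x → R ∋ y ⊎ R ∌ y → R ∋ z ⊎ R ∌ z → RingAt R v
    go (inj₁ a) (inj₁ b) (inj₂ c) = mk x y z vx vy vz a b c x≢y all
    go (inj₁ a) (inj₂ b) (inj₁ c) = mk x z y vx vz vy a c b x≢z (λ vw → swp (all vw))
    go (inj₂ a) (inj₁ b) (inj₁ c) = mk y z x vy vz vx b c a y≢z (λ vw → rot (all vw))
    go (inj₁ a) (inj₁ b) (inj₁ c) = bad a b c λ ()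
    go (inj₁ a) (inj₂ b) (inj₂ c) = bad a b c λ ()
    go (inj₂ a) (inj₁ b) (inj₂ c) = bad a b c λ ()
    go (inj₂ a) (inj₂ b) (inj₁ c) = bad a b c λ ()
    go (inj₂ a) (inj₂ b) (inj₂ c) = bad a b c λ ()

  otherR : ∀ {R v r} → RingAt R v → v ~ r → R ∋ r →
           ∃ λ q → q ≢ r × v ~ q × R ∋ q × (∀ {w} → v ~ w → R ∋ w → w ≡ r ⊎ w ≡ q)
  otherR rg vr rr with RingAt.isR rg vr rr
  ... | inj₁ refl = RingAt.q rg , (λ e → RingAt.p≢q rg (sym e)) , RingAt.vq rg , RingAt.Rq rg , RingAt.isR rg
  ... | inj₂ refl = RingAt.p rg , RingAt.p≢q rg , RingAt.vp rg , RingAt.Rp rg , λ aw rw → Sum.swap (RingAt.isR rg aw rw)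

  -- Membership in a closed subset is carried from a vertex of `E` to a neighbour in `K₁`, across
  -- `K₁`, and back out.
  conn-fringe : ∀ (K₁ E : Sub) → Conn K₁ → (∀ {v} → K₁ ∋ v → E ∋ v) →
                (∀ {v} → E ∋ v → K₁ ∌ v → ∃ λ u → K₁ ∋ u × v ~ u) → Conn E
  conn-fringe K₁ E con sub fr S cl {x} {y} ex ey sx with base x ex | base y ey
    where
    base : ∀ v → E ∋ v → ∃ λ u → K₁ ∋ u × (S ∋ v → S ∋ u) × (S ∋ u → S ∋ v)
    base v ev with bool? (K₁ v)
    ... | inj₁ k = v , k , (λ s → s) , λ s → s
    ... | inj₂ k with fr ev k
    ...   | u , ku , vu = u , ku , cl ev (sub ku) vu , cl (sub ku) ev (~-sym vu)
  ... | u , ku , f , _ | w , kw , _ , g = g (con S (λ ka kb → cl (sub ka) (sub kb)) ku kw (f sx))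

  module _ {R : Sub} (T : Terminal R) where
    open Surplus (Terminal.gs T)

    inK : ∀ {v u} → R ∋ v → v ~ u → R ∌ u → K R ∋ u
    inK rv vu ru = diff-in U R (closed (sub rv) vu) ru

    -- A union of some, but not all, of the cycles forming R.
    smaller : ∀ (D : Sub) → (∀ {v} → D ∋ v → R ∋ v) → (∀ {v w} → D ∋ v → v ~ w → R ∋ w → D ∋ w) →
              ∀ {d x} → D ∋ d → R ∋ x → D ∌ x → Smaller R
    smaller D D⊆R clD {d} {x} dd rx dx = D , lt , record
      { sub = λ dv → sub (D⊆R dv)
      ; conK = conn-fringe (K R) (K D) conK (λ {v} → kk v) fringe
      ; kne = proj₁ kne , kk _ (proj₂ kne)
      ; ne = d , dd
      ; le = ≤-trans (≤-reflexive (sym (sum-+ (λ v → ind (D v)) (λ v → ind (D v))))) (sum-mono pt) }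
      where
      lt : size D < size R
      lt = ≤-trans (s≤s (size-mono {D} {del R x} (λ v dv → del-in R x (λ { refl → t≢f dv dx }) (D⊆R dv)))) (size-lt R rx)
      kk : ∀ v → K R ∋ v → K D ∋ v
      kk v kv = diff-in U D (proj₁ (diff-inv U R kv)) (¬∋⇒∌ D (λ dv → t≢f (D⊆R dv) (proj₂ (diff-inv U R kv))))
      -- The discarded cycles pass to the connected part; each of their vertices has its third
      -- neighbour in `K R`.
      fringe : ∀ {v} → K D ∋ v → K R ∌ v → ∃ λ u → K R ∋ u × v ~ u
      fringe {v} kv nk = RingAt.o ra , inK rv (RingAt.vo ra) (RingAt.Ro ra) , RingAt.vo ra
        where
        rv = diff-∌ U R (proj₁ (diff-inv U D kv)) nk
        ra = ringAt T rv
      pt : ∀ v → ind (D v) + ind (D v) ≤ (if D v then deg D v else 0)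
      pt v with D v in dv
      ... | false = z≤n
      ... | true = ≤-reflexive (sym (trans (sum-cong same) (Terminal.two T (D⊆R dv))))
        where
        same : ∀ u → ind (D u ∧ Subcubic.adj H v u) ≡ ind (R u ∧ Subcubic.adj H v u)
        same u with bool? (adj v u)
        ... | inj₁ e rewrite e = cong (λ b → ind (b ∧ true)) (bool-ext D⊆R (clD dv e))
        ... | inj₂ e rewrite e = cong ind (trans (Bool.∧-zeroʳ (D u)) (sym (Bool.∧-zeroʳ (R u))))

    -- `z` is the exceptional vertex. In `sgl` it is exempt, because the edge from `u₀` to `z` is
    -- the parent edge of `K R` and not an open end.
    module Close {z u₀ a b : V} (rz : R ∋ z) (ku₀ : K R ∋ u₀) (zu₀ : z ~ u₀) (ra : R ∋ a) (rb : R ∋ b)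
                 (za : z ~ a) (zb : z ~ b) (a≢b : a ≢ b) {σ τ : V} (aσ : a ~ σ) (bτ : b ~ τ) (Rσ : R ∌ σ) (Rτ : R ∌ τ)
                 (σ≢τ : σ ≢ τ)
                 (sgl : ∀ {u w w'} → K R ∋ u → R ∋ w → R ∋ w' → w ≢ z → w' ≢ z → u ~ w → u ~ w' → w ≡ w')
                 {M : V → Bool} (aa : AA (K R) u₀ z M) (Mσ : M σ ≡ false) (Mτ : M τ ≡ true) where
      R∌K : ∀ {v} → K R ∋ v → R ∌ v
      R∌K kv = proj₂ (diff-inv U R kv)

      -- `D` is the path walked from `a` to `r`, and `q` comes next on the cycle. `A t` is sent to
      -- `q`; `A s` does not leave `r` and is reserved for the arc from `q` back to `r`.
      record State (D : Sub) (r q : V) (t s : Tri) : Set where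
        field
          c    : Colouring
          D⊆R  : ∀ {v} → D ∋ v → R ∋ v
          Dz   : D ∌ z
          Dr   : D ∋ r
          Da   : D ∋ a
          Rq   : R ∋ q
          Dq   : D ∌ q
          rq~  : r ~ q
          dist : ∀ {v w w'} → D ∋ v → v ~ w → v ~ w' → c v w ≡ c v w' → w ≡ w'
          inn  : ∀ {v w u} → D ∋ v → D ∋ w → v ~ w → w ~ u → c v w ≢ c w u
          out  : ∀ {v u} → D ∋ v → v ~ u → R ∌ u → c v u ≡ B (not (M u))
          inA  : ∀ {v w} → D ∋ v → v ~ w → R ∋ w → isA (c v w)
          toz  : c a z ≡ A t₀
          rq   : c r q ≡ A t
          rs   : ∀ {w} → r ~ w → c r w ≢ A s
          clD  : ∀ {v w} → D ∋ v → v ~ w → R ∋ w → D ∋ w ⊎ w ≡ z ⊎ (v ≡ r × w ≡ q)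
          -- As `z` has only two neighbours on the cycle, this makes the walk return to `z` through
          -- `b`.
          end  : q ≡ z → r ≢ a

      start : ∃ λ q → State (only a) a q t₁ t₂
      start with ringAt T ra
      ... | rg = q' , record
        { c = c ; D⊆R = λ dv → subst (R ∋_) (sym (only-inv a dv)) ra
        ; Dz = ¬∋⇒∌ (only a) {z} (λ d → z≢a (only-inv a d)) ; Dr = only-self a ; Da = only-self a ; Rq = Rq'
        ; Dq = ¬∋⇒∌ (only a) {q'} (λ d → ~⇒≢ aq' (sym (only-inv a d))) ; rq~ = aq'
        ; dist = λ dv → distA (only-inv a dv)
        ; inn = λ dv dw vw _ → ⊥-elim (~⇒≢ vw (trans (only-inv a dv) (sym (only-inv a dw))))
        ; out = λ dv → outA (only-inv a dv)
        ; inA = λ dv → inA' (only-inv a dv)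
        ; toz = cz
        ; rq = cq ; rs = λ {w} _ → rootOut-any z q' (A t₀) (A t₁) (B (not (M σ))) {_≢ A t₂} (λ ()) (λ ()) (λ ()) w
        ; clD = λ dv vw rw → cl (only-inv a dv) vw rw ; end = λ e → ⊥-elim (q'≢z e) }
        where
        open RingAt rg
        z≢a : z ≢ a
        z≢a = ~⇒≢ za
        sel : ∃ λ q' → q' ≢ z × a ~ q' × R ∋ q' × (∀ {w} → a ~ w → R ∋ w → w ≡ z ⊎ w ≡ q')
        sel = otherR rg (~-sym za) rz
        q' = proj₁ sel
        q'≢z = proj₁ (proj₂ sel)
        aq' = proj₁ (proj₂ (proj₂ sel))
        Rq' = proj₁ (proj₂ (proj₂ (proj₂ sel)))
        is = proj₂ (proj₂ (proj₂ (proj₂ sel)))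
        ca : V → Col
        ca = rootOut z q' (A t₀) (A t₁) (B (not (M σ)))
        c : Colouring
        c _ = ca
        cz : ca z ≡ A t₀
        cz = rootOut-p z q' _ _ _
        cq : ca q' ≡ A t₁
        cq = rootOut-k z q' _ _ _ q'≢z
        isσ : ∀ {w} → a ~ w → w ≢ z → w ≢ q' → w ≡ σ
        isσ {w} aw n₁ n₂ with bool? (R w)
        ... | inj₂ rw = trans (isK aw rw) (sym (isK aσ Rσ))
        ... | inj₁ rw with is aw rw
        ...   | inj₁ e = ⊥-elim (n₁ e)
        ...   | inj₂ e = ⊥-elim (n₂ e)
        distA : ∀ {v w w'} → v ≡ a → v ~ w → v ~ w' → ca w ≡ ca w' → w ≡ w'
        distA refl = rootOut-dist {P = a ~_} z q' {A t₀} {A t₁} {B (not (M σ))} (λ ()) (λ ()) (λ ())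
          (λ aw aw' n₁ n₂ n₃ n₄ → trans (isσ aw n₁ n₃) (sym (isσ aw' n₂ n₄)))
        outA : ∀ {v u} → v ≡ a → v ~ u → R ∌ u → ca u ≡ B (not (M u))
        outA refl vu ru with trans (isK vu ru) (sym (isK aσ Rσ))
        ... | refl = rootOut-y z q' (A t₀) (A t₁) (B (not (M σ))) {σ} (λ e → t≢f rz (subst (R ∌_) e ru)) (λ e → t≢f Rq' (subst (R ∌_) e ru))
        inA' : ∀ {v w} → v ≡ a → v ~ w → R ∋ w → isA (ca w)
        inA' refl vw rw with is vw rw
        ... | inj₁ refl = subst isA (sym cz) isa
        ... | inj₂ refl = subst isA (sym cq) isa
        cl : ∀ {v w} → v ≡ a → v ~ w → R ∋ w → only a ∋ w ⊎ w ≡ z ⊎ (v ≡ a × w ≡ q')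
        cl refl vw rw with is vw rw
        ... | inj₁ e = inj₂ (inj₁ e)
        ... | inj₂ e = inj₂ (inj₂ (refl , e))

      -- `q` sends the reserved `A s` back and the third A colour forward. The only A colour not
      -- leaving `q` is then `A t`, which enters from `r` and becomes the reserved colour for the
      -- next arc back.
      advance : ∀ {D r q t s} → q ≢ z → t ≢ s → State D r q t s →
                ∃ λ q' → ∃ λ t' → t' ≢ t × State (add D q) q q' t' t
      advance {D} {r} {q} {t} {s} q≢z t≢s st = q' , t' , proj₁ (proj₂ fresh) , record
        { c = c' ; D⊆R = λ dv → sub' (add-inv D q dv)
        ; Dz = add-∌ D q (λ e → q≢z (sym e)) Dz ; Dr = add-new D q ; Da = add-old D q Da ; Rq = Rq'
        ; Dq = add-∌ D q (λ e → ~⇒≢ qq' (sym e)) Dq' ; rq~ = qq'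
        ; dist = dist' ; inn = inn' ; out = out' ; inA = inA'
        ; toz = trans (c'o z a≢q) toz
        ; rq = trans (c'q q') cq'
        ; rs = λ {w} _ e → rootOut-any r q' (A s) (A t') (B (not (M o))) {_≢ A t} (λ e → t≢s (sym (A-inj e)))
                             (λ e → proj₁ (proj₂ fresh) (A-inj e)) (λ ()) w (trans (sym (c'q w)) e)
        ; clD = cl' ; end = λ _ e → a≢q (sym e) }
        where
        open State st
        rg : RingAt R q
        rg = ringAt T Rq
        module rg = RingAt rg
        o : V
        o = rg.o
        a≢q : a ≢ q
        a≢q e = t≢f Da (subst (D ∌_) (sym e) Dq)
        sel : ∃ λ q' → q' ≢ r × q ~ q' × R ∋ q' × (∀ {w} → q ~ w → R ∋ w → w ≡ r ⊎ w ≡ q')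
        sel = otherR rg (~-sym rq~) (D⊆R Dr)
        q' = proj₁ sel
        q'≢r = proj₁ (proj₂ sel)
        qq' = proj₁ (proj₂ (proj₂ sel))
        Rq' = proj₁ (proj₂ (proj₂ (proj₂ sel)))
        is = proj₂ (proj₂ (proj₂ (proj₂ sel)))
        only-r : ∀ {v} → D ∋ v → v ~ q → v ≡ r
        only-r dv vq with clD dv vq Rq
        ... | inj₁ dq = ⊥-elim (t≢f dq Dq)
        ... | inj₂ (inj₁ e) = ⊥-elim (q≢z e)
        ... | inj₂ (inj₂ (e , _)) = e
        Dq' : D ∌ q'
        Dq' = ¬∋⇒∌ D (λ d → q'≢r (only-r d (~-sym qq')))
        fresh = third t s
        t' = proj₁ fresh
        Mo : Col
        Mo = B (not (M o))
        cq : V → Col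
        cq = rootOut r q' (A s) (A t') Mo
        cr : cq r ≡ A s
        cr = rootOut-p r q' (A s) (A t') Mo
        cq' : cq q' ≡ A t'
        cq' = rootOut-k r q' (A s) (A t') Mo q'≢r
        c' : Colouring
        c' v w = if does (v ≟ q) then cq w else c v w
        c'q : ∀ w → c' q w ≡ cq w
        c'q w with q ≟ q
        ... | yes _ = refl
        ... | no x = ⊥-elim (x refl)
        c'o : ∀ {v} w → v ≢ q → c' v w ≡ c v w
        c'o {v} w x with v ≟ q
        ... | yes e = ⊥-elim (x e)
        ... | no _ = refl
        sub' : ∀ {v} → v ≡ q ⊎ D ∋ v → R ∋ v
        sub' (inj₁ refl) = Rq
        sub' (inj₂ d) = D⊆R d
        isO : ∀ {w} → q ~ w → w ≢ r → w ≢ q' → w ≡ o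
        isO {w} qw n₁ n₂ with bool? (R w)
        ... | inj₂ rw = rg.isK qw rw
        ... | inj₁ rw with is qw rw
        ...   | inj₁ e = ⊥-elim (n₁ e)
        ...   | inj₂ e = ⊥-elim (n₂ e)
        dist' : ∀ {v w w'} → add D q ∋ v → v ~ w → v ~ w' → c' v w ≡ c' v w' → w ≡ w'
        dist' {v} dv vw vw' e with v ≟ q
        ... | yes refl = rootOut-dist {P = q ~_} r q' {A s} {A t'} {Mo} (λ e → proj₂ (proj₂ fresh) (sym (A-inj e))) (λ ()) (λ ())
                (λ qw qw' n₁ n₂ n₃ n₄ → trans (isO qw n₁ n₃) (sym (isO qw' n₂ n₄))) vw vw' e
        ... | no n = dist dv vw vw' e
        inn' : ∀ {v w u} → add D q ∋ v → add D q ∋ w → v ~ w → w ~ u → c' v w ≢ c' w u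
        inn' {v} {w} {u} dv dw vw wu e with v ≟ q | w ≟ q
        ... | yes refl | yes refl = ~⇒≢ vw refl
        ... | yes refl | no n with only-r dw (~-sym vw)
        ...   | refl = rs wu (sym (trans (sym cr) e))
        inn' {v} {w} {u} dv dw vw wu e | no n | yes refl with only-r dv vw
        ... | refl = rootOut-any r q' (A s) (A t') Mo {λ x → A t ≢ x} (λ e → t≢s (A-inj e))
                       (λ e → proj₁ (proj₂ fresh) (sym (A-inj e))) (λ ()) u
                       (trans (sym rq) e)
        inn' {v} {w} {u} dv dw vw wu e | no n | no n' = inn dv dw vw wu e
        out' : ∀ {v u} → add D q ∋ v → v ~ u → R ∌ u → c' v u ≡ B (not (M u))
        out' {v} {u} dv vu ru with v ≟ q
        ... | no n = out dv vu ru
        ... | yes refl with rg.isK vu ru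
        ...   | refl = rootOut-y r q' (A s) (A t') Mo {o} (λ e → t≢f (D⊆R Dr) (subst (R ∌_) e ru)) (λ e → t≢f Rq' (subst (R ∌_) e ru))
        inA' : ∀ {v w} → add D q ∋ v → v ~ w → R ∋ w → isA (c' v w)
        inA' {v} {w} dv vw rw with v ≟ q
        ... | no n = inA dv vw rw
        ... | yes refl with is vw rw
        ...   | inj₁ refl = subst isA (sym cr) isa
        ...   | inj₂ refl = subst isA (sym cq') isa
        cl' : ∀ {v w} → add D q ∋ v → v ~ w → R ∋ w → add D q ∋ w ⊎ w ≡ z ⊎ (v ≡ q × w ≡ q')
        cl' {v} {w} dv vw rw with add-inv D q dv
        ... | inj₁ refl with is vw rw
        ...   | inj₁ refl = inj₁ (add-old D q Dr)
        ...   | inj₂ e = inj₂ (inj₂ (refl , e))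
        cl' {v} {w} dv vw rw | inj₂ dv' with clD dv' vw rw
        ... | inj₁ dw = inj₁ (add-old D q dw)
        ... | inj₂ (inj₁ e) = inj₂ (inj₁ e)
        ... | inj₂ (inj₂ (_ , refl)) = inj₁ (add-new D q)

      walk : ∀ k {D r q t s} → size (diff R D) ≤ k → t ≢ s → State D r q t s →
             ∃ λ D → ∃ λ r → ∃ λ t → ∃ λ s → State D r z t s
      walk k {D} {r} {q} {t} {s} le ts st with q ≟ z
      ... | yes refl = D , r , t , s , st
      ... | no q≢z with k | ≤-trans (≤-reflexive (sym (size-del (diff R D) q (diff-in R D (State.Rq st) (State.Dq st))))) le
      ...   | suc k' | s≤s le' with advance q≢z ts st
      ...     | q' , t' , t't , st' = walk k' (≤-trans (size-mono {diff R (add D q)} {del (diff R D) q} less) le') t't st'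
        where
        less : ∀ v → diff R (add D q) ∋ v → del (diff R D) q ∋ v
        less v p with diff-inv R (add D q) p
        ... | rv , nv = del-in (diff R D) q (proj₁ (add-∌-inv D q nv)) (diff-in R D rv (proj₂ (add-∌-inv D q nv)))

      isab : ∀ {w} → z ~ w → R ∋ w → w ≡ a ⊎ w ≡ b
      isab zw rw with otherR (ringAt T rz) za ra
      ... | q , _ , _ , _ , is with is zb rb
      ...   | inj₁ e = ⊥-elim (a≢b (sym e))
      ...   | inj₂ refl = is zw rw

      isu₀ : ∀ {w} → z ~ w → R ∌ w → w ≡ u₀
      isu₀ zw rw = trans (RingAt.isK (ringAt T rz) zw rw) (sym (RingAt.isK (ringAt T rz) zu₀ (R∌K ku₀)))

      -- By the prescribed values of `M`, `B true` goes from `a` to `σ` and `B false` from `b` to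
      -- `τ`. So `z` may send `B false` to `a` and `B true` to `b`, whatever the length of the
      -- cycle.
      module Final {D : Sub} {r : V} {t s : Tri} (st : State D r z t s) (cover : ∀ {v} → R ∋ v → v ≢ z → D ∋ v) where
        open State st renaming (c to cD; dist to distD; inn to innD)
        r≡b : r ≡ b
        r≡b with isab (~-sym rq~) (D⊆R Dr)
        ... | inj₁ e = ⊥-elim (end refl e)
        ... | inj₂ e = e
        bz : cD b z ≡ A t
        bz = subst (λ v → cD v z ≡ A t) r≡b rq
        Db : D ∋ b
        Db = subst (D ∋_) r≡b Dr
        xx = third t t₀
        x : Tri
        x = proj₁ xx
        yy = third x x
        y : Tri
        y = proj₁ yy
        -- x is the colour from z to u₀; it must differ from the colours t₀ and t which z receives.
        o : Off (K R) u₀ z M (A y) (A x)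
        o = recolAA aa (λ ()) (proj₁ (proj₂ yy))
        module o = Off o
        cz : V → Col
        cz = rootOut u₀ a (A x) (B false) (B true)
        R≢u₀ : ∀ {v} → R ∋ v → v ≢ u₀
        R≢u₀ rv e = t≢f rv (subst (R ∌_) (sym e) (R∌K ku₀))
        cza : cz a ≡ B false
        cza = rootOut-k u₀ a (A x) (B false) (B true) (R≢u₀ ra)
        czb : cz b ≡ B true
        czb = rootOut-y u₀ a (A x) (B false) (B true) (R≢u₀ rb) (λ e → a≢b (sym e))
        czu : cz u₀ ≡ A x
        czu = rootOut-p u₀ a (A x) (B false) (B true)
        cz-any : ∀ {P : Col → Set} → P (A x) → P (B false) → P (B true) → ∀ w → P (cz w)
        cz-any {P} = rootOut-any u₀ a (A x) (B false) (B true) {P}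
        isb : ∀ {w} → z ~ w → w ≢ u₀ → w ≢ a → w ≡ b
        isb {w} zw n₁ n₂ with bool? (R w)
        ... | inj₂ rw = ⊥-elim (n₁ (isu₀ zw rw))
        ... | inj₁ rw with isab zw rw
        ...   | inj₁ e = ⊥-elim (n₂ e)
        ...   | inj₂ e = e
        distz : ∀ {w w'} → z ~ w → z ~ w' → cz w ≡ cz w' → w ≡ w'
        distz = rootOut-dist {P = z ~_} u₀ a {A x} {B false} {B true} (λ ()) (λ ()) (λ ())
          (λ zw zw' n₁ n₂ n₃ n₄ → trans (isb zw n₁ n₃) (sym (isb zw' n₂ n₄)))

        KRs : ∀ {u v} → K R ∋ u → R ∋ v → u ~ v → v ≢ z → o.c u v ≡ B (M u) × (∀ {w} → K R ∋ w → u ~ w → isA (o.c u w))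
        KRs {u} {v} ku rv uv vz = o.sing ku (uv , K∌ rv , λ e → vz (proj₂ e)) uniq
          where
          K∌ : ∀ {v} → R ∋ v → K R ∌ v
          K∌ rv = ¬∋⇒∌ (K R) (λ kv → t≢f rv (R∌K kv))
          uniq : ∀ {w} → Out (K R) u₀ z u w → w ≡ v
          uniq {w} (uw , nw , ne) = sgl ku Rw rv wz vz uw uv
            where
            Rw : R ∋ w
            Rw = diff-∌ U R (closed (proj₁ (diff-inv U R ku)) uw) nw
            wz : w ≢ z
            wz refl = ne (isu₀ (~-sym uw) (R∌K ku) , refl)

        c : Colouring
        c v w = if R v then (if does (v ≟ z) then cz w else cD v w) else o.c v w

        dist : ∀ {v w w'} → U ∋ v → v ~ w → v ~ w' → c v w ≡ c v w' → w ≡ w'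
        dist {v} uv vw vw' e with R v in rv
        ... | false = o.dist (diff-in U R uv rv) vw vw' e
        ... | true with v ≟ z
        ...   | yes refl = distz vw vw' e
        ...   | no q = distD (cover rv q) vw vw' e

        K→z : ∀ {u w} → u ≡ u₀ → z ~ w → o.c u z ≢ cz w
        K→z {w = w} refl zw e = cz-any {λ x → A y ≢ x} (λ e' → proj₁ (proj₂ yy) (A-inj e')) (λ ()) (λ ()) w
                                  (trans (sym o.rp) e)

        z→K : ∀ {u w} → u ≡ u₀ → u ~ w → cz u ≢ o.c u w
        z→K refl uw e = o.fr uw (trans (sym e) czu)

        -- `v` sends A colours along the cycle and `B (not (M u))` to `u`, so `B (M u)` may enter
        -- it.
        K→D : ∀ {u v w} → K R ∋ u → R ∋ v → v ≢ z → u ~ v → v ~ w → o.c u v ≢ cD v w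
        K→D {u} {v} {w} ku rv vz uv vw e with bool? (R w)
        ... | inj₁ rw = A≢B (inA (cover rv vz) vw rw) (trans (sym e) (proj₁ (KRs ku rv uv vz)))
        ... | inj₂ rw with trans (RingAt.isK (ringAt T rv) vw rw) (sym (RingAt.isK (ringAt T rv) (~-sym uv) (R∌K ku)))
        ...   | refl = not-≢ (M u) (B-inj (trans (sym (proj₁ (KRs ku rv uv vz))) (trans e (out (cover rv vz) vw rw))))

        -- `u` sends A colours inside `K R`, `B (M u)` to its open end, and `A y` if the arc goes to
        -- `z`; so `B (not (M u))` may enter it.
        D→K : ∀ {u v w} → K R ∋ u → R ∋ v → v ≢ z → v ~ u → u ~ w → cD v u ≢ o.c u w
        D→K {u} {v} {w} ku rv vz vu uw e with bool? (R w)
        ... | inj₂ rw = A≢B (proj₂ (KRs ku rv (~-sym vu) vz) (diff-in U R (closed (proj₁ (diff-inv U R ku)) uw) rw) uw)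
                          (trans (sym e) (out (cover rv vz) vu (R∌K ku)))
        ... | inj₁ rw with w ≟ z
        ...   | no wz = not-≢ (M u) (B-inj (trans (sym (proj₁ (KRs ku rw uw wz))) (trans (sym e) (out (cover rv vz) vu (R∌K ku)))))
        ...   | yes refl with isu₀ (~-sym uw) (R∌K ku)
        ...     | refl = A≢B' (trans (sym (out (cover rv vz) vu (R∌K ku))) (trans e o.rp))
          where
          A≢B' : ∀ {m t} → B m ≢ A t
          A≢B' ()

        D→z : ∀ {v w} → v ≡ a ⊎ v ≡ b → z ~ w → cD v z ≢ cz w
        D→z {w = w} (inj₁ refl) zw e = cz-any {λ x → A t₀ ≢ x} (λ e' → proj₂ (proj₂ xx) (sym (A-inj e'))) (λ ()) (λ ()) w
                                (trans (sym toz) e)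
        D→z {w = w} (inj₂ refl) zw e = cz-any {λ x → A t ≢ x} (λ e' → proj₁ (proj₂ xx) (sym (A-inj e'))) (λ ()) (λ ()) w
                                (trans (sym bz) e)

        z→D : ∀ {v w} → v ≡ a ⊎ v ≡ b → v ~ w → cz v ≢ cD v w
        z→D {w = w} (inj₁ refl) vw e with bool? (R w)
        ... | inj₁ rw = A≢B (inA Da vw rw) (trans (sym e) cza)
        ... | inj₂ rw with trans (RingAt.isK (ringAt T ra) vw rw) (sym (RingAt.isK (ringAt T ra) aσ Rσ))
        ...   | refl = not-≢ false (B-inj (trans (sym cza) (trans e (trans (out Da vw rw) (cong (λ m → B (not m)) Mσ)))))
        z→D {w = w} (inj₂ refl) vw e with bool? (R w)
        ... | inj₁ rw = A≢B (inA Db vw rw) (trans (sym e) czb)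
        ... | inj₂ rw with trans (RingAt.isK (ringAt T rb) vw rw) (sym (RingAt.isK (ringAt T rb) bτ Rτ))
        ...   | refl = not-≢ true (B-inj (trans (sym czb) (trans e (trans (out Db vw rw) (cong (λ m → B (not m)) Mτ)))))

        inn : ∀ {v w u} → U ∋ v → U ∋ w → v ~ w → w ~ u → c v w ≢ c w u
        inn {v} {w} {u} uv uw vw wu e with R v in rv | R w in rw
        ... | false | false = o.inn (diff-in U R uv rv) (diff-in U R uw rw) vw wu e
        ... | false | true with w ≟ z
        ...   | yes refl = K→z (isu₀ (~-sym vw) rv) wu e
        ...   | no q = K→D (diff-in U R uv rv) rw q vw wu e
        inn {v} {w} {u} uv uw vw wu e | true | false with v ≟ z
        ...   | yes refl = z→K (isu₀ vw rw) wu e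
        ...   | no q = D→K (diff-in U R uw rw) rv q vw wu e
        inn {v} {w} {u} uv uw vw wu e | true | true with v ≟ z | w ≟ z
        ...   | yes refl | yes refl = ~⇒≢ vw refl
        ...   | yes refl | no q = z→D (isab vw rw) wu e
        ...   | no q | yes refl = D→z (isab (~-sym vw) rv) wu e
        ...   | no q | no q' = innD (cover rv q) (cover rw q') vw wu e

      -- If the walk returns to `z` without having met all of `R`, the cycle through `z` alone is a
      -- smaller set with surplus.
      close : Cert U ⊎ Smaller R
      close with start
      ... | q , st₀ with walk (size (diff R (only a))) ≤-refl (λ ()) st₀
      ...   | D , r , t , s , st with any? (λ x → (R ∋? x) ×-dec (add D z ∌? x))
      ...     | yes (x , rx , dx) = inj₂ (smaller (add D z) sub' clo (add-new D z) rx dx)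
        where
        open State st using (D⊆R; clD; Da; Dr; end; rq~)
        r≡b : r ≡ b
        r≡b with isab (~-sym rq~) (D⊆R Dr)
        ... | inj₁ e = ⊥-elim (end refl e)
        ... | inj₂ e = e
        sub' : ∀ {v} → add D z ∋ v → R ∋ v
        sub' dv with add-inv D z dv
        ... | inj₁ refl = rz
        ... | inj₂ d = D⊆R d
        clo : ∀ {v w} → add D z ∋ v → v ~ w → R ∋ w → add D z ∋ w
        clo dv vw rw with add-inv D z dv
        clo dv vw rw | inj₁ refl with isab vw rw
        ... | inj₁ refl = add-old D z Da
        ... | inj₂ refl = add-old D z (subst (D ∋_) r≡b Dr)
        clo dv vw rw | inj₂ d with clD d vw rw
        ... | inj₁ dw = add-old D z dw
        ... | inj₂ (inj₁ refl) = add-new D z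
        ... | inj₂ (inj₂ (_ , refl)) = add-new D z
      ...     | no none = inj₁ (record { c = F.c ; dist = F.dist ; inn = F.inn })
        where
        cover : ∀ {v} → R ∋ v → v ≢ z → D ∋ v
        cover {v} rv vz with bool? (D v)
        ... | inj₁ d = d
        ... | inj₂ d = ⊥-elim (none (v , rv , add-∌ D z vz d))
        module F = Final st cover

not-unique : ∀ {x y z : Bool} → x ≢ y → x ≢ z → y ≡ z
not-unique {true} {true} p q = ⊥-elim (p refl)
not-unique {true} {false} {true} p q = ⊥-elim (q refl)
not-unique {true} {false} {false} p q = refl
not-unique {false} {false} p q = ⊥-elim (p refl)
not-unique {false} {true} {false} p q = ⊥-elim (q refl)
not-unique {false} {true} {true} p q = refl

-- Choosing where the cycle is closed

module Selecting {n : ℕ} (H : Subcubic n) (U : Fin n → Bool)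
               (closed : ∀ {v w} → U v ≡ true → Subcubic.adj H v w ≡ true → U w ≡ true)
               (conU : SubcubicGraph.Conn H U)
               (cubic : ∀ {v} → U v ≡ true → Counting.Three~ H v) where
  open Closing H U closed conU cubic public

  module Free = Recursion H (λ _ _ → ⊤) (λ _ → true , tt) (λ _ _ _ → true , tt , tt)

  module _ {v x y t : V} (vx : v ~ x) (vy : v ~ y) (vt : v ~ t) (x≢y : x ≢ y) (tx : t ≢ x) (ty : t ≢ y) where
    is₃ : ∀ {w} → v ~ w → w ≡ x ⊎ w ≡ y ⊎ w ≡ t
    is₃ {w} vw with w ≟ x | w ≟ y | w ≟ t
    ... | yes e | _ | _ = inj₁ e
    ... | no _ | yes e | _ = inj₂ (inj₁ e)
    ... | no _ | no _ | yes e = inj₂ (inj₂ e)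
    ... | no p | no q | no r = ⊥-elim (deg≤3 v vw vx vy vt p q r x≢y (λ e → tx (sym e)) (λ e → ty (sym e)))

  thirdNbr : ∀ {v x y} → U ∋ v → v ~ x → v ~ y → x ≢ y → ∃ λ t → v ~ t × t ≢ x × t ≢ y
  thirdNbr {v} uv vx vy x≢y = go (t.all vx) (t.all vy)
    where
    t = cubic uv
    module t = Three~ t
    go : ∀ {x y} → x ≡ t.x ⊎ x ≡ t.y ⊎ x ≡ t.z → y ≡ t.x ⊎ y ≡ t.y ⊎ y ≡ t.z → ∃ λ w → v ~ w × w ≢ x × w ≢ y
    go (inj₁ refl) (inj₂ (inj₁ refl)) = t.z , t.vz , (λ e → t.x≢z (sym e)) , λ e → t.y≢z (sym e)
    go (inj₁ refl) (inj₂ (inj₂ refl)) = t.y , t.vy , (λ e → t.x≢y (sym e)) , t.y≢z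
    go (inj₁ refl) (inj₁ refl) = t.y , t.vy , (λ e → t.x≢y (sym e)) , λ e → t.x≢y (sym e)
    go (inj₂ (inj₁ refl)) (inj₁ refl) = t.z , t.vz , (λ e → t.y≢z (sym e)) , λ e → t.x≢z (sym e)
    go (inj₂ (inj₁ refl)) (inj₂ (inj₂ refl)) = t.x , t.vx , t.x≢y , t.x≢z
    go (inj₂ (inj₁ refl)) (inj₂ (inj₁ refl)) = t.x , t.vx , t.x≢y , t.x≢y
    go (inj₂ (inj₂ refl)) (inj₁ refl) = t.y , t.vy , t.y≢z , λ e → t.x≢y (sym e)
    go (inj₂ (inj₂ refl)) (inj₂ (inj₁ refl)) = t.x , t.vx , t.x≢z , t.x≢y
    go (inj₂ (inj₂ refl)) (inj₂ (inj₂ refl)) = t.x , t.vx , t.x≢z , t.x≢z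

  secondNbr : ∀ {v x} → U ∋ v → v ~ x → ∃ λ t → v ~ t × t ≢ x
  secondNbr {v} {x} uv vx with Three~.x (cubic uv) ≟ x
  ... | yes refl = Three~.y (cubic uv) , Three~.vy (cubic uv) , λ e → Three~.x≢y (cubic uv) (sym e)
  ... | no q = Three~.x (cubic uv) , Three~.vx (cubic uv) , q

  -- Each arc takes the label of its head. Heads of arcs with a common tail, and of consecutive
  -- arcs, are distinct, so it suffices that labels are not repeated in the component.
  labelCert : (γ : V → Col) → (∀ {v w} → U ∋ v → U ∋ w → γ v ≡ γ w → v ≡ w) → Cert U
  labelCert γ inj = record
    { c = λ _ w → γ w
    ; dist = λ uv vw vw' e → inj (closed uv vw) (closed uv vw') e
    ; inn = λ uv uw vw wu e → ~⇒≢ wu (inj uw (closed uw wu) e) }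

  -- Arcs between vertices of equal index form a matching and carry the B colour of the side of the
  -- tail. Hence `v` sends `B (side v)` and A colours other than `A (i v)`, while it is entered by
  -- the other B colour and by `A (i v)`.
  bipartiteCert : (side : V → Bool) (i : V → Tri) → (∀ {v w} → U ∋ v → v ~ w → side v ≢ side w) →
                  (∀ {v w} → U ∋ v → U ∋ w → side v ≡ side w → i v ≡ i w → v ≡ w) → Cert U
  bipartiteCert side i sd inj = record { c = c ; dist = dist ; inn = inn }
    where
    c : Colouring
    c v w = if does (i v ≟ᵗ i w) then B (side v) else A (i w)
    dist : ∀ {v w w'} → U ∋ v → v ~ w → v ~ w' → c v w ≡ c v w' → w ≡ w'
    dist {v} {w} {w'} uv vw vw' e with i v ≟ᵗ i w | i v ≟ᵗ i w'
    ... | yes p | yes q = inj (closed uv vw) (closed uv vw') (not-unique (sd uv vw) (sd uv vw')) (trans (sym p) q)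
    ... | no p | no q = inj (closed uv vw) (closed uv vw') (not-unique (sd uv vw) (sd uv vw')) (A-inj e)
    dist uv vw vw' () | yes p | no q
    dist uv vw vw' () | no p | yes q
    inn : ∀ {v w u} → U ∋ v → U ∋ w → v ~ w → w ~ u → c v w ≢ c w u
    inn {v} {w} {u} uv uw vw wu e with i v ≟ᵗ i w | i w ≟ᵗ i u
    ... | yes p | yes q = sd uv vw (B-inj e)
    ... | no p | no q = q (A-inj e)
    inn uv uw vw wu () | yes p | no q
    inn uv uw vw wu () | no p | yes q

  module _ {R : Sub} (T : Terminal R) where
    open Surplus (Terminal.gs T)

    outK : ∀ {v} → K R ∋ v → R ∌ v
    outK kv = proj₂ (diff-inv U R kv)
    KU : ∀ {v} → K R ∋ v → U ∋ v
    KU kv = proj₁ (diff-inv U R kv)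

    -- `K R` is rooted at `u₀` with parent `z`. The last hypothesis gives A colours on both arcs of
    -- the edge to `z`, and `σ ≢ τ` allows opposite values of `M` there.
    closeOr : ∀ {z u₀ a b} → R ∋ z → K R ∋ u₀ → z ~ u₀ → R ∋ a → R ∋ b → z ~ a → z ~ b → a ≢ b →
      ∀ {σ τ} → a ~ σ → b ~ τ → R ∌ σ → R ∌ τ → σ ≢ τ →
      (∀ {u w w'} → K R ∋ u → R ∋ w → R ∋ w' → w ≢ z → w' ≢ z → u ~ w → u ~ w' → w ≡ w') →
      Conn (del (K R) u₀) → Cert U ⊎ Smaller R
    closeOr {z} {u₀} rz ku₀ zu₀ ra rb za zb a≢b {σ} {τ} aσ bτ Rσ Rτ σ≢τ sgl cK =
      Close.close T rz ku₀ zu₀ ra rb za zb a≢b aσ bτ Rσ Rτ σ≢τ sgl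
        (Rec.Solution.aa sol cK) (proj₁ (ok (inK T ra aσ Rσ)) refl) (proj₂ (ok (inK T rb bτ Rτ)) refl)
      where
      open Separate σ τ σ≢τ
      module Rec = Recursion H Ok pref tie
      sol : Rec.Solution (K R) u₀ z (proj₁ (pref u₀))
      sol = Rec.solve (size (K R)) (K R) ≤-refl conK ku₀ (twoBut (~-sym zu₀)) (λ kz _ → t≢f rz (outK kz)) _
      ok : ∀ {v} → K R ∋ v → Ok v (Rec.Solution.M sol v)
      ok {v} kv with v ≟ u₀
      ... | yes refl = subst (Ok v) (sym (Rec.Solution.Mr sol)) (proj₂ (pref v))
      ... | no q = Rec.Solution.ok sol kv q

    -- Both sides of the bridge are coloured independently, rooted at its ends; the colours in X are then
    -- permuted so that the two arcs on the bridge fit together.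
    module Bridge {X : Sub} {u s : V} (uU : U ∋ u) (X⊆U : ∀ {v} → X ∋ v → U ∋ v) (Xs : X ∋ s)
                  (Xu : X ∌ u) (us : u ~ s) (conX : Conn X)
                  (edge : ∀ {v w} → X ∋ v → v ~ w → X ∌ w → v ≡ s × w ≡ u) where
      E : Sub
      E = diff U X
      Eu : E ∋ u
      Eu = diff-in U X uU Xu
      E∌ : ∀ {v} → X ∋ v → E ∌ v
      E∌ {v} xv = ¬∋⇒∌ E (λ ev → t≢f xv (proj₂ (diff-inv U X ev)))
      -- A subset closed in `E` extends to `U` by giving all of `X` its value at `u`; the only edge
      -- leaving `X` ends at `u`.
      conE : Conn E
      conE S cl {x} {y} ex ey sx = trans (sym (S'o (proj₂ (diff-inv U X ey))))
        (conU S' cl' (proj₁ (diff-inv U X ex)) (proj₁ (diff-inv U X ey)) (trans (S'o (proj₂ (diff-inv U X ex))) sx))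
        where
        S' : Sub
        S' v = if X v then S u else S v
        S'o : ∀ {v} → X ∌ v → S' v ≡ S v
        S'o q rewrite q = refl
        cl' : ∀ {v w} → U ∋ v → U ∋ w → v ~ w → S' ∋ v → S' ∋ w
        cl' {v} {w} uv uw vw sv with X v in xv | X w in xw
        ... | true | true = sv
        ... | true | false with edge xv vw xw
        ...   | _ , refl = sv
        cl' {v} {w} uv uw vw sv | false | true with edge xw (~-sym vw) xv
        ...   | _ , refl = sv
        cl' {v} {w} uv uw vw sv | false | false = cl (diff-in U X uv xv) (diff-in U X uw xw) vw sv
      any-cap : ∀ {D r p M} → Cap D r p M → ∃ λ a → ∃ λ b → Off D r p M a b
      any-cap (inj₁ o) = _ , _ , o
      any-cap (inj₂ f) = _ , _ , f true
      solE : Free.Solution E u s true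
      solE = Free.solve (size E) E ≤-refl conE Eu (twoBut us) (λ es _ → t≢f es (E∌ Xs)) true
      solX : Free.Solution X s u true
      solX = Free.solve (size X) X ≤-refl conX Xs (twoBut (~-sym us)) (λ xu _ → t≢f xu Xu) true
      oE = any-cap (Free.Solution.cap solE)
      oX = any-cap (Free.Solution.cap solX)
      a b a' b' : Col
      a = proj₁ oE
      b = proj₁ (proj₂ oE)
      a' = proj₁ oX
      b' = proj₁ (proj₂ oX)
      module e = Off (proj₂ (proj₂ oE))
      module x = Off (proj₂ (proj₂ oX))
      f : Col → Col
      -- The arc from `s` must carry a colour that may enter `u`, and conversely. Neither side has
      -- open ends, so the permutation need not preserve the A colours.
      f = move a' b' b a
      a≢b : a ≢ b
      a≢b q = e.fr us (trans e.rp q)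
      a'≢b' : a' ≢ b'
      a'≢b' q = x.fr (~-sym us) (trans x.rp q)
      fa : f a' ≡ b
      fa = move-a a' b' b a a'≢b' (λ q → a≢b (sym q))
      fb : f b' ≡ a
      fb = move-b a' b' b a
      f-inj : ∀ {p q} → f p ≡ f q → p ≡ q
      f-inj = move-inj a' b' b a
      c : Colouring
      c v w = if X v then f (x.c v w) else e.c v w
      bridge : Cert U
      bridge = record { c = c ; dist = dist ; inn = inn }
        where
        dist : ∀ {v w w'} → U ∋ v → v ~ w → v ~ w' → c v w ≡ c v w' → w ≡ w'
        dist {v} uv vw vw' q with X v in xv
        ... | true = x.dist xv vw vw' (f-inj q)
        ... | false = e.dist (diff-in U X uv xv) vw vw' q
        inn : ∀ {v w u} → U ∋ v → U ∋ w → v ~ w → w ~ u → c v w ≢ c w u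
        inn {v} {w} uv uw vw wu q with X v in xv | X w in xw
        ... | true | true = x.inn xv xw vw wu (f-inj q)
        ... | false | false = e.inn (diff-in U X uv xv) (diff-in U X uw xw) vw wu q
        ... | true | false with edge xv vw xw
        ...   | refl , refl = e.fr wu (trans (sym q) (trans (cong f x.rp) fa))
        inn {v} {w} uv uw vw wu q | false | true with edge xw (~-sym vw) xv
        ...   | refl , refl = x.fr wu (f-inj (trans (sym q) (trans e.rp (sym fb))))

    module Select (nodbl : ∀ {u w w'} → K R ∋ u → R ∋ w → R ∋ w' → u ~ w → u ~ w' → w ≡ w') where

      -- By `nodbl` the two cycle neighbours of `z` have different neighbours in `K R`.
      closeAt : ∀ {u z} → K R ∋ u → R ∋ z → u ~ z → Conn (del (K R) u) → Cert U ⊎ Smaller R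
      closeAt {u} {z} ku rz uz cK = closeOr rz ku (~-sym uz) rg.Rp rg.Rq rg.vp rg.vq rg.p≢q
          (RingAt.vo rp) (RingAt.vo rq) (RingAt.Ro rp) (RingAt.Ro rq) σ≢τ
          (λ ku rw rw' _ _ → nodbl ku rw rw') cK
        where
        rg = ringAt T rz
        module rg = RingAt rg
        rp = ringAt T rg.Rp
        rq = ringAt T rg.Rq
        σ≢τ : RingAt.o rp ≢ RingAt.o rq
        σ≢τ e = rg.p≢q (nodbl (inK T rg.Rp (RingAt.vo rp) (RingAt.Ro rp)) rg.Rp rg.Rq (~-sym (RingAt.vo rp))
                  (subst (_~ rg.q) (sym e) (~-sym (RingAt.vo rq))))

      conn-del-nbr : ∀ {u z s t} → K R ∋ u → R ∋ z → (∀ {w} → u ~ w → w ≡ z ⊎ w ≡ s ⊎ w ≡ t) →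
                     (X : Comp (del (K R) u) s) → Comp.C X ∋ t → Conn (del (K R) u)
      conn-del-nbr {u} {z} {s} {t} ku rz is X xt = conn-ext (λ v → bool-ext X.⊆W
          (conn-cover (K R) X.C conK ku X.clo (λ kw uw → nb kw (is uw)))) X.conn
        where
        open Free using (conn-cover)
        module X = Comp X
        nb : ∀ {w} → K R ∋ w → w ≡ z ⊎ w ≡ s ⊎ w ≡ t → X.C ∋ w
        nb kw (inj₁ refl) = ⊥-elim (t≢f rz (outK kw))
        nb kw (inj₂ (inj₁ refl)) = X.root
        nb kw (inj₂ (inj₂ refl)) = xt

      -- Descent on `X`. If `u` is a cut vertex and no vertex of `X` is next to `R`, the edge `us`
      -- is a bridge. Otherwise some `u'` in `X` is next to `R`; either `u'` is not a cut vertex, or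
      -- a component of `K R` without `u'` avoids `u`. Such a component lies in `X` without `u'`, so
      -- it is smaller.
      select : ∀ k {u z s} (ku : K R ∋ u) → R ∋ z → u ~ z → K R ∋ s → u ~ s →
               (X : Comp (del (K R) u) s) → size (Comp.C X) ≤ k → Cert U ⊎ Smaller R
      select zero {s = s} ku rz uz ks us X le with ≤-trans (≤-reflexive (sym (size-del (Comp.C X) s (Comp.root X)))) le
      ... | ()
      select (suc k) {u} {z} {s} ku rz uz ks us X le with thirdNbr (KU ku) uz us (λ { refl → t≢f rz (outK ks) })
      ... | t , ut , tz , ts = by (bool? (X.C t))
        where
        module X = Comp X
        isu : ∀ {w} → u ~ w → w ≡ z ⊎ w ≡ s ⊎ w ≡ t
        isu = is₃ uz us ut (λ { refl → t≢f rz (outK ks) }) tz ts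
        Xu : X.C ∌ u
        Xu = ¬∋⇒∌ X.C (λ xu → proj₁ (del-inv (K R) u (X.⊆W xu)) refl)
        KX : ∀ {v} → X.C ∋ v → K R ∋ v
        KX xv = proj₂ (del-inv (K R) u (X.⊆W xv))
        module Ring' {u' z'} (xu' : X.C ∋ u') (rz' : R ∋ z') (uz' : u' ~ z') where
          ku' = KX xu'
          kn : ∀ {s'} → u' ~ s' → s' ≢ z' → K R ∋ s'
          kn {s'} us' n with bool? (R s')
          ... | inj₁ r = ⊥-elim (n (nodbl ku' r rz' us' uz'))
          ... | inj₂ r = diff-in U R (closed (KU ku') us') r
          dn : ∀ {s'} → u' ~ s' → K R ∋ s' → del (K R) u' ∋ s'
          dn us' ks' = del-in (K R) u' (λ e → ~⇒≢ us' (sym e)) ks'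
          descend : ∀ {s'} → u' ~ s' → K R ∋ s' → (X' : Comp (del (K R) u') s') → Comp.C X' ∌ u → Cert U ⊎ Smaller R
          descend {s'} us' ks' X' nu = select k ku' rz' uz' ks' us' X'
              (≤-pred (≤-trans (s≤s (size-mono {X'.C} {del X.C u'} (λ v xv → del-in X.C u' (≢u' xv) (inX xv))))
                (≤-trans (≤-reflexive (sym (size-del X.C u' xu'))) le)))
            where
            module X' = Comp X'
            ≢u' : ∀ {v} → X'.C ∋ v → v ≢ u'
            ≢u' xv = proj₁ (del-inv (K R) u' (X'.⊆W xv))
            stay : ∀ {v w} → X.C ∋ v → X'.C ∋ w → v ~ w → X.C ∋ w
            stay {v} {w} xv xw vw = X.clo xv (del-in (K R) u (λ { refl → t≢f xw nu }) (proj₂ (del-inv (K R) u' {w} (X'.⊆W xw)))) vw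
            inX : ∀ {v} → X'.C ∋ v → X.C ∋ v
            inX xv = X'.conn X.C (λ _ dw vw sv → stay sv dw vw) X'.root xv (stay xu' X'.root us')
          at : Cert U ⊎ Smaller R
          at with secondNbr (KU ku') uz'
          ... | s' , us' , s'z with thirdNbr (KU ku') uz' us' (λ e → s'z (sym e))
          ...   | t' , ut' , t'z , t's = pick (bool? (X'.C u)) (bool? (X''.C u))
            where
            X' = comp (del (K R) u') (dn us' (kn us' s'z))
            X'' = comp (del (K R) u') (dn ut' (kn ut' t'z))
            module X' = Comp X'
            module X'' = Comp X''
            pick : X'.C ∋ u ⊎ X'.C ∌ u → X''.C ∋ u ⊎ X''.C ∌ u → Cert U ⊎ Smaller R
            pick (inj₂ nu) _ = descend us' (kn us' s'z) X' nu
            pick (inj₁ _) (inj₂ nu) = descend ut' (kn ut' t'z) X'' nu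
            pick (inj₁ xu) (inj₁ xu'') = closeAt ku' rz' uz'
              (conn-del-nbr ku' rz' (is₃ uz' us' ut' (λ e → s'z (sym e)) t'z t's) X'
                (X''.conn X'.C (λ _ dw vw sv → X'.clo sv (X''.⊆W dw) vw) xu'' X''.root xu))
        by : X.C ∋ t ⊎ X.C ∌ t → Cert U ⊎ Smaller R
        by (inj₁ xt) = closeAt ku rz uz (conn-del-nbr ku rz isu X xt)
        by (inj₂ xt) with any? (λ u' → (X.C ∋? u') ×-dec any? (λ z' → (R ∋? z') ×-dec (u' ~? z')))
        ... | yes (u' , xu' , z' , rz' , uz') = Ring'.at xu' rz' uz'
        ... | no q = inj₁ (Bridge.bridge (KU ku) (λ xv → KU (KX xv)) X.root Xu us X.conn edge)
          where
          edge : ∀ {v w} → X.C ∋ v → v ~ w → X.C ∌ w → v ≡ s × w ≡ u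
          edge {v} {w} xv vw xw with bool? (R w)
          ... | inj₁ rw = ⊥-elim (q (v , xv , w , rw , vw))
          ... | inj₂ rw with w ≟ u
          ...   | no n = ⊥-elim (t≢f (X.clo xv (del-in (K R) u n (diff-in U R (closed (KU (KX xv)) vw) rw)) vw) xw)
          ...   | yes refl with isu (~-sym vw)
          ...     | inj₁ refl = ⊥-elim (t≢f rz (outK (KX xv)))
          ...     | inj₂ (inj₁ refl) = refl , refl
          ...     | inj₂ (inj₂ refl) = ⊥-elim (t≢f xv xt)

-- Vertices of the connected part with several neighbours in `R`

does-true : ∀ {P : Set} (d : Dec P) → does d ≡ true → P
does-true (yes p) _ = p

OneOf : ∀ {n} → Fin n → Fin n → Fin n → Fin n → Set
OneOf x y z v = v ≡ x ⊎ v ≡ y ⊎ v ≡ z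

oneOf? : ∀ {n} (x y z v : Fin n) → Dec (OneOf x y z v)
oneOf? x y z v = (v ≟ x) ⊎-dec ((v ≟ y) ⊎-dec (v ≟ z))

index : ∀ {n} → Fin n → Fin n → Fin n → Tri
index x y v = if does (v ≟ x) then t₀ else if does (v ≟ y) then t₁ else t₂

index-inj : ∀ {n} {x y z v w : Fin n} → OneOf x y z v → OneOf x y z w → index x y v ≡ index x y w → v ≡ w
index-inj {n} {x} {y} {z} p q e = trans (sym (at-index p)) (trans (cong at e) (at-index q))
  where
  at : Tri → Fin n
  at t₀ = x
  at t₁ = y
  at t₂ = z
  at-index : ∀ {v} → OneOf x y z v → at (index x y v) ≡ v
  at-index {v} p with v ≟ x
  ... | yes e = sym e
  ... | no n₁ with v ≟ y
  ...   | yes e = sym e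
  at-index (inj₁ e) | no n₁ | no n₂ = ⊥-elim (n₁ e)
  at-index (inj₂ (inj₁ e)) | no n₁ | no n₂ = ⊥-elim (n₂ e)
  at-index (inj₂ (inj₂ e)) | no n₁ | no n₂ = sym e

module Refining {n : ℕ} (H : Subcubic n) (U : Fin n → Bool)
               (closed : ∀ {v w} → U v ≡ true → Subcubic.adj H v w ≡ true → U w ≡ true)
               (conU : SubcubicGraph.Conn H U)
               (cubic : ∀ {v} → U v ≡ true → Counting.Three~ H v) where
  open Selecting H U closed conU cubic public

  size-cong : ∀ {D E : Sub} → (∀ v → D v ≡ E v) → size D ≡ size E
  size-cong eq = sum-cong (λ v → cong ind (eq v))

  e₂-cong : ∀ {D E : Sub} → (∀ v → D v ≡ E v) → e₂ D ≡ e₂ E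
  e₂-cong {D} {E} eq = sum-cong pt
    where
    pt : ∀ v → (if D v then deg D v else 0) ≡ (if E v then deg E v else 0)
    pt v rewrite eq v = cong (λ d → if E v then d else 0) (sum-cong (λ u → cong (λ b → ind (b ∧ adj v u)) (eq u)))

  del-add : ∀ (D : Sub) e → D ∌ e → ∀ v → del (add D e) e v ≡ D v
  del-add D e de v with v ≟ e
  ... | yes refl = sym de
  ... | no _ = refl

  add-del : ∀ (D : Sub) v → D ∋ v → ∀ x → add (del D v) v x ≡ D x
  add-del D v dv x with x ≟ v
  ... | yes refl = sym dv
  ... | no _ = refl

  module Double {R : Sub} (T : Terminal R) {e g h : V} (ke : K R ∋ e) (rg : R ∋ g) (rh : R ∋ h)
                (eg : e ~ g) (eh : e ~ h) (g≢h : g ≢ h) where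
    open Surplus (Terminal.gs T)

    K≢R : ∀ {u v} → R ∌ u → R ∋ v → u ≢ v
    K≢R ku rv refl = t≢f rv ku

    Re : R ∌ e
    Re = outK T ke

    -- With all its neighbours in `R`, `e` is alone in the connected set `K R`. Every vertex of `R`
    -- has a neighbour in `K R`, so it is a neighbour of `e`: the component is K₄.
    module AllR {i : V} (ei : e ~ i) (ig : i ≢ g) (ih : i ≢ h) (ri : R ∋ i) where
      ise : ∀ {v} → e ~ v → OneOf g h i v
      ise = is₃ eg eh ei g≢h ig ih

      only-e : ∀ {v} → K R ∋ v → v ≡ e
      only-e {v} kv with v ≟ e
      ... | yes q = q
      ... | no q with conn-nbr (K R) conK ke kv (λ x → q (sym x))
      ...   | u , ku , eu with ise eu
      ...     | inj₁ refl = ⊥-elim (t≢f rg (outK T ku))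
      ...     | inj₂ (inj₁ refl) = ⊥-elim (t≢f rh (outK T ku))
      ...     | inj₂ (inj₂ refl) = ⊥-elim (t≢f ri (outK T ku))

      γ : V → Col
      γ v = if does (v ≟ e) then B false else A (index g h v)

      oneOf : ∀ {v} → U ∋ v → v ≢ e → OneOf g h i v
      oneOf {v} uv ve with bool? (R v)
      ... | inj₂ rv = ⊥-elim (ve (only-e (diff-in U R uv rv)))
      ... | inj₁ rv = ise (~-sym (subst (v ~_) (only-e (inK T rv vo Ro)) vo))
        where open RingAt (ringAt T rv)

      γ-inj : ∀ {v w} → U ∋ v → U ∋ w → γ v ≡ γ w → v ≡ w
      γ-inj {v} {w} uv uw q with v ≟ e | w ≟ e
      ... | yes p | yes p' = trans p (sym p')
      ... | no p | no p' = index-inj (oneOf uv p) (oneOf uw p') (A-inj q)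
      γ-inj uv uw () | yes _ | no _
      γ-inj uv uw () | no _ | yes _

      cert : Cert U
      cert = labelCert γ γ-inj

    module TwoR {w : V} (ew : e ~ w) (wg : w ≢ g) (wh : w ≢ h) (Rw : R ∌ w) where
      kw : K R ∋ w
      kw = diff-in U R (closed (KU T ke) ew) Rw

      ise : ∀ {v} → e ~ v → OneOf g h w v
      ise = is₃ eg eh ew g≢h wg wh

      iseR : ∀ {v} → e ~ v → R ∋ v → v ≡ g ⊎ v ≡ h
      iseR ev rv with ise ev
      ... | inj₁ q = inj₁ q
      ... | inj₂ (inj₁ q) = inj₂ q
      ... | inj₂ (inj₂ refl) = ⊥-elim (t≢f rv Rw)

      conDel : Conn (del (K R) e)
      conDel = conn-del₁ (K R) conK ke kw ew (λ ku eu → uniq ku (ise eu))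
        where
        uniq : ∀ {u} → K R ∋ u → OneOf g h w u → u ≡ w
        uniq ku (inj₁ refl) = ⊥-elim (t≢f rg (outK T ku))
        uniq ku (inj₂ (inj₁ refl)) = ⊥-elim (t≢f rh (outK T ku))
        uniq ku (inj₂ (inj₂ q)) = q

      -- Exchanging e with a vertex v of R keeps the size and the number of inner edges of R.
      module Swap {v : V} (rv : R ∋ v) (ev : ¬ e ~ v) where
        R₁ : Sub
        R₁ = add (del R v) e
        De : del R v ∌ e
        De = del-∌ˡ R v Re
        R₁old : ∀ {x} → R ∋ x → x ≢ v → R₁ ∋ x
        R₁old rx n = add-old (del R v) e (del-in R v n rx)
        R₁e : R₁ ∋ e
        R₁e = add-new (del R v) e
        R₁v : R₁ ∌ v
        R₁v = add-∌ (del R v) e (λ q → K≢R Re rv (sym q)) (del-self R v)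
        R₁out : ∀ {x} → R ∌ x → x ≢ e → R₁ ∌ x
        R₁out rx n = add-∌ (del R v) e n (del-∌ˡ R v rx)
        R₁inv : ∀ {x} → R₁ ∋ x → x ≡ e ⊎ (x ≢ v × R ∋ x)
        R₁inv p with add-inv (del R v) e p
        ... | inj₁ q = inj₁ q
        ... | inj₂ q = inj₂ (del-inv R v q)
        K₁ : ∀ x → del (K R) e x ≡ del (K R₁) v x
        K₁ x with x ≟ e | x ≟ v
        ... | yes refl | yes refl = refl
        ... | yes refl | no _ = sym (Bool.∧-zeroʳ (U x))
        ... | no _ | yes refl rewrite rv = Bool.∧-zeroʳ (U x)
        ... | no _ | no _ = refl
        size₁ : size R₁ ≡ size R
        size₁ = trans (size-del R₁ e R₁e) (trans (cong suc (size-cong (del-add (del R v) e De))) (sym (size-del R v rv)))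
        deg₁ : deg R₁ e ≡ 2
        deg₁ = trans (deg-three R₁ three) (cong₂ _+_ (cong ind (R₁old rg (λ { refl → ev eg })))
                 (cong₂ _+_ (cong ind (R₁old rh (λ { refl → ev eh }))) (cong ind (R₁out Rw (λ q → ~⇒≢ ew (sym q))))))
          where
          three : Three~ e
          three = record { x = g ; y = h ; z = w ; vx = eg ; vy = eh ; vz = ew ; x≢y = g≢h
                         ; x≢z = λ q → wg (sym q) ; y≢z = λ q → wh (sym q) }
        e₂₁ : e₂ R₁ ≡ e₂ R
        e₂₁ = trans (e₂-del R₁ e R₁e) (trans (cong₂ _+_ (e₂-cong (del-add (del R v) e De))
                (trans (cong (λ d → d + d) deg₁) (sym (cong (λ d → d + d) (Terminal.two T rv))))) (sym (e₂-del R v rv)))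
        rv' = ringAt T rv
        module rv' = RingAt rv'
        o≢e : rv'.o ≢ e
        o≢e q = ev (~-sym (subst (v ~_) q rv'.vo))
        gs₁ : Surplus R₁
        gs₁ = record
          { sub = λ {x} p → Sum.[ (λ { refl → KU T ke }) , (λ q → sub (proj₂ q)) ]′ (R₁inv {x} p)
          -- `e` hangs on `w` only, so `K R` stays connected without it; `v` is then joined through
          -- its neighbour outside `R`, which is not `e`.
          ; conK = conn-ext (add-del (K R₁) v K₁v) (conn-add (del (K R₁) v) {v} (conn-ext K₁ conDel)
                     (trans (sym (K₁ rv'.o)) (del-in (K R) e o≢e (inK T rv rv'.vo rv'.Ro))) (~-sym rv'.vo))
          ; kne = w , diff-in U R₁ (KU T kw) (R₁out Rw (λ q → ~⇒≢ ew (sym q)))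
          ; ne = e , R₁e
          ; le = subst₂ _≤_ (cong (λ s → s + s) (sym size₁)) (sym e₂₁) le }
          where
          K₁v : K R₁ ∋ v
          K₁v = diff-in U R₁ (sub rv) R₁v
        back : Smaller R₁ → Smaller R
        back (R' , lt , gs) = R' , <-≤-trans lt (≤-reflexive size₁) , gs

      -- The exchange takes the neighbour `v` from `x` without giving it `e`, so `x` keeps fewer
      -- than two neighbours in `R₁` and `R₁` is not terminal. A set smaller than `R₁` is smaller
      -- than `R`, as the sizes agree.
      swap : ∀ {v x} → R ∋ v → ¬ e ~ v → R ∋ x → v ~ x → ¬ e ~ x → Smaller R
      swap {v} {x} rv ev rx vx ex = Sum.[ back , (λ T₁ → ⊥-elim (absurd T₁)) ]′ (terminal? gs₁)
        where
        open Swap rv ev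
        absurd : ¬ Terminal R₁
        absurd T₁ with otherR (ringAt T rx) (~-sym vx) rv
        ... | y , _ , _ , _ , is = p≢q (trans (is-y vp Rp) (sym (is-y vq Rq)))
          where
          open RingAt (ringAt {v = x} T₁ (R₁old rx (λ q → ~⇒≢ vx (sym q))))
          is-y : ∀ {u} → x ~ u → R₁ ∋ u → u ≡ y
          is-y {u} xu ru with R₁inv {u} ru
          ... | inj₁ refl = ⊥-elim (ex (~-sym xu))
          ... | inj₂ (n , ru') with is xu ru'
          ...   | inj₁ q = ⊥-elim (n q)
          ...   | inj₂ q = q

      module Near (near : ∀ {v x} → R ∋ v → ¬ e ~ v → R ∋ x → v ~ x → e ~ x) where
        rgg = ringAt T rg
        open RingAt rgg using () renaming (p to a; q to b; vp to ga; vq to gb; Rp to ra; Rq to rb; p≢q to a≢b; isR to isg)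
        module ra' = RingAt (ringAt T ra)
        module rb' = RingAt (ringAt T rb)
        σ τ : V
        σ = ra'.o
        τ = rb'.o

        -- Both neighbours of `v` in `R` are adjacent to `e`, and `e` has only `g` and `h` there.
        far : ∀ {v} → R ∋ v → ¬ e ~ v → v ~ g × v ~ h
        far {v} rv ev = both (iseR (near rv ev Rp vp) Rp) (iseR (near rv ev Rq vq) Rq) vp vq p≢q
          where
          open RingAt (ringAt T rv)
          both : ∀ {p q} → p ≡ g ⊎ p ≡ h → q ≡ g ⊎ q ≡ h → v ~ p → v ~ q → p ≢ q → v ~ g × v ~ h
          both (inj₁ refl) (inj₂ refl) x y _ = x , y
          both (inj₂ refl) (inj₁ refl) x y _ = y , x
          both (inj₁ refl) (inj₁ refl) x y ne = ⊥-elim (ne refl)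
          both (inj₂ refl) (inj₂ refl) x y ne = ⊥-elim (ne refl)

        -- Closing at `g` exempts one of the two edges from `e` to `R`, and `e` is not a cut vertex.
        -- Any other vertex of `K R` can only meet `R` in `a` or `b`, by `far`, and then equals `σ`
        -- or `τ` respectively.
        distinct : σ ≢ τ → Cert U ⊎ Smaller R
        distinct σ≢τ = closeOr T rg ke (~-sym eg) ra rb ga gb a≢b ra'.vo rb'.vo ra'.Ro rb'.Ro σ≢τ sgl conDel
          where
          is-h : ∀ {x} → e ~ x → R ∋ x → x ≢ g → x ≡ h
          is-h ex rx n with iseR ex rx
          ... | inj₁ q = ⊥-elim (n q)
          ... | inj₂ q = q
          ab : ∀ {u x} → K R ∋ u → u ≢ e → R ∋ x → u ~ x → (x ≡ a × u ≡ σ) ⊎ (x ≡ b × u ≡ τ)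
          ab {u} {x} ku n rx ux with isg (~-sym (proj₁ (far rx (λ ex → n (trans (isK (~-sym ux) (outK T ku)) (sym (isK (~-sym ex) Re))))))) rx
            where open RingAt (ringAt T rx)
          ... | inj₁ refl = inj₁ (refl , ra'.isK (~-sym ux) (outK T ku))
          ... | inj₂ refl = inj₂ (refl , rb'.isK (~-sym ux) (outK T ku))
          sgl : ∀ {u x y} → K R ∋ u → R ∋ x → R ∋ y → x ≢ g → y ≢ g → u ~ x → u ~ y → x ≡ y
          sgl {u} ku rx ry nx ny ux uy with u ≟ e
          ... | yes refl = trans (is-h ux rx nx) (sym (is-h uy ry ny))
          ... | no n with ab ku n rx ux | ab ku n ry uy
          ...   | inj₁ (q , _) | inj₁ (q' , _) = trans q (sym q')
          ...   | inj₂ (q , _) | inj₂ (q' , _) = trans q (sym q')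
          ...   | inj₁ (_ , q) | inj₂ (_ , q') = ⊥-elim (σ≢τ (trans (sym q) q'))
          ...   | inj₂ (_ , q) | inj₁ (_ , q') = ⊥-elim (σ≢τ (trans (sym q') q))

        module Equal (σ≡τ : σ ≡ τ) where
          -- Otherwise `e` would be the common vertex `σ ≡ τ`, and `a` and `b`, being neighbours of
          -- `e` in `R` different from `g`, would both be `h`.
          ea : ¬ e ~ a
          ea ex with iseR ex ra | iseR eb rb
            where
            eb : e ~ b
            eb = ~-sym (subst (b ~_) (trans (sym σ≡τ) (sym (ra'.isK (~-sym ex) Re))) rb'.vo)
          ... | inj₁ q | _ = ~⇒≢ ga (sym q)
          ... | inj₂ _ | inj₁ q = ~⇒≢ gb (sym q)
          ... | inj₂ q | inj₂ q' = a≢b (trans q (sym q'))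
          eb : ¬ e ~ b
          eb ex = ea (~-sym (subst (a ~_) (trans σ≡τ (sym (rb'.isK (~-sym ex) Re))) ra'.vo))
          ha : h ~ a
          ha = ~-sym (proj₂ (far ra ea))
          hb : h ~ b
          hb = ~-sym (proj₂ (far rb eb))
          aτ : a ~ τ
          aτ = subst (a ~_) σ≡τ ra'.vo
          e≢a : e ≢ a
          e≢a = K≢R Re ra
          e≢b : e ≢ b
          e≢b = K≢R Re rb
          nbr-h : ∀ {v} → h ~ v → OneOf a b e v
          nbr-h = is₃ ha hb (~-sym eh) a≢b e≢a e≢b
          nbr-b : ∀ {v} → b ~ v → OneOf g h τ v
          nbr-b = is₃ (~-sym gb) (~-sym hb) rb'.vo g≢h (K≢R rb'.Ro rg) (K≢R rb'.Ro rh)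

          -- After exchanging `a` and `e`, the cycle neighbours of `g` are `e` and `b`, whose
          -- neighbours in the new connected part are the distinct vertices `w` and `τ`. So the
          -- cycle can be closed at `g`, with root `a`.
          apart : w ≢ τ → Cert U ⊎ Smaller R
          apart w≢τ = Sum.[ (λ s → inj₂ (back s)) , (λ T₁ → Sum.map₂ back (closing T₁)) ]′ (terminal? gs₁)
            where
            open Swap ra ea
            key : ∀ {u x} → K R₁ ∋ u → R₁ ∋ x → x ≢ g → u ~ x → (x ≡ h × u ≡ a) ⊎ (x ≡ b × u ≡ τ) ⊎ (x ≡ e × u ≡ w)
            key {u} {x} ku rx n ux = which (R₁inv {x} rx)
              where
              out : ∀ {y} → R₁ ∋ y → u ≢ y
              out ry refl = t≢f ry (proj₂ (diff-inv U R₁ ku))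
              at-e : OneOf g h w u → u ≡ w
              at-e (inj₁ q) = ⊥-elim (out (R₁old rg (~⇒≢ ga)) q)
              at-e (inj₂ (inj₁ q)) = ⊥-elim (out (R₁old rh (~⇒≢ ha)) q)
              at-e (inj₂ (inj₂ q)) = q
              at-b : OneOf g h τ u → u ≡ τ
              at-b (inj₁ q) = ⊥-elim (out (R₁old rg (~⇒≢ ga)) q)
              at-b (inj₂ (inj₁ q)) = ⊥-elim (out (R₁old rh (~⇒≢ ha)) q)
              at-b (inj₂ (inj₂ q)) = q
              at-h : OneOf a b e u → u ≡ a
              at-h (inj₁ q) = q
              at-h (inj₂ (inj₁ q)) = ⊥-elim (out (R₁old rb (λ q → a≢b (sym q))) q)
              at-h (inj₂ (inj₂ q)) = ⊥-elim (out R₁e q)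
              which : x ≡ e ⊎ (x ≢ a × R ∋ x) → (x ≡ h × u ≡ a) ⊎ (x ≡ b × u ≡ τ) ⊎ (x ≡ e × u ≡ w)
              which (inj₁ refl) = inj₂ (inj₂ (refl , at-e (ise (~-sym ux))))
              which (inj₂ (na , rx)) with e ~? x
              ... | yes ex with iseR ex rx
              ...   | inj₁ q = ⊥-elim (n q)
              ...   | inj₂ refl = inj₁ (refl , at-h (nbr-h (~-sym ux)))
              which (inj₂ (na , rx)) | no ex with isg (~-sym (proj₁ (far rx ex))) rx
              ... | inj₁ q = ⊥-elim (na q)
              ... | inj₂ refl = inj₂ (inj₁ (refl , at-b (nbr-b (~-sym ux))))
            sgl : ∀ {u x y} → K R₁ ∋ u → R₁ ∋ x → R₁ ∋ y → x ≢ g → y ≢ g → u ~ x → u ~ y → x ≡ y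
            sgl ku rx ry nx ny ux uy with key ku rx nx ux | key ku ry ny uy
            ... | inj₁ (q , _) | inj₁ (q' , _) = trans q (sym q')
            ... | inj₂ (inj₁ (q , _)) | inj₂ (inj₁ (q' , _)) = trans q (sym q')
            ... | inj₂ (inj₂ (q , _)) | inj₂ (inj₂ (q' , _)) = trans q (sym q')
            ... | inj₁ (_ , q) | inj₂ (inj₁ (_ , q')) = ⊥-elim (K≢R rb'.Ro ra (trans (sym q') q))
            ... | inj₁ (_ , q) | inj₂ (inj₂ (_ , q')) = ⊥-elim (K≢R Rw ra (trans (sym q') q))
            ... | inj₂ (inj₁ (_ , q)) | inj₁ (_ , q') = ⊥-elim (K≢R rb'.Ro ra (trans (sym q) q'))
            ... | inj₂ (inj₂ (_ , q)) | inj₁ (_ , q') = ⊥-elim (K≢R Rw ra (trans (sym q) q'))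
            ... | inj₂ (inj₁ (_ , q)) | inj₂ (inj₂ (_ , q')) = ⊥-elim (w≢τ (trans (sym q') q))
            ... | inj₂ (inj₂ (_ , q)) | inj₂ (inj₁ (_ , q')) = ⊥-elim (w≢τ (trans (sym q) q'))
            closing : Terminal R₁ → Cert U ⊎ Smaller R₁
            closing T₁ = closeOr T₁ (R₁old rg (~⇒≢ ga)) (diff-in U R₁ (sub ra) R₁v) ga R₁e (R₁old rb (λ q → a≢b (sym q)))
              (~-sym eg) gb e≢b ew rb'.vo (R₁out Rw (λ q → ~⇒≢ ew (sym q))) (R₁out rb'.Ro (λ q → eb (~-sym (subst (b ~_) q rb'.vo))))
              w≢τ sgl (conn-ext K₁ conDel)

          -- The component is complete bipartite with parts g, h, τ and a, b, e.
          k₃₃ : w ≡ τ → Cert U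
          k₃₃ w≡τ = bipartiteCert (adj g) i sd i-inj
            where
            P Q : V → Set
            P = OneOf g h τ
            Q = OneOf a b e
            eτ : e ~ τ
            eτ = subst (e ~_) w≡τ ew
            row : ∀ {v} → P v → v ~ a × v ~ b × v ~ e
            row (inj₁ refl) = ga , gb , ~-sym eg
            row (inj₂ (inj₁ refl)) = ha , hb , ~-sym eh
            row (inj₂ (inj₂ refl)) = ~-sym aτ , ~-sym rb'.vo , ~-sym eτ
            PQ~ : ∀ {v w} → P v → Q w → v ~ w
            PQ~ p (inj₁ refl) = proj₁ (row p)
            PQ~ p (inj₂ (inj₁ refl)) = proj₁ (proj₂ (row p))
            PQ~ p (inj₂ (inj₂ refl)) = proj₂ (proj₂ (row p))
            nbr-P : ∀ {v w} → P v → v ~ w → Q w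
            nbr-P p = is₃ (proj₁ (row p)) (proj₁ (proj₂ (row p))) (proj₂ (proj₂ (row p))) a≢b e≢a e≢b
            nbr-Q : ∀ {v w} → Q v → v ~ w → P w
            nbr-Q q = is₃ (~-sym (PQ~ (inj₁ refl) q)) (~-sym (PQ~ (inj₂ (inj₁ refl)) q)) (~-sym (PQ~ (inj₂ (inj₂ refl)) q))
                        g≢h (K≢R rb'.Ro rg) (K≢R rb'.Ro rh)
            mem? : ∀ v → Dec (P v ⊎ Q v)
            mem? v = oneOf? g h τ v ⊎-dec oneOf? a b e v
            mem : ∀ {v} → U ∋ v → P v ⊎ Q v
            mem {v} uv = does-true (mem? v) (conU (λ v → does (mem? v))
                           (λ {v} {w} _ _ vw sv → dec-true (mem? w) (cl vw (does-true (mem? v) sv)))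
                           (sub rg) uv (dec-true (mem? g) (inj₁ (inj₁ refl))))
              where
              cl : ∀ {v w} → v ~ w → P v ⊎ Q v → P w ⊎ Q w
              cl vw (inj₁ p) = inj₂ (nbr-P p vw)
              cl vw (inj₂ q) = inj₁ (nbr-Q q vw)
            sideQ : ∀ {v} → Q v → adj g v ≡ true
            sideQ = PQ~ (inj₁ refl)
            sideP : ∀ {v} → P v → adj g v ≡ false
            sideP {v} p with bool? (adj g v)
            ... | inj₁ q = ⊥-elim (~⇒≢ (PQ~ p (nbr-P (inj₁ refl) q)) refl)
            ... | inj₂ q = q
            i : V → Tri
            i v = if adj g v then index a b v else index g h v
            sd : ∀ {v w} → U ∋ v → v ~ w → adj g v ≢ adj g w
            sd uv vw q with mem uv
            ... | inj₁ p = t≢f (sideQ (nbr-P p vw)) (trans (sym q) (sideP p))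
            ... | inj₂ p = t≢f (sideQ p) (trans q (sideP (nbr-Q p vw)))
            i-inj : ∀ {v w} → U ∋ v → U ∋ w → adj g v ≡ adj g w → i v ≡ i w → v ≡ w
            i-inj uv uw s q with mem uv | mem uw
            ... | inj₁ p | inj₂ p' = ⊥-elim (t≢f (sideQ p') (trans (sym s) (sideP p)))
            ... | inj₂ p | inj₁ p' = ⊥-elim (t≢f (sideQ p) (trans s (sideP p')))
            ... | inj₁ p | inj₁ p' rewrite sideP p | sideP p' = index-inj p p' q
            ... | inj₂ p | inj₂ p' rewrite sideQ p | sideQ p' = index-inj p p' q

          result : Cert U ⊎ Smaller R
          result with w ≟ τ
          ... | yes q = inj₁ (k₃₃ q)
          ... | no q = apart q

        result : Cert U ⊎ Smaller R
        result with σ ≟ τ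
        ... | yes q = Equal.result q
        ... | no q = distinct q

      result : Cert U ⊎ Smaller R
      result with any? (λ v → (R ∋? v) ×-dec (¬? (e ~? v) ×-dec any? (λ x → (R ∋? x) ×-dec ((v ~? x) ×-dec ¬? (e ~? x)))))
      ... | yes (v , rv , ev , x , rx , vx , ex) = inj₂ (swap rv ev rx vx ex)
      ... | no q = Near.result near
        where
        near : ∀ {v x} → R ∋ v → ¬ e ~ v → R ∋ x → v ~ x → e ~ x
        near {v} {x} rv ev rx vx with e ~? x
        ... | yes p = p
        ... | no p = ⊥-elim (q (v , rv , ev , x , rx , vx , p))

    result : Cert U ⊎ Smaller R
    result with thirdNbr (KU T ke) eg eh g≢h
    ... | w , ew , wg , wh with bool? (R w)
    ...   | inj₁ rw = inj₁ (AllR.cert ew wg wh rw)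
    ...   | inj₂ rw = TwoR.result ew wg wh rw

  improve : ∀ {R} → Terminal R → Cert U ⊎ Smaller R
  improve {R} T with any? (λ e → (K R ∋? e) ×-dec any? (λ g → (R ∋? g) ×-dec ((e ~? g) ×-dec
                        any? (λ h → (R ∋? h) ×-dec ((e ~? h) ×-dec ¬? (g ≟ h))))))
  ... | yes (e , ke , g , rg , eg , h , rh , eh , g≢h) = Double.result T ke rg rh eg eh g≢h
  ... | no q with Surplus.ne (Terminal.gs T)
  ...   | z , rz with ringAt T rz
  ...     | rg with secondNbr (KU T (inK T rz (RingAt.vo rg) (RingAt.Ro rg))) (~-sym (RingAt.vo rg))
  ...       | s , os , sz = Select.select T nodbl (size (Comp.C X)) ko rz (~-sym vo) ks os X ≤-refl
    where
    open RingAt rg using (o; vo; Ro)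
    nodbl : ∀ {u w w'} → K R ∋ u → R ∋ w → R ∋ w' → u ~ w → u ~ w' → w ≡ w'
    nodbl {u} {w} {w'} ku rw rw' uw uw' with w ≟ w'
    ... | yes p = p
    ... | no p = ⊥-elim (q (u , ku , w , rw , uw , w' , rw' , uw' , p))
    ko : K R ∋ o
    ko = inK T rz vo Ro
    ks : K R ∋ s
    ks with bool? (R s)
    ... | inj₁ r = ⊥-elim (sz (nodbl ko r rz os (~-sym vo)))
    ... | inj₂ r = diff-in U R (closed (KU T ko) os) r
    X : Comp (del (K R) o) s
    X = comp (del (K R) o) (del-in (K R) o (λ e → ~⇒≢ os (sym e)) ks)

  refine : ∀ k {R} → size R ≤ k → Surplus R → Cert U
  shrink : ∀ k {R} → size R ≤ k → Smaller R → Cert U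
  refine k le gs = Sum.[ shrink k le , (λ T → Sum.[ (λ c → c) , shrink k le ]′ (improve T)) ]′ (terminal? gs)
  shrink zero le (R' , lt , gs) with ≤-trans lt le
  ... | ()
  shrink (suc k) le (R' , lt , gs) = refine k (≤-pred (≤-trans lt le)) gs

  -- The start is a single vertex `k₀` as connected part. The other `s` vertices span
  -- `3 (s + 1) / 2 - 3` edges, at least `s` because the neighbours of `k₀` give `s ≥ 3`.
  cubicCert : ∀ {k₀} → U ∋ k₀ → Cert U
  cubicCert {k₀} uk = refine (size R) ≤-refl (record
    { sub = λ p → proj₂ (del-inv U k₀ p)
    ; conK = conn-ext K-only (only-conn k₀)
    ; kne = k₀ , trans (sym (K-only k₀)) (only-self k₀)
    ; ne = t.x , del-in U k₀ (λ q → ~⇒≢ t.vx (sym q)) (closed uk t.vx)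
    ; le = le })
    where
    R : Sub
    R = del U k₀
    module t = Three~ (cubic uk)
    K-only : ∀ v → only k₀ v ≡ K R v
    K-only v with v ≟ k₀
    ... | yes refl rewrite uk = refl
    ... | no _ with U v
    ...   | true = refl
    ...   | false = refl
    degU : ∀ {v} → U ∋ v → deg U v ≡ 3
    degU uv = trans (deg-three U (cubic uv)) (cong₂ _+_ (cong ind (closed uv vx))
                (cong₂ _+_ (cong ind (closed uv vy)) (cong ind (closed uv vz))))
      where open Three~ (cubic uv)
    e₂U : e₂ U ≡ size U + (size U + size U)
    e₂U = trans (sum-cong pt) (trans (sum-+ (λ v → ind (U v)) _) (cong (size U +_) (sum-+ (λ v → ind (U v)) _)))
      where
      pt : ∀ v → (if U v then deg U v else 0) ≡ ind (U v) + (ind (U v) + ind (U v))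
      pt v with U v in uv
      ... | true = degU uv
      ... | false = refl
    s = size R
    3≤s : 3 ≤ s
    3≤s = ≤-trans (≤-reflexive (sym (degU uk))) (sum-mono pt)
      where
      pt : ∀ u → ind (U u ∧ adj k₀ u) ≤ ind (R u)
      pt u with u ≟ k₀
      ... | yes refl rewrite irr u | Bool.∧-zeroʳ (U u) = z≤n
      ... | no _ with U u | adj k₀ u
      ...   | true | true = ≤-refl
      ...   | true | false = z≤n
      ...   | false | _ = z≤n
    count : e₂ R + 6 ≡ suc s + (suc s + suc s)
    count = trans (cong (λ d → e₂ R + (d + d)) (sym (degU uk))) (trans (sym (e₂-del U k₀ uk))
              (trans e₂U (cong (λ m → m + (m + m)) (size-del U k₀ uk))))
    le : s + s ≤ e₂ R
    le = +-cancelʳ-≤ 6 _ _ (≤-trans (≤-reflexive (solve 1 (λ s → s :+ s :+ con 6 := s :+ s :+ con 3 :+ con 3) refl s))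
           (≤-trans (+-monoʳ-≤ (s + s + 3) 3≤s) (≤-reflexive (trans (regroup s) (sym count)))))
      where
      open +-*-Solver
      regroup : ∀ s → s + s + 3 + s ≡ suc s + (suc s + suc s)
      regroup = solve 1 (λ s → s :+ s :+ con 3 :+ s := (con 1 :+ s) :+ ((con 1 :+ s) :+ (con 1 :+ s))) refl

-- Components and translation to strong edge colourings

module Whole {n : ℕ} (H : Subcubic n) where
  open Counting H
  open Certificates H
  module Free = Recursion H (λ _ _ → ⊤) (λ _ → true , tt) (λ _ _ _ → true , tt , tt)

  offCert : ∀ {D r p M a b} → Off D r p M a b → Cert D
  offCert o = record { c = c ; dist = dist ; inn = inn }
    where open Off o

  three? : ∀ v → Dec (Three~ v)
  three? v with any? (λ x → any? (λ y → any? (λ z → ((v ~? x) ×-dec ((v ~? y) ×-dec (v ~? z)))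
                  ×-dec (¬? (x ≟ y) ×-dec (¬? (x ≟ z) ×-dec ¬? (y ≟ z))))))
  ... | yes (x , y , z , (vx , vy , vz) , x≢y , x≢z , y≢z) = yes (record
          { x = x ; y = y ; z = z ; vx = vx ; vy = vy ; vz = vz ; x≢y = x≢y ; x≢z = x≢z ; y≢z = y≢z })
  ... | no q = no (λ t → let open Three~ t in q (x , y , z , (vx , vy , vz) , x≢y , x≢z , y≢z))

  componentCert : ∀ (U : Sub) {k} → U ∋ k → (∀ {v w} → U ∋ v → v ~ w → U ∋ w) → Conn U → Cert U
  componentCert U uk closed con with any? (λ v → (U ∋? v) ×-dec ¬? (three? v))
  -- A root of degree at most two is taken as its own parent; it is not adjacent to itself, so the
  -- parent edge does not exist.
  ... | yes (v , uv , q) = Sum.[ offCert , (λ f → offCert (f true)) ]′ (Free.Solution.cap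
          (Free.solve (size U) U ≤-refl con uv two (λ _ vv → ~⇒≢ vv refl) true))
    where
    two : TwoBut v v
    two vx vy vz _ _ _ x≢y x≢z y≢z = q (record
      { vx = vx ; vy = vy ; vz = vz ; x≢y = x≢y ; x≢z = x≢z ; y≢z = y≢z })
  ... | no q = Refining.cubicCert H U closed con (λ {v} uv → decidable-stable (three? v) (λ nt → q (v , uv , nt))) uk

  closedCert : ∀ k (W : Sub) → size W ≤ k → (∀ {v w} → W ∋ v → v ~ w → W ∋ w) → Cert W
  closedCert k W le closed with any? (W ∋?_)
  ... | no q = record { c = λ _ _ → A t₀ ; dist = λ wv → ⊥-elim (q (_ , wv)) ; inn = λ wv → ⊥-elim (q (_ , wv)) }
  closedCert zero W le closed | yes (v , wv) with ≤-trans (≤-reflexive (sym (size-del W v wv))) le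
  ... | ()
  closedCert (suc k) W le closed | yes (v , wv) = record { c = c ; dist = dist ; inn = inn }
    where
    open Comp (comp W wv)
    W' : Sub
    W' = diff W C
    C-closed : ∀ {v w} → C ∋ v → v ~ w → C ∋ w
    C-closed cv vw = clo cv (closed (⊆W cv) vw) vw
    less : ∀ x → W' ∋ x → del W v ∋ x
    less x p with diff-inv W C p
    ... | wx , cx = del-in W v (λ { refl → t≢f root cx }) wx
    W'-closed : ∀ {v w} → W' ∋ v → v ~ w → W' ∋ w
    W'-closed p vw = diff-in W C (closed (proj₁ (diff-inv W C p)) vw)
      (¬∋⇒∌ C (λ cw → t≢f (C-closed cw (~-sym vw)) (proj₂ (diff-inv W C p))))
    cert₁ : Cert C
    cert₁ = componentCert C root C-closed conn
    cert₂ : Cert W'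
    cert₂ = closedCert k W' (≤-pred (≤-trans (s≤s (size-mono {W'} {del W v} less))
                                       (≤-trans (≤-reflexive (sym (size-del W v wv))) le))) W'-closed
    module c₁ = Cert cert₁
    module c₂ = Cert cert₂
    c : Colouring
    c x = if C x then c₁.c x else c₂.c x
    dist : ∀ {v w w'} → W ∋ v → v ~ w → v ~ w' → c v w ≡ c v w' → w ≡ w'
    dist {v} wv vw vw' e with C v in cv
    ... | true = c₁.dist cv vw vw' e
    ... | false = c₂.dist (diff-in W C wv cv) vw vw' e
    inn : ∀ {v w u} → W ∋ v → W ∋ w → v ~ w → w ~ u → c v w ≢ c w u
    inn {v} {w} wv ww vw wu e with C v in cv | C w in cw
    ... | true | true = c₁.inn cv cw vw wu e
    ... | false | false = c₂.inn (diff-in W C wv cv) (diff-in W C ww cw) vw wu e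
    ... | true | false = t≢f (C-closed cv vw) cw
    ... | false | true = t≢f (C-closed cw (~-sym vw)) cv

  cert : Cert (λ _ → true)
  cert = closedCert (size (λ _ → true)) (λ _ → true) ≤-refl (λ _ _ → refl)

-- From arc colourings back to strong edge colourings

code : Col → Fin 5
code (A t₀) = # 0
code (A t₁) = # 1
code (A t₂) = # 2
code (B true) = # 3
code (B false) = # 4

code-inj : ∀ {x y} → code x ≡ code y → x ≡ y
code-inj {x} {y} e = trans (sym (decode-code x)) (trans (cong decode e) (decode-code y))
  where
  decode : Fin 5 → Col
  decode zero = A t₀
  decode (suc zero) = A t₁
  decode (suc (suc zero)) = A t₂
  decode (suc (suc (suc zero))) = B true
  decode (suc (suc (suc (suc zero)))) = B false
  decode-code : ∀ x → decode (code x) ≡ x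
  decode-code (A t₀) = refl
  decode-code (A t₁) = refl
  decode-code (A t₂) = refl
  decode-code (B true) = refl
  decode-code (B false) = refl

length-filter : ∀ {n m} (f : Fin m → Bool) (g : Fin n → Fin m) →
                length (filter (λ w → Bool.T? (f w)) (tabulate g)) ≡ sumF (λ i → ind (f (g i)))
length-filter {zero} f g = refl
length-filter {suc n} f g with f (g zero)
... | true = cong suc (length-filter f (λ i → g (suc i)))
... | false = length-filter f (λ i → g (suc i))

T→≡ : ∀ {b} → T b → b ≡ true
T→≡ {true} _ = refl

≡→T : ∀ {b} → b ≡ true → T b
≡→T refl = tt

-- H has the vertices of G. Two vertices of Y with a common neighbour are adjacent in H, and a pendant
-- vertex of X stays a leaf; the edge of G between y and x is the arc of H from y to `other y x`.
module Translate {n : ℕ} (G : Defs.Graph n) (side : Fin n → Bool) (bip : IsBipartition G side)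
                 (deg₂ : ∀ v → side v ≡ true → degree G v ≤ 2) (deg₃ : ∀ v → side v ≡ false → degree G v ≤ 3)
                 (noC4 : ¬ HasC4 G) where
  open Subsets {n}

  E : V → V → Set
  E u v = Defs.adj G u v ≡ true

  E? : ∀ u v → Dec (E u v)
  E? u v = Defs.adj G u v Bool.≟ true

  E-sym : ∀ {u v} → E u v → E v u
  E-sym {u} {v} e = trans (Defs.sym G v u) e

  sides : ∀ {u v} → E u v → side u ≢ side v
  sides e = bip _ _ (≡→T e)

  Ys Xs : V → Set
  Ys v = side v ≡ false
  Xs v = side v ≡ true

  Y≢X : ∀ {y x} → Ys y → Xs x → y ≢ x
  Y≢X sy sx refl = t≢f sx sy

  nbrX : ∀ {y x} → Ys y → E y x → Xs x
  nbrX {y} {x} sy e with bool? (side x)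
  ... | inj₁ q = q
  ... | inj₂ q = ⊥-elim (sides e (trans sy (sym q)))

  nbrY : ∀ {y x} → Xs x → E y x → Ys y
  nbrY {y} {x} sx e with bool? (side y)
  ... | inj₂ q = q
  ... | inj₁ q = ⊥-elim (sides e (trans q (sym sx)))

  size-suc : ∀ (D : Sub) {a k} → D ∋ a → k ≤ size (del D a) → suc k ≤ size D
  size-suc D {a} da le = ≤-trans (s≤s le) (≤-reflexive (sym (size-del D a da)))

  two-at-X : ∀ {x a b c} → Xs x → E x a → E x b → E x c → a ≢ b → a ≢ c → b ≢ c → ⊥
  two-at-X {x} {a} {b} {c} sx xa xb xc ab ac bc = <⇒≱ (s≤s (≤-refl {2})) (≤-trans
    (size-suc N xa (size-suc N₁ (del-in N a (≢-sym ab) xb)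
      (size-suc (del N₁ b) {c} (del-in N₁ b (≢-sym bc) (del-in N a (≢-sym ac) xc)) z≤n)))
    (≤-trans (≤-reflexive (sym (length-filter N (λ i → i)))) (deg₂ x sx)))
    where
    N N₁ : Sub
    N = Defs.adj G x
    N₁ = del N a

  three-at-Y : ∀ {y a b c d} → Ys y → E y a → E y b → E y c → E y d → a ≢ b → a ≢ c → a ≢ d → b ≢ c → b ≢ d → c ≢ d → ⊥
  three-at-Y {y} {a} {b} {c} {d} sy ya yb yc yd ab ac ad bc bd cd = <⇒≱ (s≤s (≤-refl {3})) (≤-trans
    (size-suc N ya (size-suc N₁ (del-in N a (≢-sym ab) yb) (size-suc N₂ (del-in N₁ b (≢-sym bc) (del-in N a (≢-sym ac) yc))
      (size-suc (del N₂ c) {d} (del-in N₂ c (≢-sym cd) (del-in N₁ b (≢-sym bd) (del-in N a (≢-sym ad) yd))) z≤n))))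
    (≤-trans (≤-reflexive (sym (length-filter N (λ i → i)))) (deg₃ y sy)))
    where
    N N₁ N₂ : Sub
    N = Defs.adj G y
    N₁ = del N a
    N₂ = del N₁ b

  Shared Pendant Near : V → V → Set
  Shared v w = v ≢ w × Ys v × ∃ λ x → E v x × E w x
  Pendant v w = Ys v × E v w × (∀ u → E u w → u ≡ v)
  Near v w = Shared v w ⊎ Pendant v w ⊎ Pendant w v

  shared? : ∀ v w → Dec (Shared v w)
  shared? v w = ¬? (v ≟ w) ×-dec ((side v Bool.≟ false) ×-dec any? (λ x → E? v x ×-dec E? w x))

  pendant? : ∀ v w → Dec (Pendant v w)
  pendant? v w = (side v Bool.≟ false) ×-dec (E? v w ×-dec all? (λ u → E? u w →-dec (u ≟ v)))

  near? : ∀ v w → Dec (Near v w)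
  near? v w = shared? v w ⊎-dec (pendant? v w ⊎-dec pendant? w v)

  near-sym : ∀ {v w} → Near v w → Near w v
  near-sym (inj₁ (vw , sv , x , vx , wx)) = inj₁ (≢-sym vw , nbrY (nbrX sv vx) wx , x , wx , vx)
  near-sym (inj₂ (inj₁ p)) = inj₂ (inj₂ p)
  near-sym (inj₂ (inj₂ p)) = inj₂ (inj₁ p)

  near-irr : ∀ {v} → ¬ Near v v
  near-irr (inj₁ (n , _)) = n refl
  near-irr (inj₂ (inj₁ (_ , e , _))) = sides e refl
  near-irr (inj₂ (inj₂ (_ , e , _))) = sides e refl

  -- Traces a neighbour of `y` in `H` back to an edge of `G` at `y`. This is injective because a
  -- vertex of X has at most two neighbours, so degrees in `H` are bounded by those in `G`.
  via : ∀ {y w} → Ys y → Near y w → ∃ λ x → E y x × ((w ≢ y × E w x) ⊎ (w ≡ x × (∀ u → E u x → u ≡ y)))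
  via sy (inj₁ (n , _ , x , yx , wx)) = x , yx , inj₁ (≢-sym n , wx)
  via sy (inj₂ (inj₁ (_ , e , all))) = _ , e , inj₂ (refl , all)
  via sy (inj₂ (inj₂ (sw , e , _))) = ⊥-elim (sides e (trans sw (sym sy)))

  via-inj : ∀ {y w w'} (sy : Ys y) (p : Near y w) (q : Near y w') → w ≢ w' → proj₁ (via sy p) ≢ proj₁ (via sy q)
  via-inj {y} sy p q n e with via sy p | via sy q
  via-inj sy p q n refl | x , yx , inj₁ (wy , wx) | _ , _ , inj₁ (wy' , wx') =
    two-at-X (nbrX sy yx) (E-sym yx) (E-sym wx) (E-sym wx') (≢-sym wy) (≢-sym wy') n
  via-inj sy p q n refl | x , yx , inj₁ (wy , wx) | _ , _ , inj₂ (_ , all) = wy (all _ wx)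
  via-inj sy p q n refl | x , yx , inj₂ (_ , all) | _ , _ , inj₁ (wy , wx) = wy (all _ wx)
  via-inj sy p q n refl | x , yx , inj₂ (e , _) | _ , _ , inj₂ (e' , _) = n (trans e (sym e'))

  H : Subcubic n
  H = record
    { adj = λ v w → does (near? v w)
    ; ~-symᵇ = λ v w → bool-ext (λ p → dec-true (near? w v) (near-sym (does-true (near? v w) p)))
                                (λ p → dec-true (near? v w) (near-sym (does-true (near? w v) p)))
    ; irr = λ v → ¬∋⇒∌ (λ v → does (near? v v)) {v} (λ p → near-irr (does-true (near? v v) p))
    ; deg≤3 = λ v p q r s → few (does-true (near? v _) p) (does-true (near? v _) q) (does-true (near? v _) r) (does-true (near? v _) s) }
    where
    few : ∀ {v a b c d} → Near v a → Near v b → Near v c → Near v d →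
          a ≢ b → a ≢ c → a ≢ d → b ≢ c → b ≢ d → c ≢ d → ⊥
    few {v} {a} {b} p q r s ab ac ad bc bd cd with bool? (side v)
    ... | inj₂ sv = three-at-Y sv (proj₁ (proj₂ (via sv p))) (proj₁ (proj₂ (via sv q))) (proj₁ (proj₂ (via sv r))) (proj₁ (proj₂ (via sv s)))
           (via-inj sv p q ab) (via-inj sv p r ac) (via-inj sv p s ad) (via-inj sv q r bc) (via-inj sv q s bd) (via-inj sv r s cd)
    -- A vertex of X has a neighbour in `H` only if it is pendant, and then only one.
    ... | inj₁ sv = ab (sym (only p q))
      where
      only : ∀ {w w'} → Near v w → Near v w' → w' ≡ w
      only (inj₁ (_ , sy , _)) _ = ⊥-elim (t≢f sv sy)
      only (inj₂ (inj₁ (sy , _))) _ = ⊥-elim (t≢f sv sy)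
      only (inj₂ (inj₂ _)) (inj₁ (_ , sy , _)) = ⊥-elim (t≢f sv sy)
      only (inj₂ (inj₂ _)) (inj₂ (inj₁ (sy , _))) = ⊥-elim (t≢f sv sy)
      only (inj₂ (inj₂ (_ , _ , all))) (inj₂ (inj₂ (_ , e , _))) = all _ e

  open SubcubicGraph H using (_~_)

  near→~ : ∀ {v w} → Near v w → v ~ w
  near→~ {v} {w} p = dec-true (near? v w) p

  partner? : ∀ y x → Dec (∃ λ u → E u x × u ≢ y)
  partner? y x = any? (λ u → E? u x ×-dec ¬? (u ≟ y))

  other : V → V → V
  other y x with partner? y x
  ... | yes (u , _) = u
  ... | no _ = x

  other-≡ : ∀ {y x u} → Xs x → E y x → E u x → u ≢ y → other y x ≡ u
  other-≡ {y} {x} {u} sx yx ux uy with partner? y x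
  ... | no q = ⊥-elim (q (u , ux , uy))
  ... | yes (w , wx , wy) with w ≟ u
  ...   | yes e = e
  ...   | no q = ⊥-elim (two-at-X sx (E-sym wx) (E-sym ux) (E-sym yx) q wy uy)

  other-~ : ∀ {y x} → Ys y → E y x → y ~ other y x
  other-~ {y} {x} sy yx with partner? y x
  ... | yes (u , ux , uy) = near→~ (inj₁ (≢-sym uy , sy , x , yx , ux))
  ... | no q = near→~ (inj₂ (inj₁ (sy , yx , all)))
    where
    all : ∀ u → E u x → u ≡ y
    all u ux with u ≟ y
    ... | yes e = e
    ... | no n = ⊥-elim (q (u , ux , n))

  -- Two vertices of X joining `y` to the same vertex would form a 4-cycle with them; their edges
  -- would need different colours on one arc.
  other-inj : ∀ {y x x'} → Ys y → E y x → E y x' → other y x ≡ other y x' → x ≡ x'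
  other-inj {y} {x} {x'} sy yx yx' e with partner? y x | partner? y x'
  ... | no _ | no _ = e
  ... | no _ | yes (u , ux , _) = ⊥-elim (Y≢X (nbrY (nbrX sy yx') ux) (nbrX sy yx) (sym e))
  ... | yes (u , ux , _) | no _ = ⊥-elim (Y≢X (nbrY (nbrX sy yx) ux) (nbrX sy yx') e)
  ... | yes (u , ux , uy) | yes (_ , ux' , _) with x ≟ x'
  ...   | yes q = q
  other-inj {y} {x} {x'} sy yx yx' refl | yes (u , ux , uy) | yes (_ , ux' , _) | no q =
    ⊥-elim (noC4 (y , x , u , x' , Y≢X sy (nbrX sy yx) , ≢-sym uy , Y≢X sy (nbrX sy yx') ,
      ≢-sym (Y≢X su (nbrX sy yx)) , q , Y≢X su (nbrX sy yx') , ≡→T yx , ≡→T (E-sym ux) , ≡→T ux' , ≡→T (E-sym yx')))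
    where
    su : Ys u
    su = nbrY (nbrX sy yx) ux

  open Certificates.Cert (Whole.cert H)

  κ : V → V → Col
  κ y x = c y (other y x)

  Touch : V → V → Set
  Touch p q = p ≡ q ⊎ E p q

  module _ {y x y' x' : V} (sy : Ys y) (sy' : Ys y') (yx : E y x) (yx' : E y' x') where
    sx : Xs x
    sx = nbrX sy yx
    sx' : Xs x'
    sx' = nbrX sy' yx'

    sameY : y ≡ y' → x ≢ x' → κ y x ≢ κ y' x'
    sameY refl n e = n (other-inj sy yx yx' (dist refl (other-~ sy yx) (other-~ sy yx') e))

    -- The two edges become the opposite arcs of one edge of `H`.
    sameX : x ≡ x' → y ≢ y' → κ y x ≢ κ y' x'
    sameX refl n e = inn {y} {y'} {y} refl refl (subst (y ~_) o (other-~ sy yx)) (subst (y' ~_) o' (other-~ sy' yx'))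
      (trans (sym (cong (c y) o)) (trans e (cong (c y') o')))
      where
      o : other y x ≡ y'
      o = other-≡ sx yx yx' (≢-sym n)
      o' : other y' x ≡ y
      o' = other-≡ sx yx' yx n

    -- The arc of `y'x'` ends at `y`, where the arc of `yx` begins.
    joined : E y x' → y ≢ y' → κ y x ≢ κ y' x'
    joined e n q = inn {y'} {y} {other y x} refl refl (subst (y' ~_) o (other-~ sy' yx')) (other-~ sy yx)
      (trans (sym (cong (c y') o)) (sym q))
      where
      o : other y' x' ≡ y
      o = other-≡ sx' yx' e n

  conflict : ∀ {y x y' x'} → Ys y → Ys y' → E y x → E y' x' → ¬ (y ≡ y' × x ≡ x') →
             ∀ {p q} → p ≡ y ⊎ p ≡ x → q ≡ y' ⊎ q ≡ x' → Touch p q → κ y x ≢ κ y' x'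
  conflict {y} {x} {y'} {x'} sy sy' yx yx' ne pp qq t with y ≟ y'
  ... | yes e = sameY sy sy' yx yx' e (λ e' → ne (e , e'))
  conflict sy sy' yx yx' ne (inj₁ refl) (inj₁ refl) (inj₁ e) | no n = ⊥-elim (n e)
  conflict sy sy' yx yx' ne (inj₁ refl) (inj₁ refl) (inj₂ e) | no n = ⊥-elim (sides e (trans sy (sym sy')))
  conflict sy sy' yx yx' ne (inj₁ refl) (inj₂ refl) (inj₁ e) | no n = ⊥-elim (Y≢X sy (nbrX sy' yx') e)
  conflict sy sy' yx yx' ne (inj₁ refl) (inj₂ refl) (inj₂ e) | no n = joined sy sy' yx yx' e n
  conflict sy sy' yx yx' ne (inj₂ refl) (inj₁ refl) (inj₁ e) | no n = ⊥-elim (Y≢X sy' (nbrX sy yx) (sym e))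
  conflict sy sy' yx yx' ne (inj₂ refl) (inj₁ refl) (inj₂ e) | no n = ≢-sym (joined sy' sy yx' yx (E-sym e) (≢-sym n))
  conflict sy sy' yx yx' ne (inj₂ refl) (inj₂ refl) (inj₁ e) | no n = sameX sy sy' yx yx' e n
  conflict sy sy' yx yx' ne (inj₂ refl) (inj₂ refl) (inj₂ e) | no n = ⊥-elim (sides e (trans (nbrX sy yx) (sym (nbrX sy' yx'))))

  colourᶜ : V → V → Col
  colourᶜ u v = if side u then κ v u else κ u v

  record Oriented (u v : V) : Set where
    field
      y x  : V
      sy   : Ys y
      yx   : E y x
      col  : colourᶜ u v ≡ κ y x
      ends : (u ≡ y × v ≡ x) ⊎ (u ≡ x × v ≡ y)
    fst : u ≡ y ⊎ u ≡ x
    fst = Sum.map proj₁ proj₁ ends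
    snd : v ≡ y ⊎ v ≡ x
    snd = Sum.swap (Sum.map proj₂ proj₂ ends)

  orient : ∀ {u v} → Adj G u v → Oriented u v
  orient {u} {v} e with bool? (side u)
  ... | inj₂ q = record { y = u ; x = v ; sy = q ; yx = T→≡ e
                        ; col = cong (λ b → if b then κ v u else κ u v) q ; ends = inj₁ (refl , refl) }
  ... | inj₁ q = record { y = v ; x = u ; sy = nbrY q (E-sym (T→≡ e)) ; yx = E-sym (T→≡ e)
                        ; col = cong (λ b → if b then κ v u else κ u v) q ; ends = inj₂ (refl , refl) }

  colouring : StrongChromaticIndex≤ G 5
  colouring = record
    { colour = λ u v _ → code (colourᶜ u v)
    ; colour-sym = λ u v e e' → cong code (symm u v e)
    ; strong = strong }
    where
    symm : ∀ u v → Adj G u v → colourᶜ u v ≡ colourᶜ v u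
    symm u v e with side u | side v | bip u v e
    ... | true | true | q = ⊥-elim (q refl)
    ... | true | false | q = refl
    ... | false | true | q = refl
    ... | false | false | q = ⊥-elim (q refl)
    same : ∀ {u v w z y x y' x' : V} → (u ≡ y × v ≡ x) ⊎ (u ≡ x × v ≡ y) → (w ≡ y' × z ≡ x') ⊎ (w ≡ x' × z ≡ y') →
           y ≡ y' × x ≡ x' → SameEdge u v w z
    same (inj₁ (refl , refl)) (inj₁ (refl , refl)) q = inj₁ q
    same (inj₁ (refl , refl)) (inj₂ (refl , refl)) q = inj₂ q
    same (inj₂ (refl , refl)) (inj₁ (refl , refl)) (q , q') = inj₂ (q' , q)
    same (inj₂ (refl , refl)) (inj₂ (refl , refl)) (q , q') = inj₁ (q' , q)
    strong : ∀ u v w z (e : Adj G u v) (f : Adj G w z) → ¬ SameEdge u v w z → WithinDistTwo G u v w z →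
             code (colourᶜ u v) ≢ code (colourᶜ w z)
    strong u v w z e f ns near q = touch near
      where
      module o = Oriented (orient e)
      module o' = Oriented (orient f)
      κ≡ : κ o.y o.x ≡ κ o'.y o'.x
      κ≡ = trans (sym o.col) (trans (code-inj q) o'.col)
      go : ∀ {p r} → p ≡ o.y ⊎ p ≡ o.x → r ≡ o'.y ⊎ r ≡ o'.x → Touch p r → ⊥
      go a b t = conflict o.sy o'.sy o.yx o'.yx (λ s → ns (same o.ends o'.ends s)) a b t κ≡
      touch : WithinDistTwo G u v w z → ⊥
      touch (inj₁ (inj₁ t)) = go o.fst o'.fst (inj₁ t)
      touch (inj₁ (inj₂ (inj₁ t))) = go o.fst o'.snd (inj₁ t)
      touch (inj₁ (inj₂ (inj₂ (inj₁ t)))) = go o.snd o'.fst (inj₁ t)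
      touch (inj₁ (inj₂ (inj₂ (inj₂ t)))) = go o.snd o'.snd (inj₁ t)
      touch (inj₂ (inj₁ t)) = go o.fst o'.fst (inj₂ (T→≡ t))
      touch (inj₂ (inj₂ (inj₁ t))) = go o.fst o'.snd (inj₂ (T→≡ t))
      touch (inj₂ (inj₂ (inj₂ (inj₁ t)))) = go o.snd o'.fst (inj₂ (T→≡ t))
      touch (inj₂ (inj₂ (inj₂ (inj₂ t)))) = go o.snd o'.snd (inj₂ (T→≡ t))

theorem6 : (n : ℕ) (G : Graph n) (side : Fin n → Bool) → IsBipartition G side
    → (∀ v → side v ≡ true → degree G v ≤ 2)
    → (∀ v → side v ≡ false → degree G v ≤ 3)
    → ¬ HasC4 G
    → StrongChromaticIndex≤ G 5
theorem6 n G side bip deg₂ deg₃ noC4 = Translate.colouring G side bip deg₂ deg₃ noC4
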